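{- Let $G=(V,E,w)$ be a weighted cactus graph with $n$ vertices and let $T_G$ be its tree representation. Given a positive integer $p$ and two non-negative integers $l$ and $u$ with $l\leq u$, the algorithm CactusPartitionPoly described in the context solves the decision $p$-$(l,u)$-partition problem (that is, it returns "yes" if $G$ has a $p$-$(l,u)$-partition and "no" otherwise) in time $\mathcal{O}(p^4n^2)$.
   Context: **Problem.** Graphs are connected. A cactus graph is a graph in which any two simple cycles have at most one vertex in common. Every vertex $v$ has a non-negative integer weight $w(v)$, and it is assumed that $w(v)\leq u$ for all $v\in V$ (otherwise no $p$-$(l,u)$-partition exists). A partition of $G$ is a partition of $V$ into disjoint connected subsets (clusters). The weight of a cluster is $w(V_i)=\sum_{v\in V_i}w(v)$. A $p$-$(l,u)$-partition is a partition into exactly $p$ clusters $V_1,\ldots,V_p$ with $l\leq w(V_i)\leq u$ for all $i$. **Tree representation.** A vertex of $G$ is a C-vertex if it has degree 2 and lies in exactly one cycle, a G-vertex if it lies in no cycle, and an H-vertex (hinge) otherwise. $G$ is rooted in a selected hinge $r$. The tree representation $T_G$ has one node for each G- and H-vertex, with the edges of $G$ that lie on no cycle, and one cycle node $c$ for each cycle $C$ of $G$; there is an edge between $c$ and the node $H_v$ of each H-vertex $v$ lying on $C$. $T_G$ is a tree, rooted in $r$. For a node $v$ of $T_G$, $c_v$ is the number of its children, $v_i$ is its $i$-th child, and $pred(v)$ is its parent. **Operations.** Put $d=u-l$. Interval partition sets are sets of tuples $([a,a'],k)$ with $[a,a']$ an interval and $k$ a positive integer. For two such sets, $I_1\oplus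 I_2=\{([a,a'],k_1+k_2) : [b,b']\cap[l,u]\neq\emptyset,\ k_1+k_2\leq p,\ ([a,a'],k_1)\in I_1,\ ([b,b'],k_2)\in I_2\}$, $I_1\otimes I_2=\{([a+b,a'+b'],k_1+k_2-1) : a+b\leq u,\ k_1+k_2-1\leq p,\ ([a,a'],k_1)\in I_1,\ ([b,b'],k_2)\in I_2\}$, $I_1\odot I_2=(I_1\oplus I_2)\cup(I_1\otimes I_2)$. Intervals $[a,a']$ and $[b,b']$ with $a\leq b$ are $d$-interfering if $b-a'\leq d$; merging them gives $[a,\max\{a',b'\}]$. For an interval partition set $I'$, $M(I')$ is obtained by repeatedly merging, separately for each value of $k$, all $d$-interfering intervals occurring in tuples with that $k$, until none remain. **Algorithm CactusPartitionPoly** (input: $G$ rooted in $r$, and $l,u,p$). Process all non-cycle nodes $v$ of $T_G$ bottom-up. Set $I(v,0)=\{([w(v),w(v)],1)\}$. For $i=1,\ldots,c_v$: if $v_i$ is a cycle node, set $I(v,i)=\mathrm{PolyCyclePartition}(v_i,i)$; otherwise set $I(v,i)=M(I(v,i-1)\odot I(v_i))$. Here $I(v)$ denotes $I(v,c_v)$. Finally return "yes" if $I(r)$ contains a tuple $([a,a'],p)$ with $[a,a']\cap[l,u]\neq\emptyset$, and "no" otherwise. **Procedure PolyCyclePartition$(c,i_c)$.** Let $c$ represent the cycle $C=\langle w_1,\ldots,w_m\rangle$, where $w_1$ is the vertex with $H_{w_1}=pred(c)$, and $c$ is the $i_c$-th child of $pred(c)$. For each $j=1,\ldots,m-1$ let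 $T(C,j)$ be the path obtained from $C$ by deleting the edge $(w_j,w_{j+1})$, viewed as a tree rooted in $w_1$, and let $b_v$ be the number of children of $v$ in $T(C,j)$. Process the vertices $v$ of $T(C,j)$ bottom-up. Initialize $I_j(v,0)=I(pred(c),i_c-1)$ if $v=w_1$; $I_j(v,0)=I(H_v)$ if $v\neq w_1$ is an H-vertex; and $I_j(v,0)=\{([w(v),w(v)],1)\}$ if $v$ is a C-vertex. For $i=1,\ldots,b_v$ set $I_j(v,i)=M(I_j(v,i-1)\odot I_j(v_i))$, where $v_i$ is now the $i$-th child of $v$ in $T(C,j)$ and $I_j(v)$ denotes $I_j(v,b_v)$. Return $M\big(\bigcup_{j=1}^{m-1}I_j(w_1)\big)$. -}

module Defs where

open import Data.Bool.Base using (Bool; true; false; _∧_; _∨_; if_then_else_)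
open import Data.Fin.Base using (Fin)
open import Data.Fin.Properties using (_≟_)
open import Data.List.Base
  using (List; []; _∷_; _++_; _∷ʳ_; map; zip; filter; length; sum; allFin)
open import Data.List.Membership.Propositional using (_∈_)
open import Data.List.Relation.Unary.All using (All)
open import Data.List.Relation.Unary.AllPairs using (AllPairs)
open import Data.List.Relation.Unary.Any using (Any)
open import Data.List.Relation.Unary.Unique.Propositional using (Unique)
open import Data.Nat.Base
  using (ℕ; suc; _+_; _∸_; _⊔_; _≤_; _≡ᵇ_; _≤ᵇ_; _<ᵇ_)
open import Data.Product.Base using (_×_; _,_; ∃-syntax; uncurry)
open import Data.Sum.Base using (_⊎_)
open import Data.Unit.Base using (⊤; tt)
open import Function.Bundles using (_⇔_)
open import Level using (0ℓ)
open import Relation.Binary.Construct.Closure.ReflexiveTransitive using (Star)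
open import Relation.Binary.Core using (Rel)
open import Relation.Binary.Definitions using (Decidable; Symmetric)
open import Relation.Binary.PropositionalEquality using (_≡_)
open import Relation.Nullary.Negation using (¬_)
open import Relation.Unary using (Pred)

------------------------------------------------------------------------
-- Weighted graphs and cactus graphs

record WeightedGraph (n : ℕ) : Set₁ where
  infix 4 _~_ _~?_
  field
    _~_      : Rel (Fin n) 0ℓ
    _~?_     : Decidable _~_
    ~-sym    : Symmetric _~_
    ~-irrefl : ∀ {v} → ¬ (v ~ v)
    weight   : Fin n → ℕ

-- For C = ⟨w₁,…,wₘ⟩: the pairs (w₁,w₂), …, (wₘ₋₁,wₘ), (wₘ,w₁).
cyclicPairs : ∀ {A : Set} → List A → List (A × A)
cyclicPairs []       = []
cyclicPairs (x ∷ xs) = zip (x ∷ xs) (xs ∷ʳ x)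

CycleEdge : ∀ {n} → List (Fin n) → Rel (Fin n) 0ℓ
CycleEdge C x y = (x , y) ∈ cyclicPairs C ⊎ (y , x) ∈ cyclicPairs C

-- Cycles are subgraphs: vertex sequences differing by a rotation or a
-- reversal present the same cycle.
SameCycle : ∀ {n} → Rel (List (Fin n)) 0ℓ
SameCycle C D = ∀ x y → CycleEdge C x y ⇔ CycleEdge D x y

module _ {n : ℕ} (G : WeightedGraph n) where
  open WeightedGraph G

  ConnectedSubset : Pred (Fin n) 0ℓ → Set
  ConnectedSubset S =
    ∀ {x y} → S x → S y → Star (λ a b → S a × S b × a ~ b) x y

  Connected : Set
  Connected = ConnectedSubset (λ _ → ⊤)

  degree : Fin n → ℕ
  degree v = length (filter (v ~?_) (allFin n))

  IsCycle : List (Fin n) → Set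
  IsCycle C = 3 ≤ length C × Unique C × All (uncurry _~_) (cyclicPairs C)

  Cactus : Set
  Cactus = ∀ {C D} → IsCycle C → IsCycle D → ¬ SameCycle C D →
           ∀ {x y} → x ∈ C → x ∈ D → y ∈ C → y ∈ D → x ≡ y

  EdgeOnCycle : Rel (Fin n) 0ℓ
  EdgeOnCycle x y = ∃[ C ] IsCycle C × CycleEdge C x y

  InExactlyOneCycle : Pred (Fin n) 0ℓ
  InExactlyOneCycle v =
    ∃[ C ] IsCycle C × v ∈ C × (∀ D → IsCycle D → v ∈ D → SameCycle C D)

  CVertex GVertex HVertex : Pred (Fin n) 0ℓ
  CVertex v = degree v ≡ 2 × InExactlyOneCycle v
  GVertex v = ¬ (∃[ C ] IsCycle C × v ∈ C)
  HVertex v = ¬ CVertex v × ¬ GVertex v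

  -- Cactus graphs without hinges (trees and single cycles) are rooted in an
  -- arbitrary vertex, which then plays the role of the selected hinge.
  Root : Pred (Fin n) 0ℓ
  Root r = HVertex r ⊎ (∀ v → ¬ HVertex v)

  ----------------------------------------------------------------------
  -- p-(l,u)-partitions

  -- Vᵢ is the fibre of cluster over i.
  record Partition (l u p : ℕ) : Set where
    field
      cluster : Fin n → Fin p

    clusterWeight : Fin p → ℕ
    clusterWeight i =
      sum (map weight (filter (λ v → cluster v ≟ i) (allFin n)))

    field
      nonempty  : ∀ i → ∃[ v ] cluster v ≡ i
      connected : ∀ i → ConnectedSubset (λ v → cluster v ≡ i)
      lower     : ∀ i → l ≤ clusterWeight i
      upper     : ∀ i → clusterWeight i ≤ u

------------------------------------------------------------------------
-- Rooted tree representations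

-- A cycle node c with pred(c) = H_{w₁} carries its cycle ⟨w₁,w₂,…,wₘ⟩ as
-- the list of entries for w₂,…,wₘ: the entry of an H-vertex is the subtree
-- of T_G at the corresponding child of c, and C-vertices, which have no
-- node in T_G, are recorded by name.
data VertexNode (n : ℕ) : Set
data Child      (n : ℕ) : Set
data Entry      (n : ℕ) : Set

data VertexNode n where
  node : Fin n → List (Child n) → VertexNode n

data Child n where
  vertexNode : VertexNode n → Child n
  cycleNode  : List (Entry n) → Child n

data Entry n where
  cVertex : Fin n → Entry n
  hVertex : VertexNode n → Entry n

module _ {n : ℕ} where

  label : VertexNode n → Fin n
  label (node v _) = v

  entryLabel : Entry n → Fin n
  entryLabel (cVertex v) = v
  entryLabel (hVertex t) = label t

  labels         : VertexNode n → List (Fin n)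
  labelsChildren : List (Child n) → List (Fin n)
  labelsEntries  : List (Entry n) → List (Fin n)
  labels (node v cs) = v ∷ labelsChildren cs
  labelsChildren []                  = []
  labelsChildren (vertexNode t ∷ cs) = labels t ++ labelsChildren cs
  labelsChildren (cycleNode es ∷ cs) = labelsEntries es ++ labelsChildren cs
  labelsEntries []               = []
  labelsEntries (cVertex _ ∷ es) = labelsEntries es
  labelsEntries (hVertex t ∷ es) = labels t ++ labelsEntries es

  cLabels         : VertexNode n → List (Fin n)
  cLabelsChildren : List (Child n) → List (Fin n)
  cLabelsEntries  : List (Entry n) → List (Fin n)
  cLabels (node _ cs) = cLabelsChildren cs
  cLabelsChildren []                  = []
  cLabelsChildren (vertexNode t ∷ cs) = cLabels t ++ cLabelsChildren cs
  cLabelsChildren (cycleNode es ∷ cs) = cLabelsEntries es ++ cLabelsChildren cs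
  cLabelsEntries []               = []
  cLabelsEntries (cVertex v ∷ es) = v ∷ cLabelsEntries es
  cLabelsEntries (hVertex t ∷ es) = cLabels t ++ cLabelsEntries es

  -- The edges of T_G between two non-cycle nodes, directed downwards.
  edges         : VertexNode n → List (Fin n × Fin n)
  edgesChildren : Fin n → List (Child n) → List (Fin n × Fin n)
  edgesEntries  : List (Entry n) → List (Fin n × Fin n)
  edges (node v cs) = edgesChildren v cs
  edgesChildren v []                  = []
  edgesChildren v (vertexNode t ∷ cs) =
    (v , label t) ∷ edges t ++ edgesChildren v cs
  edgesChildren v (cycleNode es ∷ cs) = edgesEntries es ++ edgesChildren v cs
  edgesEntries []               = []
  edgesEntries (cVertex _ ∷ es) = edgesEntries es
  edgesEntries (hVertex t ∷ es) = edges t ++ edgesEntries es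

  cycles         : VertexNode n → List (List (Fin n))
  cyclesChildren : Fin n → List (Child n) → List (List (Fin n))
  cyclesEntries  : List (Entry n) → List (List (Fin n))
  cycles (node v cs) = cyclesChildren v cs
  cyclesChildren v []                  = []
  cyclesChildren v (vertexNode t ∷ cs) = cycles t ++ cyclesChildren v cs
  cyclesChildren v (cycleNode es ∷ cs) =
    (v ∷ map entryLabel es) ∷ cyclesEntries es ++ cyclesChildren v cs
  cyclesEntries []               = []
  cyclesEntries (cVertex _ ∷ es) = cyclesEntries es
  cyclesEntries (hVertex t ∷ es) = cycles t ++ cyclesEntries es

record IsTreeRepresentation {n : ℕ} (G : WeightedGraph n) (r : Fin n)
                            (T : VertexNode n) : Set where
  open WeightedGraph G
  field
    rooted          : label T ≡ r
    -- One node for each G- and H-vertex (the clause v ≡ r only matters for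
    -- a single cycle, where r is a C-vertex playing the role of a hinge).
    labels-unique   : Unique (labels T)
    labels-vertices : ∀ v → v ∈ labels T ⇔ (¬ CVertex G v ⊎ v ≡ r)
    cLabels-C       : All (CVertex G) (cLabels T)
    edges-acyclic   : ∀ x y → ((x , y) ∈ edges T ⊎ (y , x) ∈ edges T)
                            ⇔ (x ~ y × ¬ EdgeOnCycle G x y)
    -- One cycle node for each cycle.
    cycles-cycles   : All (IsCycle G) (cycles T)
    cycles-complete : ∀ C → IsCycle G C → Any (SameCycle C) (cycles T)
    cycles-distinct : AllPairs (λ C D → ¬ SameCycle C D) (cycles T)

------------------------------------------------------------------------
-- Step counting

-- Unit-cost model: every call of every function below executes one tick,
-- and between two ticks only boundedly many operations on numbers, Booleans
-- and list or tree constructors are performed.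
record Timed (A : Set) : Set where
  constructor _after_
  field
    value : A
    steps : ℕ
open Timed public

return : ∀ {A : Set} → A → Timed A
return x = x after 0

tick : Timed ⊤
tick = tt after 1

infixl 1 _>>=_ _>>_

_>>=_ : ∀ {A B : Set} → Timed A → (A → Timed B) → Timed B
m >>= f = value (f (value m)) after (steps m + steps (f (value m)))

_>>_ : ∀ {A B : Set} → Timed A → Timed B → Timed B
m >> m′ = m >>= λ _ → m′

append : ∀ {A : Set} → List A → List A → Timed (List A)
append [] ys = do
  tick
  return ys
append (x ∷ xs) ys = do
  tick
  zs ← append xs ys
  return (x ∷ zs)

reverseOnto : ∀ {A : Set} → List A → List A → Timed (List A)
reverseOnto acc [] = do
  tick
  return acc
reverseOnto acc (x ∷ xs) = do
  tick
  reverseOnto (x ∷ acc) xs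

------------------------------------------------------------------------
-- Interval partition sets

-- [ a ⋯ a′ ]# k is the tuple ([a,a′],k).
record Tuple : Set where
  constructor [_⋯_]#_
  field
    lo hi parts : ℕ
open Tuple public

-- A finite set of tuples, listed in the lexicographic order of (k,a).
IntervalPartitionSet : Set
IntervalPartitionSet = List Tuple

-- The operands of M, that is I₁ ⊙ I₂ and ⋃ⱼ Iⱼ(w₁), are presented as unions
-- of interval partition sets.  Each member of the union is itself in
-- lexicographic order, so M can use linear-time merging instead of sorting.
Union : Set
Union = List IntervalPartitionSet

module Algorithm (l u p : ℕ) where

  d : ℕ
  d = u ∸ l

  -- [b,b′] ∩ [l,u] ≠ ∅
  meets : Tuple → Bool
  meets ([ b ⋯ b′ ]# _) = (b ≤ᵇ u) ∧ (l ≤ᵇ b′)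

  -- The tuples ([a,a′],k₁+k₂) of I₁ ⊕ I₂ for a fixed k₂.
  cutRun : IntervalPartitionSet → ℕ → Timed IntervalPartitionSet
  cutRun [] k₂ = do
    tick
    return []
  cutRun (([ a ⋯ a′ ]# k₁) ∷ I₁) k₂ = do
    tick
    run ← cutRun I₁ k₂
    return (if k₁ + k₂ ≤ᵇ p
            then ([ a ⋯ a′ ]# (k₁ + k₂)) ∷ run
            else run)

  infixl 6 _⊕_ _⊗_ _⊙_

  _⊕_ : IntervalPartitionSet → IntervalPartitionSet → Timed Union
  I₁ ⊕ [] = do
    tick
    return []
  I₁ ⊕ (y ∷ I₂) = do
    tick
    runs ← I₁ ⊕ I₂
    if meets y
      then (do run ← cutRun I₁ (parts y)
               return (run ∷ runs))
      else return runs

  -- The tuples of I₁ ⊗ I₂ for a fixed tuple of I₁.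
  joinRun : Tuple → IntervalPartitionSet → Timed IntervalPartitionSet
  joinRun x [] = do
    tick
    return []
  joinRun x@([ a ⋯ a′ ]# k₁) (([ b ⋯ b′ ]# k₂) ∷ I₂) = do
    tick
    run ← joinRun x I₂
    return (if (a + b ≤ᵇ u) ∧ (k₁ + k₂ ∸ 1 ≤ᵇ p)
            then ([ a + b ⋯ a′ + b′ ]# (k₁ + k₂ ∸ 1)) ∷ run
            else run)

  _⊗_ : IntervalPartitionSet → IntervalPartitionSet → Timed Union
  [] ⊗ I₂ = do
    tick
    return []
  (x ∷ I₁) ⊗ I₂ = do
    tick
    run  ← joinRun x I₂
    runs ← I₁ ⊗ I₂
    return (run ∷ runs)

  _⊙_ : IntervalPartitionSet → IntervalPartitionSet → Timed Union
  I₁ ⊙ I₂ = do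
    tick
    cut  ← I₁ ⊕ I₂
    join ← I₁ ⊗ I₂
    append cut join

  precedes : Tuple → Tuple → Bool
  precedes ([ a ⋯ _ ]# k) ([ b ⋯ _ ]# k′) =
    (k <ᵇ k′) ∨ ((k ≡ᵇ k′) ∧ (a ≤ᵇ b))

  mergeLists : IntervalPartitionSet → IntervalPartitionSet →
               Timed IntervalPartitionSet
  mergeLists [] ys = do
    tick
    return ys
  mergeLists (x ∷ xs) [] = do
    tick
    return (x ∷ xs)
  mergeLists (x ∷ xs) (y ∷ ys) = do
    tick
    if precedes x y
      then (do zs ← mergeLists xs (y ∷ ys)
               return (x ∷ zs))
      else (do zs ← mergeLists (x ∷ xs) ys
               return (y ∷ zs))

  -- Decides d-interference of intervals belonging to the same k; the first
  -- interval is the one with the smaller left end.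
  interfering : Tuple → Tuple → Bool
  interfering ([ _ ⋯ a′ ]# k) ([ b ⋯ _ ]# k′) = (k ≡ᵇ k′) ∧ (b ∸ a′ ≤ᵇ d)

  mergeIntervals : Tuple → Tuple → Tuple
  mergeIntervals ([ a ⋯ a′ ]# k) ([ _ ⋯ b′ ]# _) = [ a ⋯ a′ ⊔ b′ ]# k

  coalesceFrom : Tuple → IntervalPartitionSet → Timed IntervalPartitionSet
  coalesceFrom x [] = do
    tick
    return (x ∷ [])
  coalesceFrom x (y ∷ ys) = do
    tick
    if interfering x y
      then coalesceFrom (mergeIntervals x y) ys
      else (do zs ← coalesceFrom y ys
               return (x ∷ zs))

  coalesce : IntervalPartitionSet → Timed IntervalPartitionSet
  coalesce [] = do
    tick
    return []
  coalesce (x ∷ xs) = do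
    tick
    coalesceFrom x xs

  M : Union → Timed IntervalPartitionSet
  M [] = do
    tick
    return []
  M (run ∷ runs) = do
    tick
    I ← M runs
    J ← mergeLists run I
    coalesce J

  ----------------------------------------------------------------------
  -- PolyCyclePartition

  data Tree : Set where
    tree : IntervalPartitionSet → List Tree → Tree

  -- I(v) for the root v of a tree whose vertices carry the sets I(v,0).
  treePartition     : Tree → Timed IntervalPartitionSet
  treePartitionFrom : IntervalPartitionSet → List Tree →
                      Timed IntervalPartitionSet
  treePartition (tree I ts) = do
    tick
    treePartitionFrom I ts
  treePartitionFrom I [] = do
    tick
    return I
  treePartitionFrom I (t ∷ ts) = do
    tick
    I′ ← treePartition t
    J  ← I ⊙ I′
    K  ← M J
    treePartitionFrom K ts

  -- The path on the given vertices, hanging from its first vertex.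
  branch : List IntervalPartitionSet → Timed (List Tree)
  branch [] = do
    tick
    return []
  branch (I ∷ Is) = do
    tick
    ts ← branch Is
    return (tree I ts ∷ [])

  -- T(C,j), with the sets I_j(v,0) at its vertices, from those of w₁, of
  -- w_j,…,w₂, and of w_{j+1},…,wₘ.
  cutTree : IntervalPartitionSet → (front back : List IntervalPartitionSet) →
            Timed Tree
  cutTree I front back = do
    tick
    front′   ← reverseOnto [] front
    back′    ← reverseOnto [] back
    branch₁  ← branch front′
    branch₂  ← branch back′
    branches ← append branch₁ branch₂
    return (tree I branches)

  -- I_j(w₁), I_{j+1}(w₁), …, I_{m-1}(w₁), with arguments as for cutTree.
  cutsFrom : IntervalPartitionSet → (front back : List IntervalPartitionSet) →
             Timed Union
  cutsFrom I front [] = do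
    tick
    return []
  cutsFrom I front (B ∷ back) = do
    tick
    t  ← cutTree I front (B ∷ back)
    J  ← treePartition t
    Js ← cutsFrom I (B ∷ front) back
    return (J ∷ Js)

  -- Arguments: I(pred(c),i_c-1), and the sets I_j(v,0) for v = w₂,…,wₘ.
  polyCyclePartition : IntervalPartitionSet → List IntervalPartitionSet →
                       Timed IntervalPartitionSet
  polyCyclePartition I Is = do
    tick
    Js ← cutsFrom I [] Is
    M Js

  ----------------------------------------------------------------------
  -- CactusPartitionPoly

  module _ {n : ℕ} (w : Fin n → ℕ) where

    singleton : Fin n → IntervalPartitionSet
    singleton v = ([ w v ⋯ w v ]# 1) ∷ []

    partition        : VertexNode n → Timed IntervalPartitionSet
    partitionFrom    : IntervalPartitionSet → List (Child n) →
                       Timed IntervalPartitionSet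
    partitionEntries : List (Entry n) → Timed (List IntervalPartitionSet)
    partition (node v cs) = do
      tick
      partitionFrom (singleton v) cs
    partitionFrom I [] = do
      tick
      return I
    partitionFrom I (vertexNode t ∷ cs) = do
      tick
      I′ ← partition t
      J  ← I ⊙ I′
      K  ← M J
      partitionFrom K cs
    partitionFrom I (cycleNode es ∷ cs) = do
      tick
      Is ← partitionEntries es
      K  ← polyCyclePartition I Is
      partitionFrom K cs
    partitionEntries [] = do
      tick
      return []
    partitionEntries (cVertex v ∷ es) = do
      tick
      Is ← partitionEntries es
      return (singleton v ∷ Is)
    partitionEntries (hVertex t ∷ es) = do
      tick
      I  ← partition t
      Is ← partitionEntries es
      return (I ∷ Is)

    accepts : IntervalPartitionSet → Timed Bool
    accepts [] = do
      tick
      return false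
    accepts (x ∷ I) = do
      tick
      if (parts x ≡ᵇ p) ∧ meets x then return true else accepts I

    -- true is "yes".
    cactusPartitionPoly : VertexNode n → Timed Bool
    cactusPartitionPoly T = do
      tick
      I ← partition T
      accepts I

open Algorithm public using (cactusPartitionPoly)

{-# OPTIONS --safe #-}
module Submission where

-- An interval [a,a'] kept for k clusters stands for partitions whose root
-- clusters have weights that leave no gap longer than d in [a,a'] and include
-- a'.  Since d = u - l, such an interval meets [l,u] only if one of these
-- weights lies in [l,u], so merging d-interfering intervals loses no
-- information about the existence of partitions.  The k - 1 other clusters
-- weigh between (k - 1) l and (k - 1) u, which confines the weight of the root
-- cluster to a range of length (k - 1) d: at most k intervals survive for each
-- k, whence O(p^2) tuples per set and O(p^4) steps per ⊙.
--
-- On a cycle, a partition that separates two consecutive vertices makes no use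
-- of the edge between them; a partition that does not keeps the cycle in one
-- cluster, which remains connected when an edge is deleted.  Hence the
-- partitions of a cycle with pieces attached are those of the paths T(C,j).
-- These m - 1 paths take O(m^2) operations ⊙ for a cycle of m vertices, and the
-- lengths of all cycles add up to O(n), whence the factor n^2.

open import Defs
open import Data.Bool.Base using (true; false; _∧_; if_then_else_)
open import Data.Empty using (⊥; ⊥-elim)
open import Data.Fin.Base using (Fin) renaming (zero to fzero; suc to fsuc)
open import Data.Fin.Properties using (_≟_; nonZeroIndex)
open import Data.List.Base using (List; []; _∷_; _++_; _∷ʳ_; length; map; concat; concatMap; reverse; _ʳ++_; filter; zip; allFin; lookup)
import Data.List.Membership.DecPropositional as DecMembership
open import Data.List.Membership.Propositional using (_∈_; _∉_; find; lose)
open import Data.List.Membership.Propositional.Properties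
  using (∈-++⁺ˡ; ∈-++⁺ʳ; ∈-++⁻; ∈-concat⁻; ∈-concat⁺′; ∈-concat⁻′; ∈-∃++; ∈-filter⁺; ∈-filter⁻; ∈-map⁺; ∈-map⁻; ∈-allFin; ∈-lookup)
open import Data.List.Membership.Propositional.Properties.WithK using (unique∧set⇒bag)
open import Data.List.Properties
  using (++-assoc; ++-identityʳ; map-++; reverse-++; reverse-involutive; concat-++; length-++; length-map; length-reverse; length-tabulate; concatMap-++; reverse-map; ʳ++-defn)
open import Data.List.Relation.Binary.BagAndSetEquality using (∼bag⇒↭)
open import Data.List.Relation.Binary.Permutation.Propositional as Perm
  using (_↭_; ↭-refl; ↭-sym; ↭-trans; ↭-prep; ↭-reflexive; ↭⇒↭ₛ; module PermutationReasoning)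
open import Data.List.Relation.Binary.Permutation.Propositional.Properties
  using (∈-resp-↭; All-resp-↭; Any-resp-↭; ↭-length; ++⁺; ++⁺ˡ; ++⁺ʳ; shift; shifts; ↭-reverse; map⁺)
import Data.List.Relation.Binary.Permutation.Setoid.Properties as Permₛ
open import Data.List.Relation.Binary.Pointwise as Pointwise using (Pointwise; []; _∷_; Pointwise-length)
open import Data.List.Relation.Unary.All as All using (All; []; _∷_)
import Data.List.Relation.Unary.All.Properties as Allₚ
open import Data.List.Relation.Unary.AllPairs as AllPairs using (AllPairs; []; _∷_)
import Data.List.Relation.Unary.AllPairs.Properties as AllPairsₚ
open import Data.List.Relation.Unary.Any as Any using (Any; here; there; any?)
import Data.List.Relation.Unary.Any.Properties as Anyₚ
open import Data.List.Relation.Unary.Linked using (Linked; []; [-]; _∷_)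
open import Data.List.Relation.Unary.Unique.Propositional using (Unique)
import Data.List.Relation.Unary.Unique.Propositional.Properties as Uniqueₚ
open import Data.Nat.Base
open import Data.Nat.DivMod using (_/_; m/n≡1+[m∸n]/n; /-monoˡ-≤; m<n*o⇒m/o<n)
open import Data.Nat.ListAction using (sum)
open import Data.Nat.ListAction.Properties using (sum-++; sum-↭)
open import Data.Nat.Properties hiding (_≟_)
open import Data.Nat.Solver using (module +-*-Solver)
open import Data.Product.Base using (_×_; _,_; proj₁; proj₂; ∃-syntax)
import Data.Product.Properties as Productₚ
open import Data.Sum.Base as Sum using (_⊎_; inj₁; inj₂; [_,_]′)
open import Function.Base using (_∘_; id; case_of_)
open import Function.Bundles using (_⇔_; mk⇔; module Equivalence)
open import Function.Construct.Composition using (_⇔-∘_)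
open import Function.Construct.Symmetry using (⇔-sym)
open import Relation.Binary.Construct.Closure.ReflexiveTransitive as Star using (Star; ε; _◅_; _◅◅_)
open import Relation.Binary.Definitions using (tri<; tri≈; tri>)
open import Relation.Binary.PropositionalEquality
  using (_≡_; refl; sym; trans; cong; cong₂; subst; setoid; module ≡-Reasoning)
open import Relation.Nullary.Decidable using (yes; no; _⊎-dec_; decidable-stable)
open import Relation.Nullary.Negation using (¬_; contradiction)
open import Relation.Nullary.Reflects using (Reflects; ofʸ; ofⁿ; fromEquivalence; _×-reflects_; _⊎-reflects_)
open import Relation.Unary using (Decidable)

-- Interval partition sets

-- Intervals and graphs meet only through a predicate `A x k`. What ⊙, M and the final test do is
-- proved for any `A` with the closure properties of `Composition` and the weight bounds of
-- `Measured`; rooted pieces of the graph supply such predicates. The invariant `Sound` asks both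
-- that the right end is attained and that every point has an attained weight at most `d` below it:
-- the former serves where an interval ends inside `[l,u]` and bridges the gap closed by a merge,
-- the latter serves where an interval runs past `u`. Since ⊗ discards sums above `u`, completeness
-- is claimed only for weights up to `u`; weights are non-negative, so no discarded sum could come
-- back below `u`. The hypotheses on the graph quantify over all its cycles and do not decide
-- whether a vertex or an edge is on one. Hence the tree representation is read as a piece with
-- explicit lists of vertices and arcs, and this piece is compared with the graph through decidable
-- list membership.

≡ᵇ-reflects-≡ : ∀ m n → Reflects (m ≡ n) (m ≡ᵇ n)
≡ᵇ-reflects-≡ m n = fromEquivalence (≡ᵇ⇒≡ m n) (≡⇒≡ᵇ m n)

if-elim : ∀ {A Q : Set} (P : A → Set) {b t e} → Reflects Q b →
          (Q → P t) → (¬ Q → P e) → P (if b then t else e)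
if-elim P (ofʸ q)  f g = f q
if-elim P (ofⁿ ¬q) f g = g ¬q

infix 4 _≼_

_≼_ : Tuple → Tuple → Set
x ≼ y = parts x < parts y ⊎ (parts x ≡ parts y × lo x ≤ lo y)

≼-trans : ∀ {x y z} → x ≼ y → y ≼ z → x ≼ z
≼-trans (inj₁ p)       (inj₁ q)          = inj₁ (<-trans p q)
≼-trans (inj₁ p)       (inj₂ (refl , _)) = inj₁ p
≼-trans (inj₂ (refl , _)) (inj₁ q)       = inj₁ q
≼-trans (inj₂ (refl , p)) (inj₂ (refl , q)) = inj₂ (refl , ≤-trans p q)

least : Tuple
least = [ 0 ⋯ 0 ]# 0

least-≼ : ∀ x → least ≼ x
least-≼ ([ _ ⋯ _ ]# zero)  = inj₂ (refl , z≤n)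
least-≼ ([ _ ⋯ _ ]# suc _) = inj₁ z<s

-- The bound `b` in front makes sorting inductive: what is made from a tail must still be able to
-- follow the entry already emitted. `least` is a bound for every sorted list.
Sorted : Tuple → IntervalPartitionSet → Set
Sorted b xs = Linked _≼_ (b ∷ xs)

sorted-weaken : ∀ {b c xs} → b ≼ c → Sorted c xs → Sorted b xs
sorted-weaken b≼c [-]       = [-]
sorted-weaken {b} {c} b≼c (_∷_ {y = y} c≼x s) = ≼-trans {b} {c} {y} b≼c c≼x ∷ s

sorted-least : ∀ {c xs} → Sorted c xs → Sorted least xs
sorted-least {c} = sorted-weaken (least-≼ c)

Covers : ℕ → ℕ → Tuple → Set
Covers x k t = parts t ≡ k × lo t ≤ x × x ≤ hi t

append-value : ∀ {A : Set} (xs ys : List A) → value (append xs ys) ≡ xs ++ ys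
append-value []       ys = refl
append-value (x ∷ xs) ys = cong (x ∷_) (append-value xs ys)

append-steps : ∀ {A : Set} (xs ys : List A) → steps (append xs ys) ≡ suc (length xs)
append-steps []       ys = refl
append-steps (x ∷ xs) ys = cong suc (trans (+-identityʳ _) (append-steps xs ys))

module _ (l u p : ℕ) where
  open Algorithm l u p hiding (cactusPartitionPoly)

  meets-reflects : ∀ y → Reflects (lo y ≤ u × l ≤ hi y) (meets y)
  meets-reflects y = ≤ᵇ-reflects-≤ (lo y) u ×-reflects ≤ᵇ-reflects-≤ l (hi y)

  precedes-reflects : ∀ x y → Reflects (x ≼ y) (precedes x y)
  precedes-reflects x y =
    <ᵇ-reflects-< (parts x) (parts y) ⊎-reflects
    ≡ᵇ-reflects-≡ (parts x) (parts y) ×-reflects ≤ᵇ-reflects-≤ (lo x) (lo y)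

  Interfering : Tuple → Tuple → Set
  Interfering x y = parts x ≡ parts y × lo y ∸ hi x ≤ d

  interfering-reflects : ∀ x y → Reflects (Interfering x y) (interfering x y)
  interfering-reflects x y =
    ≡ᵇ-reflects-≡ (parts x) (parts y) ×-reflects ≤ᵇ-reflects-≤ (lo y ∸ hi x) d

  ⋠⇒≽ : ∀ {x y} → ¬ (x ≼ y) → y ≼ x
  ⋠⇒≽ {x} {y} ¬p with <-cmp (parts x) (parts y)
  ... | tri< q _ _ = contradiction (inj₁ q) ¬p
  ... | tri> _ _ q = inj₁ q
  ... | tri≈ _ q _ = inj₂ (sym q , ≰⇒≥ (λ r → ¬p (inj₂ (q , r))))

  -- Merging sorted lists and coalescing interfering intervals

  mergeLists-↭ : ∀ xs ys → value (mergeLists xs ys) ↭ xs ++ ys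
  mergeLists-↭ []       ys = ↭-refl
  mergeLists-↭ (x ∷ xs) [] = ↭-reflexive (sym (++-identityʳ (x ∷ xs)))
  mergeLists-↭ (x ∷ xs) (y ∷ ys) =
    if-elim (λ m → value m ↭ x ∷ xs ++ y ∷ ys) (precedes-reflects x y)
      (λ _ → ↭-prep x (mergeLists-↭ xs (y ∷ ys)))
      (λ _ → ↭-trans (↭-prep y (mergeLists-↭ (x ∷ xs) ys)) (↭-sym (shift y (x ∷ xs) ys)))

  mergeLists-sorted : ∀ {b} xs ys → Sorted b xs → Sorted b ys →
                      Sorted b (value (mergeLists xs ys))
  mergeLists-sorted []       ys p q = q
  mergeLists-sorted (x ∷ xs) [] p q = p
  mergeLists-sorted {b} (x ∷ xs) (y ∷ ys) (b≼x ∷ p) (b≼y ∷ q) =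
    if-elim (λ m → Sorted b (value m)) (precedes-reflects x y)
      (λ r → b≼x ∷ mergeLists-sorted xs (y ∷ ys) p (r ∷ q))
      (λ r → b≼y ∷ mergeLists-sorted (x ∷ xs) ys (⋠⇒≽ {x} {y} r ∷ p) q)

  mergeLists-steps : ∀ xs ys → steps (mergeLists xs ys) ≤ suc (length xs + length ys)
  mergeLists-steps []       ys = s≤s z≤n
  mergeLists-steps (x ∷ xs) [] = s≤s z≤n
  mergeLists-steps (x ∷ xs) (y ∷ ys) = s≤s
    (if-elim (λ m → steps m ≤ suc (length xs + suc (length ys))) (precedes-reflects x y)
      (λ _ → ≤-trans (≤-reflexive (+-identityʳ _)) (mergeLists-steps xs (y ∷ ys)))
      (λ _ → ≤-trans (≤-reflexive (+-identityʳ _))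
               (≤-trans (mergeLists-steps (x ∷ xs) ys)
                 (≤-reflexive (cong suc (sym (+-suc (length xs) (length ys))))))))

  infix 4 _◁_

  _◁_ : Tuple → Tuple → Set
  x ◁ y = parts x < parts y ⊎ (parts x ≡ parts y × hi x + d < lo y)

  ≼∧¬interfering⇒◁ : ∀ {x y} → x ≼ y → ¬ Interfering x y → x ◁ y
  ≼∧¬interfering⇒◁ (inj₁ p) _ = inj₁ p
  ≼∧¬interfering⇒◁ {x} {y} (inj₂ (p , _)) ¬i =
    inj₂ (p , ≰⇒> (λ q → ¬i (p , m≤n+o⇒m∸n≤o (lo y) (hi x) q)))

  module _ {P : Tuple → Set}
           (P-merge : ∀ {x y} → P x → P y → Interfering x y → P (mergeIntervals x y)) where

    coalesceFrom-All : ∀ {x} xs → P x → All P xs → All P (value (coalesceFrom x xs))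
    coalesceFrom-All []       px []         = px ∷ []
    coalesceFrom-All {x} (y ∷ ys) px (py ∷ pys)
      with interfering x y | interfering-reflects x y
    ... | true  | ofʸ i = coalesceFrom-All ys (P-merge px py i) pys
    ... | false | _     = px ∷ coalesceFrom-All ys py pys

  -- A merge keeps `parts x` and `lo x`, on which alone `b ◁ x` and the order of the remaining list
  -- relative to `x` depend; so extending `x` disturbs neither its predecessor nor the sorting.
  coalesceFrom-separated : ∀ {b x} xs → b ◁ x → Sorted x xs →
                           Linked _◁_ (b ∷ value (coalesceFrom x xs))
  coalesceFrom-separated []       b◁x _ = b◁x ∷ [-]
  coalesceFrom-separated {b} {x} (y ∷ ys) b◁x (x≼y ∷ s)
    with interfering x y | interfering-reflects x y
  ... | true  | _     = coalesceFrom-separated {x = mergeIntervals x y} ys b◁x (sorted-weaken x≼y s)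
  ... | false | ofⁿ i = b◁x ∷ coalesceFrom-separated ys (≼∧¬interfering⇒◁ {x} {y} x≼y i) s

  -- A merge loses no weight because sorting puts `lo x` at or below `lo y`, so that keeping `lo x`
  -- as the left end is enough.
  coalesceFrom-covers : ∀ {x a k} xs → Sorted x xs → Any (Covers a k) (x ∷ xs) →
                        Any (Covers a k) (value (coalesceFrom x xs))
  coalesceFrom-covers []       _ c = c
  coalesceFrom-covers {x} (y ∷ ys) (x≼y ∷ s) c
    with interfering x y | interfering-reflects x y
  ... | true  | ofʸ (k≡k′ , _) = coalesceFrom-covers ys (sorted-weaken x≼y s) (merged c)
    where
    lo≤lo : x ≼ y → lo x ≤ lo y
    lo≤lo (inj₁ q)       = contradiction k≡k′ (<⇒≢ q)
    lo≤lo (inj₂ (_ , q)) = q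
    merged : ∀ {a k} → Any (Covers a k) (x ∷ y ∷ ys) → Any (Covers a k) (mergeIntervals x y ∷ ys)
    merged (here (e , q , r))         = here (e , q , ≤-trans r (m≤m⊔n (hi x) (hi y)))
    merged (there (here (e , q , r))) =
      here (trans k≡k′ e , ≤-trans (lo≤lo x≼y) q , ≤-trans r (m≤n⊔m (hi x) (hi y)))
    merged (there (there c′))         = there c′
  ... | false | _ with c
  ...   | here q   = here q
  ...   | there c′ = there (coalesceFrom-covers ys s c′)

  coalesceFrom-steps : ∀ x xs → steps (coalesceFrom x xs) ≤ suc (length xs)
  coalesceFrom-steps x []       = ≤-refl
  coalesceFrom-steps x (y ∷ ys) with interfering x y
  ... | true  = s≤s (coalesceFrom-steps (mergeIntervals x y) ys)
  ... | false = s≤s (≤-trans (≤-reflexive (+-identityʳ _)) (coalesceFrom-steps y ys))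

  coalesce-steps : ∀ xs → steps (coalesce xs) ≤ suc (length xs)
  coalesce-steps []       = ≤-refl
  coalesce-steps (x ∷ xs) = s≤s (coalesceFrom-steps x xs)

  -- A x k: the piece under consideration has a partition into k clusters in
  -- which the root cluster has weight x and the others have weight in [l,u].
  record Sound (A : ℕ → ℕ → Set) (t : Tuple) : Set where
    field
      parts≤p  : parts t ≤ p
      lo≤hi    : lo t ≤ hi t
      attained : A (hi t) (parts t)
      near     : ∀ {y} → lo t ≤ y → y ≤ hi t → ∃[ s ] A s (parts t) × s ≤ y × y ≤ s + d
  open Sound

  Sound-map : ∀ {A B : ℕ → ℕ → Set} → (∀ {x k} → A x k → B x k) → ∀ {t} → Sound A t → Sound B t
  Sound-map f σ = record
    { parts≤p = parts≤p σ ; lo≤hi = lo≤hi σ ; attained = f (attained σ)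
    ; near = λ q r → case near σ q r of λ (s , a , q′ , r′) → s , f a , q′ , r′ }

  -- A point in the gap between the two intervals exceeds the attained right end of the first by at
  -- most `d`; every other point inherits its witness from the interval containing it.
  Sound-merge : ∀ {A x y} → Sound A x → Sound A y → Interfering x y → Sound A (mergeIntervals x y)
  Sound-merge {A} {x@([ a ⋯ a′ ]# k)} {y@([ b ⋯ b′ ]# .k)} σ τ (refl , i) = record
    { parts≤p = parts≤p σ ; lo≤hi = ≤-trans (lo≤hi σ) (m≤m⊔n a′ b′) ; attained = att ; near = nr }
    where
    att : A (a′ ⊔ b′) k
    att with ⊔-sel a′ b′
    ... | inj₁ e = subst (λ z → A z k) (sym e) (attained σ)
    ... | inj₂ e = subst (λ z → A z k) (sym e) (attained τ)
    nr : ∀ {z} → a ≤ z → z ≤ a′ ⊔ b′ → ∃[ s ] A s k × s ≤ z × z ≤ s + d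
    nr {z} q r with z ≤? a′
    ... | yes z≤a′ = near σ q z≤a′
    ... | no  z≰a′ with b ≤? z
    ...   | no b≰z   = a′ , attained σ , ≰⇒≥ z≰a′ ,
                       ≤-trans (≰⇒≥ b≰z) (≤-trans (m≤n+m∸n b a′) (+-monoʳ-≤ a′ i))
    ...   | yes b≤z with ⊔-sel a′ b′
    ...     | inj₁ e = contradiction (subst (z ≤_) e r) z≰a′
    ...     | inj₂ e = near τ b≤z (subst (z ≤_) e r)

  Complete : (A : ℕ → ℕ → Set) → IntervalPartitionSet → Set
  Complete A I = ∀ {x k} → A x k → x ≤ u → k ≤ p → Any (Covers x k) I

  -- `complete` is relative to `u` and `p` because ⊕ and ⊗ discard what exceeds these bounds;
  -- `separated` is what limits the number of tuples.
  record Valid (A : ℕ → ℕ → Set) (I : IntervalPartitionSet) : Set where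
    field
      sound     : All (Sound A) I
      separated : Linked _◁_ (least ∷ I)
      complete  : Complete A I
  open Valid

  ◁⇒≼ : ∀ {A x y} → Sound A x → x ◁ y → x ≼ y
  ◁⇒≼ σ (inj₁ p) = inj₁ p
  ◁⇒≼ {x = x} σ (inj₂ (e , q)) =
    inj₂ (e , ≤-trans (lo≤hi σ) (≤-trans (m≤m+n (hi x) d) (<⇒≤ q)))

  separated⇒sorted : ∀ {A b xs} → All (Sound A) xs → Linked _◁_ (b ∷ xs) → Sorted least xs
  separated⇒sorted σs [-] = [-]
  separated⇒sorted {xs = x ∷ xs} σs (_ ∷ s) = least-≼ x ∷ go σs s
    where
    go : ∀ {x xs} → All (Sound _) (x ∷ xs) → Linked _◁_ (x ∷ xs) → Linked _≼_ (x ∷ xs)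
    go _ [-] = [-]
    go {x} {y ∷ _} (σ ∷ σs) (x◁y ∷ s) = ◁⇒≼ {y = y} σ x◁y ∷ go σs s

  valid⇒sorted : ∀ {A I} → Valid A I → Sorted least I
  valid⇒sorted v = separated⇒sorted (sound v) (separated v)

  -- `least` has 0 parts, so positive `k` places it before every sound tuple in the sense of `_◁_`.
  -- It also makes the truncated `k₁ + k₂ ∸ 1` exact.
  Positive : (A : ℕ → ℕ → Set) → Set
  Positive A = ∀ {x k} → A x k → 1 ≤ k

  module _ {A : ℕ → ℕ → Set} (pos : Positive A) where

    M-sound : ∀ {Js} → All (All (Sound A)) Js → All (Sound A) (value (M Js))
    M-sound [] = []
    M-sound {J ∷ Js} (σ ∷ σs) = go (All-resp-↭ (↭-sym (mergeLists-↭ J _)) (Allₚ.++⁺ σ (M-sound σs)))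
      where
      go : ∀ {L} → All (Sound A) L → All (Sound A) (value (coalesce L))
      go [] = []
      go {x ∷ L} (σ ∷ σs) = coalesceFrom-All (λ {x} {y} → Sound-merge {A} {x} {y}) L σ σs

    M-separated : ∀ {Js} → All (All (Sound A)) Js → All (Sorted least) Js →
                  Linked _◁_ (least ∷ value (M Js))
    M-separated [] _ = [-]
    M-separated {J ∷ Js} (σ ∷ σs) (s ∷ ss) =
      go (mergeLists-sorted J _ s (separated⇒sorted (M-sound σs) (M-separated σs ss)))
         (All-resp-↭ (↭-sym (mergeLists-↭ J _)) (Allₚ.++⁺ σ (M-sound σs)))
      where
      go : ∀ {L} → Sorted least L → All (Sound A) L → Linked _◁_ (least ∷ value (coalesce L))
      go [-] _ = [-]
      go {x ∷ L} (_ ∷ s) (σ ∷ _) = coalesceFrom-separated L (inj₁ (pos (attained σ))) s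

    M-covers : ∀ {Js x k} → All (All (Sound A)) Js → All (Sorted least) Js →
               Any (Any (Covers x k)) Js → Any (Covers x k) (value (M Js))
    M-covers {J ∷ Js} {x} {k} (σ ∷ σs) (s ∷ ss) c =
      go (mergeLists-sorted J _ s (separated⇒sorted (M-sound σs) (M-separated σs ss)))
         (Any-resp-↭ (↭-sym (mergeLists-↭ J _)) (both c))
      where
      both : Any (Any (Covers x k)) (J ∷ Js) → Any (Covers x k) (J ++ value (M Js))
      both (here c)  = Anyₚ.++⁺ˡ c
      both (there c) = Anyₚ.++⁺ʳ J (M-covers σs ss c)
      go : ∀ {L} → Sorted least L → Any (Covers x k) L → Any (Covers x k) (value (coalesce L))
      go {y ∷ L} (_ ∷ s) c = coalesceFrom-covers L s c

    M-valid : ∀ {Js} → All (All (Sound A)) Js → All (Sorted least) Js →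
              (∀ {x k} → A x k → x ≤ u → k ≤ p → Any (Any (Covers x k)) Js) →
              Valid A (value (M Js))
    M-valid σs ss c = record
      { sound = M-sound σs ; separated = M-separated σs ss
      ; complete = λ a q r → M-covers σs ss (c a q r) }

  -- The operation ⊕

  cutRun-sound : ∀ {A A₁ : ℕ → ℕ → Set} {I k₂} → All (Sound A₁) I →
                 (∀ {x k} → A₁ x k → A x (k + k₂)) → All (Sound A) (value (cutRun I k₂))
  cutRun-sound [] f = []
  cutRun-sound {A} {A₁} {t@([ a ⋯ a′ ]# k₁) ∷ I} {k₂} (σ ∷ σs) f
    with k₁ + k₂ ≤ᵇ p | ≤ᵇ-reflects-≤ (k₁ + k₂) p
  ... | true  | ofʸ q = record
    { parts≤p = q ; lo≤hi = lo≤hi σ ; attained = f (attained σ)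
    ; near = λ r s → case near σ r s of λ (z , a , r′ , s′) → z , f a , r′ , s′ } ∷ cutRun-sound σs f
  ... | false | _     = cutRun-sound σs f

  shiftParts : ℕ → Tuple → Tuple
  shiftParts k₂ t = [ lo t ⋯ hi t ]# (parts t + k₂)

  cutRun-sorted : ∀ {b} I k₂ → Sorted b I → Sorted (shiftParts k₂ b) (value (cutRun I k₂))
  cutRun-sorted [] k₂ _ = [-]
  cutRun-sorted {b} (t ∷ I) k₂ (b≼t ∷ s) with parts t + k₂ ≤ᵇ p
  ... | true  = mono b≼t ∷ cutRun-sorted I k₂ s
    where
    mono : b ≼ t → shiftParts k₂ b ≼ shiftParts k₂ t
    mono (inj₁ q)       = inj₁ (+-monoˡ-< k₂ q)
    mono (inj₂ (e , q)) = inj₂ (cong (_+ k₂) e , q)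
  ... | false = cutRun-sorted I k₂ (sorted-weaken b≼t s)

  cutRun-covers : ∀ {I x k₁ k₂} → k₁ + k₂ ≤ p → Any (Covers x k₁) I →
                  Any (Covers x (k₁ + k₂)) (value (cutRun I k₂))
  cutRun-covers {t ∷ I} {k₂ = k₂} q (here (refl , r))
    with parts t + k₂ ≤ᵇ p | ≤ᵇ-reflects-≤ (parts t + k₂) p
  ... | true  | _      = here (refl , r)
  ... | false | ofⁿ ¬q = contradiction q ¬q
  cutRun-covers {t ∷ I} {k₂ = k₂} q (there c) with parts t + k₂ ≤ᵇ p
  ... | true  = there (cutRun-covers q c)
  ... | false = cutRun-covers q c

  cutRun-length : ∀ I k₂ → length (value (cutRun I k₂)) ≤ length I
  cutRun-length [] k₂ = z≤n
  cutRun-length (t ∷ I) k₂ with parts t + k₂ ≤ᵇ p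
  ... | true  = s≤s (cutRun-length I k₂)
  ... | false = m≤n⇒m≤1+n (cutRun-length I k₂)

  cutRun-steps : ∀ I k₂ → steps (cutRun I k₂) ≡ suc (length I)
  cutRun-steps [] k₂ = refl
  cutRun-steps (t ∷ I) k₂ = cong suc (trans (+-identityʳ _) (cutRun-steps I k₂))

  ⊕-all : ∀ {P : IntervalPartitionSet → Set} {Q : Tuple → Set} I₁ {I₂} → All Q I₂ →
          (∀ {y} → Q y → lo y ≤ u → l ≤ hi y → P (value (cutRun I₁ (parts y)))) →
          All P (value (I₁ ⊕ I₂))
  ⊕-all I₁ [] f = []
  ⊕-all I₁ {y ∷ I₂} (q ∷ qs) f with meets y | meets-reflects y
  ... | true  | ofʸ (r , s) = f q r s ∷ ⊕-all I₁ qs f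
  ... | false | _           = ⊕-all I₁ qs f

  ⊕-any : ∀ {P : IntervalPartitionSet → Set} I₁ {I₂} →
          Any (λ y → lo y ≤ u × l ≤ hi y × P (value (cutRun I₁ (parts y)))) I₂ →
          Any P (value (I₁ ⊕ I₂))
  ⊕-any I₁ {y ∷ I₂} (here (r , s , q)) with meets y | meets-reflects y
  ... | true  | _      = here q
  ... | false | ofⁿ ¬m = contradiction (r , s) ¬m
  ⊕-any I₁ {y ∷ I₂} (there c) with meets y
  ... | true  = there (⊕-any I₁ c)
  ... | false = ⊕-any I₁ c

  ⊕-length : ∀ I₁ I₂ → length (value (I₁ ⊕ I₂)) ≤ length I₂
  ⊕-length I₁ [] = z≤n
  ⊕-length I₁ (y ∷ I₂) with meets y
  ... | true  = s≤s (⊕-length I₁ I₂)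
  ... | false = m≤n⇒m≤1+n (⊕-length I₁ I₂)

  ⊕-steps : ∀ I₁ I₂ → steps (I₁ ⊕ I₂) ≤ suc (length I₂ * (2 + length I₁))
  ⊕-steps I₁ [] = ≤-refl
  ⊕-steps I₁ (y ∷ I₂) with meets y
  ... | true  = s≤s (begin
      steps (I₁ ⊕ I₂) + (steps (cutRun I₁ (parts y)) + 0)
        ≡⟨ cong (steps (I₁ ⊕ I₂) +_) (trans (+-identityʳ _) (cutRun-steps I₁ (parts y))) ⟩
      steps (I₁ ⊕ I₂) + suc (length I₁)                   ≤⟨ +-monoˡ-≤ _ (⊕-steps I₁ I₂) ⟩
      suc (length I₂ * (2 + length I₁)) + suc (length I₁) ≡⟨ +-suc (suc (length I₂ * (2 + length I₁))) (length I₁) ⟩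
      2 + (length I₂ * (2 + length I₁) + length I₁)       ≡⟨ cong (2 +_) (+-comm (length I₂ * (2 + length I₁)) _) ⟩
      2 + (length I₁ + length I₂ * (2 + length I₁))       ∎)
    where open ≤-Reasoning
  ... | false = s≤s (begin
      steps (I₁ ⊕ I₂) + 0                                 ≡⟨ +-identityʳ _ ⟩
      steps (I₁ ⊕ I₂)                                     ≤⟨ ⊕-steps I₁ I₂ ⟩
      suc (length I₂ * (2 + length I₁))                   ≤⟨ s≤s (m≤n+m _ (suc (length I₁))) ⟩
      2 + (length I₁ + length I₂ * (2 + length I₁))       ∎)
    where open ≤-Reasoning

  -- The operation ⊗

  joinTuple : Tuple → Tuple → Tuple
  joinTuple x y = [ lo x + lo y ⋯ hi x + hi y ]# (parts x + parts y ∸ 1)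

  joinable-reflects : ∀ x y → Reflects (lo x + lo y ≤ u × parts x + parts y ∸ 1 ≤ p)
                                       ((lo x + lo y ≤ᵇ u) ∧ (parts x + parts y ∸ 1 ≤ᵇ p))
  joinable-reflects x y = ≤ᵇ-reflects-≤ (lo x + lo y) u ×-reflects ≤ᵇ-reflects-≤ (parts x + parts y ∸ 1) p

  joinRun-all : ∀ {P Q : Tuple → Set} x {I} → All Q I →
                (∀ {y} → Q y → lo x + lo y ≤ u → parts x + parts y ∸ 1 ≤ p → P (joinTuple x y)) →
                All P (value (joinRun x I))
  joinRun-all x [] f = []
  joinRun-all x {y ∷ I} (q ∷ qs) f
    with (lo x + lo y ≤ᵇ u) ∧ (parts x + parts y ∸ 1 ≤ᵇ p) | joinable-reflects x y
  ... | true  | ofʸ (r , s) = f q r s ∷ joinRun-all x qs f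
  ... | false | _           = joinRun-all x qs f

  joinRun-any : ∀ {P : Tuple → Set} x {I} →
                Any (λ y → lo x + lo y ≤ u × parts x + parts y ∸ 1 ≤ p × P (joinTuple x y)) I →
                Any P (value (joinRun x I))
  joinRun-any x {y ∷ I} (here (r , s , q))
    with (lo x + lo y ≤ᵇ u) ∧ (parts x + parts y ∸ 1 ≤ᵇ p) | joinable-reflects x y
  ... | true  | _      = here q
  ... | false | ofⁿ ¬m = contradiction (r , s) ¬m
  joinRun-any x {y ∷ I} (there c) with (lo x + lo y ≤ᵇ u) ∧ (parts x + parts y ∸ 1 ≤ᵇ p)
  ... | true  = there (joinRun-any x c)
  ... | false = joinRun-any x c

  -- If `parts x` were 0, truncated subtraction would send 0 and 1 parts of the second tuple to the
  -- same number, and the order of the left ends could then be wrong.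
  joinTuple-mono : ∀ x {y z} → 1 ≤ parts x → y ≼ z → joinTuple x y ≼ joinTuple x z
  joinTuple-mono ([ _ ⋯ _ ]# suc k) _ (inj₁ q)       = inj₁ (+-monoʳ-< k q)
  joinTuple-mono x                  _ (inj₂ (e , q)) =
    inj₂ (cong (λ k → parts x + k ∸ 1) e , +-monoʳ-≤ (lo x) q)

  joinRun-sorted : ∀ {b} x I → 1 ≤ parts x → Sorted b I → Sorted (joinTuple x b) (value (joinRun x I))
  joinRun-sorted x [] _ _ = [-]
  joinRun-sorted {b} x (y ∷ I) k (b≼y ∷ s)
    with (lo x + lo y ≤ᵇ u) ∧ (parts x + parts y ∸ 1 ≤ᵇ p)
  ... | true  = joinTuple-mono x {b} {y} k b≼y ∷ joinRun-sorted x I k s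
  ... | false = joinRun-sorted x I k (sorted-weaken b≼y s)

  joinRun-length : ∀ x I → length (value (joinRun x I)) ≤ length I
  joinRun-length x [] = z≤n
  joinRun-length x (y ∷ I) with (lo x + lo y ≤ᵇ u) ∧ (parts x + parts y ∸ 1 ≤ᵇ p)
  ... | true  = s≤s (joinRun-length x I)
  ... | false = m≤n⇒m≤1+n (joinRun-length x I)

  joinRun-steps : ∀ x I → steps (joinRun x I) ≡ suc (length I)
  joinRun-steps x [] = refl
  joinRun-steps x (y ∷ I) = cong suc (trans (+-identityʳ _) (joinRun-steps x I))

  ⊗-all : ∀ {P : IntervalPartitionSet → Set} {Q : Tuple → Set} {I₁} I₂ → All Q I₁ →
          (∀ {x} → Q x → P (value (joinRun x I₂))) → All P (value (I₁ ⊗ I₂))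
  ⊗-all I₂ []       f = []
  ⊗-all I₂ (q ∷ qs) f = f q ∷ ⊗-all I₂ qs f

  ⊗-any : ∀ {P : IntervalPartitionSet → Set} {I₁} I₂ →
          Any (λ x → P (value (joinRun x I₂))) I₁ → Any P (value (I₁ ⊗ I₂))
  ⊗-any I₂ (here q)  = here q
  ⊗-any I₂ (there c) = there (⊗-any I₂ c)

  ⊗-length : ∀ I₁ I₂ → length (value (I₁ ⊗ I₂)) ≡ length I₁
  ⊗-length []       I₂ = refl
  ⊗-length (x ∷ I₁) I₂ = cong suc (⊗-length I₁ I₂)

  ⊗-steps : ∀ I₁ I₂ → steps (I₁ ⊗ I₂) ≡ suc (length I₁ * (2 + length I₂))
  ⊗-steps []       I₂ = refl
  ⊗-steps (x ∷ I₁) I₂ = cong suc (begin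
    steps (joinRun x I₂) + (steps (I₁ ⊗ I₂) + 0)
      ≡⟨ cong₂ _+_ (joinRun-steps x I₂) (trans (+-identityʳ _) (⊗-steps I₁ I₂)) ⟩
    suc (length I₂) + suc (length I₁ * (2 + length I₂)) ≡⟨ +-suc (suc (length I₂)) _ ⟩
    2 + (length I₂ + length I₁ * (2 + length I₂))       ∎)
    where open ≡-Reasoning

  -- The operation ⊙ and the final test

  ⊙-value : ∀ I₁ I₂ → value (I₁ ⊙ I₂) ≡ value (I₁ ⊕ I₂) ++ value (I₁ ⊗ I₂)
  ⊙-value I₁ I₂ = append-value (value (I₁ ⊕ I₂)) _

  ⊙-length : ∀ I₁ I₂ → length (value (I₁ ⊙ I₂)) ≤ length I₂ + length I₁
  ⊙-length I₁ I₂ = begin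
    length (value (I₁ ⊙ I₂))                                ≡⟨ cong length (⊙-value I₁ I₂) ⟩
    length (value (I₁ ⊕ I₂) ++ value (I₁ ⊗ I₂))             ≡⟨ length-++ (value (I₁ ⊕ I₂)) ⟩
    length (value (I₁ ⊕ I₂)) + length (value (I₁ ⊗ I₂))     ≤⟨ +-mono-≤ (⊕-length I₁ I₂) (≤-reflexive (⊗-length I₁ I₂)) ⟩
    length I₂ + length I₁                                   ∎
    where open ≤-Reasoning

  ⊙-steps : ∀ {B} I₁ I₂ → length I₁ ≤ B → length I₂ ≤ B →
            steps (I₁ ⊙ I₂) ≤ suc (suc (B * (2 + B)) + (suc (B * (2 + B)) + suc B))
  ⊙-steps I₁ I₂ q r = s≤s (+-mono-≤
    (≤-trans (⊕-steps I₁ I₂) (s≤s (*-mono-≤ r (s≤s (s≤s q)))))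
    (+-mono-≤ (≤-trans (≤-reflexive (⊗-steps I₁ I₂)) (s≤s (*-mono-≤ q (s≤s (s≤s r)))))
              (≤-trans (≤-reflexive (append-steps (value (I₁ ⊕ I₂)) _)) (s≤s (≤-trans (⊕-length I₁ I₂) r)))))

  -- What ⊙ has to capture when two pieces are joined by an edge. Either the edge separates clusters
  -- (`cut`: the root cluster of the second piece becomes final and must weigh between `l` and `u`),
  -- or it lies within the root cluster (`join`: two root clusters become one, hence `∸ 1`); `split`
  -- says that there is no third way.
  record Composition (A₁ A₂ A : ℕ → ℕ → Set) : Set where
    field
      cut   : ∀ {x₁ k₁ x₂ k₂} → A₁ x₁ k₁ → A₂ x₂ k₂ → l ≤ x₂ → x₂ ≤ u → A x₁ (k₁ + k₂)
      join  : ∀ {x₁ k₁ x₂ k₂} → A₁ x₁ k₁ → A₂ x₂ k₂ → A (x₁ + x₂) (k₁ + k₂ ∸ 1)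
      split : ∀ {x k} → A x k →
              (∃[ k₁ ] ∃[ x₂ ] ∃[ k₂ ] A₁ x k₁ × A₂ x₂ k₂ × l ≤ x₂ × x₂ ≤ u × k₁ + k₂ ≡ k) ⊎
              (∃[ x₁ ] ∃[ k₁ ] ∃[ x₂ ] ∃[ k₂ ] A₁ x₁ k₁ × A₂ x₂ k₂ × x₁ + x₂ ≡ x × k₁ + k₂ ∸ 1 ≡ k)

  module _ (l≤u : l ≤ u) where

    -- A right end of at most `u` is itself the weight sought. Otherwise `u` lies in the interval,
    -- and an attained weight within `d` below `u` is at least `u - d = l`.
    meets-attains : ∀ {A t} → Sound A t → lo t ≤ u → l ≤ hi t → ∃[ s ] A s (parts t) × l ≤ s × s ≤ u
    meets-attains {t = t} σ q r with hi t ≤? u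
    ... | yes h = hi t , attained σ , r , h
    ... | no ¬h with near σ q (≰⇒≥ ¬h)
    ...   | s , a , s≤u , u≤s+d =
      s , a , +-cancelʳ-≤ d l s (≤-trans (≤-reflexive (m+[n∸m]≡n l≤u)) u≤s+d) , s≤u

    -- One summand is fixed at an attained weight and the rest of `z` is approximated in the other
    -- interval, so that the error `d` is incurred only once; adding two approximations would allow
    -- `2 d`. For `z` above `a + b′` the fixed summand is `b′`; otherwise it is an attained weight
    -- close to `a`.
    Sound-join : ∀ {A₁ A₂ A : ℕ → ℕ → Set} {x y} →
                 (∀ {x₁ k₁ x₂ k₂} → A₁ x₁ k₁ → A₂ x₂ k₂ → A (x₁ + x₂) (k₁ + k₂ ∸ 1)) →
                 Sound A₁ x → Sound A₂ y → parts x + parts y ∸ 1 ≤ p → Sound A (joinTuple x y)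
    Sound-join {A₁} {A₂} {A} {x@([ a ⋯ a′ ]# k₁)} {y@([ b ⋯ b′ ]# k₂)} f σ τ q = record
      { parts≤p = q ; lo≤hi = +-mono-≤ (lo≤hi σ) (lo≤hi τ)
      ; attained = f (attained σ) (attained τ) ; near = nr }
      where
      open ≤-Reasoning
      nr : ∀ {z} → a + b ≤ z → z ≤ a′ + b′ →
           ∃[ s ] A s (k₁ + k₂ ∸ 1) × s ≤ z × z ≤ s + d
      nr {z} r r′ with z ≤? a + b′
      ... | no z≰ with near σ {z ∸ b′} (m+n≤o⇒m≤o∸n a (≰⇒≥ z≰)) (m≤n+o⇒m∸n≤o z b′ (subst (z ≤_) (+-comm a′ b′) r′))
      ...   | s , α , s≤ , ≤s+d = s + b′ , f α (attained τ)
              , (begin s + b′ ≤⟨ +-monoˡ-≤ b′ s≤ ⟩ z ∸ b′ + b′ ≡⟨ m∸n+n≡m b′≤z ⟩ z ∎)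
              , (begin
                  z            ≡⟨ m∸n+n≡m b′≤z ⟨
                  z ∸ b′ + b′  ≤⟨ +-monoˡ-≤ b′ ≤s+d ⟩
                  s + d + b′   ≡⟨ +-assoc s d b′ ⟩
                  s + (d + b′) ≡⟨ cong (s +_) (+-comm d b′) ⟩
                  s + (b′ + d) ≡⟨ +-assoc s b′ d ⟨
                  s + b′ + d   ∎)
        where
        b′≤z : b′ ≤ z
        b′≤z = ≤-trans (m≤n+m b′ a) (≰⇒≥ z≰)
      -- Here `s ≤ a` makes `z ∸ s` at least `b`, but it may exceed `b′`. In that case `s + b′` is
      -- near enough, since `z ≤ a + b′` and `a ≤ s + d`.
      nr {z} r r′ | yes z≤ with near σ ≤-refl (lo≤hi σ)
      ... | s , α , s≤a , a≤s+d with z ∸ s ≤? b′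
      ...   | no z∸s≰ = s + b′ , f α (attained τ)
              , (begin s + b′ ≤⟨ +-monoʳ-≤ s (≰⇒≥ z∸s≰) ⟩ s + (z ∸ s) ≡⟨ m+[n∸m]≡n s≤z ⟩ z ∎)
              , (begin
                  z            ≤⟨ z≤ ⟩
                  a + b′       ≤⟨ +-monoˡ-≤ b′ a≤s+d ⟩
                  s + d + b′   ≡⟨ +-assoc s d b′ ⟩
                  s + (d + b′) ≡⟨ cong (s +_) (+-comm d b′) ⟩
                  s + (b′ + d) ≡⟨ +-assoc s b′ d ⟨
                  s + b′ + d   ∎)
        where
        s≤z : s ≤ z
        s≤z = ≤-trans s≤a (≤-trans (m≤m+n a b) r)
      ...   | yes z∸s≤ with near τ {z ∸ s} (m+n≤o⇒m≤o∸n b (≤-trans (≤-reflexive (+-comm b s)) (≤-trans (+-monoˡ-≤ b s≤a) r))) z∸s≤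
      ...     | s₂ , β , s₂≤ , ≤s₂+d = s + s₂ , f α β
              , (begin s + s₂ ≤⟨ +-monoʳ-≤ s s₂≤ ⟩ s + (z ∸ s) ≡⟨ m+[n∸m]≡n s≤z ⟩ z ∎)
              , (begin
                  z            ≡⟨ m+[n∸m]≡n s≤z ⟨
                  s + (z ∸ s)  ≤⟨ +-monoʳ-≤ s ≤s₂+d ⟩
                  s + (s₂ + d) ≡⟨ +-assoc s s₂ d ⟨
                  s + s₂ + d   ∎)
        where
        s≤z : s ≤ z
        s≤z = ≤-trans s≤a (≤-trans (m≤m+n a b) r)

    module _ {A₁ A₂ A : ℕ → ℕ → Set} (pos₁ : Positive A₁) (pos₂ : Positive A₂) (c : Composition A₁ A₂ A) where
      open Composition c

      Composition-positive : Positive A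
      Composition-positive a with split a
      ... | inj₁ (_ , _ , _ , a₁ , _ , _ , _ , refl)     = ≤-trans (pos₁ a₁) (m≤m+n _ _)
      ... | inj₂ (_ , k₁ , _ , k₂ , a₁ , a₂ , _ , refl) =
        m+n≤o⇒m≤o∸n 1 (+-mono-≤ (pos₁ a₁) (pos₂ a₂))

      ⊙-sound : ∀ {I₁ I₂} → All (Sound A₁) I₁ → All (Sound A₂) I₂ → All (All (Sound A)) (value (I₁ ⊙ I₂))
      ⊙-sound {I₁} {I₂} σs τs = subst (All _) (sym (⊙-value I₁ I₂)) (Allₚ.++⁺
        (⊕-all I₁ τs λ τ q r → case meets-attains τ q r of λ
          (s , β , l≤s , s≤u) → cutRun-sound {A} {A₁} σs (λ α → cut α β l≤s s≤u))
        (⊗-all I₂ σs λ {x} σ → joinRun-all x τs λ {y} τ _ q → Sound-join {x = x} {y = y} join σ τ q))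

      ⊙-sorted : ∀ {I₁ I₂} → Valid A₁ I₁ → Valid A₂ I₂ → All (Sorted least) (value (I₁ ⊙ I₂))
      ⊙-sorted {I₁} {I₂} v w = subst (All _) (sym (⊙-value I₁ I₂)) (Allₚ.++⁺
        (⊕-all I₁ (sound w) λ {y} _ _ _ → sorted-least (cutRun-sorted I₁ (parts y) (valid⇒sorted v)))
        (⊗-all I₂ (sound v) λ {x} σ → sorted-least (joinRun-sorted x I₂ (pos₁ (attained σ)) (valid⇒sorted w))))

      -- No tuple that is needed gets discarded: an interval covering a weight in `[l,u]` meets
      -- `[l,u]`, the left ends of covering intervals add up to at most `x ≤ u`, and as both numbers
      -- of parts are positive, neither exceeds `k ≤ p`.
      ⊙-covers : ∀ {I₁ I₂ x k} → Valid A₁ I₁ → Valid A₂ I₂ → A x k → x ≤ u → k ≤ p →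
                 Any (Any (Covers x k)) (value (I₁ ⊙ I₂))
      ⊙-covers {I₁} {I₂} {x} v w a x≤u k≤p with split a
      ... | inj₁ (k₁ , x₂ , k₂ , a₁ , a₂ , l≤x₂ , x₂≤u , refl) =
        subst (Any _) (sym (⊙-value I₁ I₂)) (Anyₚ.++⁺ˡ (⊕-any I₁
          (Any.map (λ { (refl , q , r) → ≤-trans q x₂≤u , ≤-trans l≤x₂ r
                                       , cutRun-covers k≤p (complete v a₁ x≤u (≤-trans (m≤m+n k₁ k₂) k≤p)) })
                   (complete w a₂ x₂≤u (≤-trans (m≤n+m k₂ k₁) k≤p)))))
      ... | inj₂ (x₁ , k₁ , x₂ , k₂ , a₁ , a₂ , refl , refl) =
        subst (Any _) (sym (⊙-value I₁ I₂)) (Anyₚ.++⁺ʳ (value (I₁ ⊕ I₂)) (⊗-any I₂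
          (Any.map (λ { {t} (refl , q , r) → joinRun-any t
             (Any.map (λ { (refl , q′ , r′) → ≤-trans (+-mono-≤ q q′) x≤u , k≤p
                                            , refl , +-mono-≤ q q′ , +-mono-≤ r r′ })
               (complete w a₂ (≤-trans (m≤n+m x₂ x₁) x≤u)
                 (≤-trans (m+n≤o⇒m≤o∸n k₂ (≤-trans (+-monoʳ-≤ k₂ (pos₁ a₁)) (≤-reflexive (+-comm k₂ k₁)))) k≤p))) })
             (complete v a₁ (≤-trans (m≤m+n x₁ x₂) x≤u)
               (≤-trans (m+n≤o⇒m≤o∸n k₁ (+-monoʳ-≤ k₁ (pos₂ a₂))) k≤p)))))

      ⊙-valid : ∀ {I₁ I₂} → Valid A₁ I₁ → Valid A₂ I₂ → Valid A (value (M (value (I₁ ⊙ I₂))))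
      ⊙-valid v w = M-valid Composition-positive (⊙-sound (sound v) (sound w)) (⊙-sorted v w) (⊙-covers v w)

    -- Each member represents its own `B`, such as the partitions of one cut of a cycle. Soundness
    -- passes from `B` to `A`, while completeness for `A` asks for just one suitable member for each
    -- partition.
    ∪-valid : ∀ {A Js} → Positive A →
              All (λ J → ∃[ B ] Valid B J × (∀ {x k} → B x k → A x k)) Js →
              (∀ {x k} → A x k → Any (λ J → ∃[ B ] Valid B J × B x k) Js) →
              Valid A (value (M Js))
    ∪-valid pos vs cs = M-valid pos
      (All.map (λ (_ , v , f) → All.map (Sound-map f) (sound v)) vs)
      (All.map (λ (_ , v , _) → valid⇒sorted v) vs)
      (λ a q r → Any.map (λ (_ , v , b) → complete v b q r) (cs a))

    accepts⇔ : ∀ {n} (w : Fin n → ℕ) {A I} → Valid A I →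
               (value (accepts w I) ≡ true) ⇔ (∃[ x ] A x p × l ≤ x × x ≤ u)
    accepts⇔ w {A} v = mk⇔ (to (sound v)) λ (x , a , q , r) → from (complete v a r ≤-refl) q r
      where
      to : ∀ {I} → All (Sound A) I → value (accepts w I) ≡ true → ∃[ x ] A x p × l ≤ x × x ≤ u
      to {t ∷ I} (σ ∷ σs) =
        if-elim (λ m → value m ≡ true → ∃[ x ] A x p × l ≤ x × x ≤ u)
          (≡ᵇ-reflects-≡ (parts t) p ×-reflects meets-reflects t)
          (λ (e , q , r) _ → case meets-attains σ q r of λ (s , a , y) → s , subst (A s) e a , y)
          (λ _ → to σs)
      from : ∀ {x I} → Any (Covers x p) I → l ≤ x → x ≤ u → value (accepts w I) ≡ true
      from {x} {t ∷ I} c q r =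
        if-elim (λ m → value m ≡ true)
          (≡ᵇ-reflects-≡ (parts t) p ×-reflects meets-reflects t)
          (λ _ → refl)
          (λ ¬m → case c of λ where
            (here (e , q′ , r′)) → contradiction (e , ≤-trans q′ r , ≤-trans q r′) ¬m
            (there c′)           → from c′ q r)

  -- Sizes of sets and numbers of steps

  accepts-steps : ∀ {n} (w : Fin n → ℕ) I → steps (accepts w I) ≤ suc (length I)
  accepts-steps w []      = ≤-refl
  accepts-steps w (t ∷ I) =
    s≤s (if-elim (λ m → steps m ≤ suc (length I))
           (≡ᵇ-reflects-≡ (parts t) p ×-reflects meets-reflects t)
           (λ _ → z≤n) (λ _ → accepts-steps w I))

  -- With `W` the total weight, this is `W - (k-1) u ≤ x ≤ W - (k-1) l`, rearranged so that no
  -- subtraction is truncated.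
  Measured : ℕ → (ℕ → ℕ → Set) → Set
  Measured W A = ∀ {x k} → A x k → 1 ≤ k × W + u ≤ x + k * u × x + k * l ≤ W + l

  -- A strict upper bound for `rank`: the term for `k ≤ p` is at most `p * p`, and the quotient is
  -- less than `p`.
  maxLength : ℕ
  maxLength = p * p + p

  -- Root clusters of partitions into k clusters have weights in an interval of
  -- length (k - 1) d, in which at most k pairwise non-interfering intervals
  -- can start; rank numbers the possible positions for all k consecutively.
  module _ (l≤u : l ≤ u) {W : ℕ} {A : ℕ → ℕ → Set} (μ : Measured W A) where

    -- `offset` is the distance of the left end from `W - (k-1) u`, the least weight that the root
    -- cluster can have.
    offset rank : Tuple → ℕ
    offset t = lo t + parts t * u ∸ (W + u)
    rank t = parts t * p + offset t / suc d

    -- `Sound` does not say that the left end is attained, but it provides an attained weight at or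
    -- below it, and a lower bound carries over upwards.
    lo-measured : ∀ {t} → Sound A t → W + u ≤ lo t + parts t * u
    lo-measured {t} σ with near σ ≤-refl (lo≤hi σ)
    ... | s , a , s≤ , _ = ≤-trans (proj₁ (proj₂ (μ a))) (+-monoˡ-≤ _ s≤)

    -- The attained right end bounds the left end from above; with `u = l + d` the offset is then at
    -- most `(k-1) d`.
    offset< : ∀ {t} → Sound A t → offset t < parts t * suc d
    offset< {t} σ with parts t | μ (attained σ)
    ... | suc k | _ , _ , q = begin-strict
      lo t + suc k * u ∸ (W + u)  ≤⟨ m≤n+o⇒m∸n≤o _ (W + u) (begin
        lo t + (u + k * u)              ≡⟨ cong (λ z → lo t + (u + k * z)) (m+[n∸m]≡n l≤u) ⟨
        lo t + (u + k * (l + d))        ≡⟨ solve 5 (λ a u k l d → a :+ (u :+ k :* (l :+ d)) := (a :+ k :* l) :+ (u :+ k :* d)) refl (lo t) u k l d ⟩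
        (lo t + k * l) + (u + k * d)    ≤⟨ +-monoˡ-≤ _ (+-monoˡ-≤ (k * l) (lo≤hi σ)) ⟩
        (hi t + k * l) + (u + k * d)    ≤⟨ +-monoˡ-≤ _ (+-cancelʳ-≤ l _ W (≤-trans (≤-reflexive
                                             (trans (+-assoc (hi t) (k * l) l) (cong (hi t +_) (+-comm (k * l) l)))) q)) ⟩
        W + (u + k * d)                 ≡⟨ +-assoc W u (k * d) ⟨
        W + u + k * d                   ∎) ⟩
      k * d                       ≤⟨ *-monoʳ-≤ k (n≤1+n d) ⟩
      k * suc d                   <⟨ m<n+m (k * suc d) z<s ⟩
      suc k * suc d               ∎
      where
      open ≤-Reasoning
      open +-*-Solver

    rank-bound : ∀ {t} → Sound A t → rank t < maxLength
    rank-bound {t} σ = +-mono-≤-< (*-monoˡ-≤ p (parts≤p σ))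
      (<-≤-trans (m<n*o⇒m/o<n {offset t} (offset< σ)) (parts≤p σ))

    -- For equal `k`, left ends are at least `d + 1` apart, so the quotient by `d + 1` grows. For
    -- different `k`, the quotient stays below `p` and cannot make up for a step of `p`.
    rank-increasing : ∀ {x y} → Sound A x → Sound A y → x ◁ y → rank x < rank y
    rank-increasing {x} {y} σ τ (inj₁ q) = begin-strict
      parts x * p + offset x / suc d <⟨ +-monoʳ-< (parts x * p) (<-≤-trans (m<n*o⇒m/o<n {offset x} (offset< σ)) (parts≤p σ)) ⟩
      parts x * p + p                ≡⟨ +-comm (parts x * p) p ⟩
      suc (parts x) * p              ≤⟨ *-monoˡ-≤ p q ⟩
      parts y * p                    ≤⟨ m≤m+n _ _ ⟩
      rank y                         ∎
      where open ≤-Reasoning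
    rank-increasing {x@([ a ⋯ a′ ]# k)} {y@([ b ⋯ _ ]# .k)} σ τ (inj₂ (refl , q)) = +-monoʳ-< (k * p) (begin
      suc (offset x / suc d)             ≡⟨ cong (λ z → suc (z / suc d)) (m+n∸n≡m (offset x) (suc d)) ⟨
      suc ((offset x + suc d ∸ suc d) / suc d) ≡⟨ m/n≡1+[m∸n]/n {offset x + suc d} (m≤n+m (suc d) (offset x)) ⟨
      (offset x + suc d) / suc d         ≤⟨ /-monoˡ-≤ (suc d) (begin
        a + k * u ∸ (W + u) + suc d        ≡⟨ +-∸-comm (suc d) (lo-measured σ) ⟨
        (a + k * u + suc d) ∸ (W + u)      ≤⟨ ∸-monoˡ-≤ (W + u) (begin
          a + k * u + suc d                  ≡⟨ solve 3 (λ a ku e → a :+ ku :+ e := (a :+ e) :+ ku) refl a (k * u) (suc d) ⟩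
          a + suc d + k * u                  ≤⟨ +-monoˡ-≤ (k * u) (begin
            a + suc d      ≡⟨ +-suc a d ⟩
            suc (a + d)    ≤⟨ s≤s (+-monoˡ-≤ d (lo≤hi σ)) ⟩
            suc (a′ + d)   ≤⟨ q ⟩
            b              ∎) ⟩
          b + k * u                          ∎) ⟩
        b + k * u ∸ (W + u)                ∎) ⟩
      offset y / suc d                   ∎)
      where
      open ≤-Reasoning
      open +-*-Solver

    separated-length : ∀ {b I} → All (Sound A) I → Linked _◁_ (b ∷ I) → length I ≤ maxLength
    separated-length _ [-] = z≤n
    separated-length {I = x ∷ I} σs (_ ∷ s) = go σs s
      where
      climb : ∀ {x I} → All (Sound A) (x ∷ I) → Linked _◁_ (x ∷ I) → rank x + length I < maxLength
      climb {x} (σ ∷ []) [-] = subst (_< maxLength) (sym (+-identityʳ (rank x))) (rank-bound σ)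
      climb {x} {y ∷ I} (σ ∷ τ ∷ σs) (x◁y ∷ s) = begin-strict
        rank x + suc (length I) ≡⟨ +-suc (rank x) (length I) ⟩
        suc (rank x) + length I ≤⟨ +-monoˡ-≤ (length I) (rank-increasing {x} {y} σ τ x◁y) ⟩
        rank y + length I       <⟨ climb (τ ∷ σs) s ⟩
        maxLength               ∎
        where open ≤-Reasoning
      go : ∀ {x I} → All (Sound A) (x ∷ I) → Linked _◁_ (x ∷ I) → length (x ∷ I) ≤ maxLength
      go {x} {I} σs s = ≤-<-trans (m≤n+m (length I) (rank x)) (climb σs s)

    valid-length : ∀ {I} → Valid A I → length I ≤ maxLength
    valid-length v = separated-length (sound v) (separated v)

    -- The accumulated set is coalesced after every run and so never exceeds `maxLength`. A run
    -- costs one tick and at most `1 + 2 maxLength` for merging and again for coalescing.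
    M-steps : ∀ {Js} → All (All (Sound A)) Js → All (Sorted least) Js →
              All (λ J → length J ≤ maxLength) Js →
              steps (M Js) ≤ suc (length Js * (3 + 4 * maxLength))
    M-steps [] _ _ = ≤-refl
    M-steps {J ∷ Js} (σ ∷ σs) (s ∷ ss) (q ∷ qs) = s≤s (begin
      steps (M Js) + (steps (mergeLists J K) + steps (coalesce L))
        ≤⟨ +-mono-≤ (M-steps σs ss qs) (+-mono-≤ (mergeLists-steps J K) (coalesce-steps L)) ⟩
      suc (length Js * c) + (suc (length J + length K) + suc (length L))
        ≤⟨ +-monoʳ-≤ (suc (length Js * c)) (+-mono-≤ (s≤s (+-mono-≤ q K-length)) (s≤s (≤-trans (≤-reflexive L-length) (+-mono-≤ q K-length)))) ⟩
      suc (length Js * c) + (suc (maxLength + maxLength) + suc (maxLength + maxLength))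
        ≡⟨ solve 2 (λ j m → con 1 :+ j :+ (con 1 :+ (m :+ m) :+ (con 1 :+ (m :+ m))) := con 3 :+ con 4 :* m :+ j) refl (length Js * c) maxLength ⟩
      c + length Js * c ∎)
      where
      open ≤-Reasoning
      open +-*-Solver
      c = 3 + 4 * maxLength
      K = value (M Js)
      L = value (mergeLists J K)
      pos : Positive A
      pos a = proj₁ (μ a)
      K-length : length K ≤ maxLength
      K-length = separated-length (M-sound pos σs) (M-separated pos σs ss)
      L-length : length L ≡ length J + length K
      L-length = trans (↭-length (mergeLists-↭ J K)) (length-++ J)

    ∪-steps : ∀ {Js} → All (λ J → ∃[ B ] Valid B J × (∀ {x k} → B x k → A x k)) Js →
              steps (M Js) ≤ suc (length Js * (3 + 4 * maxLength))
    ∪-steps vs = M-steps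
      (All.map (λ (_ , v , f) → All.map (Sound-map f) (sound v)) vs)
      (All.map (λ (_ , v , _) → valid⇒sorted v) vs)
      (All.map (λ (_ , v , f) → separated-length (All.map (Sound-map f) (sound v)) (separated v)) vs)

  -- 26 is `5 + 11 + 10`, the sum of the coefficients of the polynomial in `maxLength` that bounds
  -- one ⊙ followed by M, once the lower powers are raised to the square.
  unit : ℕ
  unit = 26 * (maxLength * maxLength)

  ⊙M-steps : ∀ {W W₁ W₂} {A₁ A₂ A : ℕ → ℕ → Set} → l ≤ u → 1 ≤ p → Measured W₁ A₁ → Measured W₂ A₂ → Measured W A →
             Composition A₁ A₂ A → ∀ {I₁ I₂} → Valid A₁ I₁ → Valid A₂ I₂ →
             steps (I₁ ⊙ I₂) + steps (M (value (I₁ ⊙ I₂))) ≤ unit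
  ⊙M-steps {A₁ = A₁} {A₂} {A} l≤u 1≤p μ₁ μ₂ μ c {I₁} {I₂} v w = begin
    steps (I₁ ⊙ I₂) + steps (M (value (I₁ ⊙ I₂)))
      ≤⟨ +-mono-≤ (⊙-steps I₁ I₂ I₁≤ I₂≤)
           (≤-trans (M-steps l≤u μ (⊙-sound l≤u pos₁ pos₂ c (sound v) (sound w)) (⊙-sorted l≤u pos₁ pos₂ c v w) lengths)
             (s≤s (*-monoˡ-≤ (3 + 4 * maxLength) (≤-trans (⊙-length I₁ I₂) (+-mono-≤ I₂≤ I₁≤))))) ⟩
    suc (suc (B * (2 + B)) + (suc (B * (2 + B)) + suc B)) + suc ((B + B) * (3 + 4 * B))
      ≡⟨ solve 1 (λ b → con 1 :+ ((con 1 :+ b :* (con 2 :+ b)) :+ ((con 1 :+ b :* (con 2 :+ b)) :+ (con 1 :+ b)))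
                          :+ (con 1 :+ (b :+ b) :* (con 3 :+ con 4 :* b))
                    := con 5 :+ con 11 :* b :+ con 10 :* (b :* b)) refl B ⟩
    5 + 11 * B + 10 * (B * B)
      ≤⟨ +-monoˡ-≤ (10 * (B * B)) (+-mono-≤ (*-monoʳ-≤ 5 (*-mono-≤ 1≤B 1≤B)) (*-monoʳ-≤ 11 (m≤n*m B B {{>-nonZero 1≤B}}))) ⟩
    5 * (B * B) + 11 * (B * B) + 10 * (B * B)
      ≡⟨ solve 1 (λ b → con 5 :* (b :* b) :+ con 11 :* (b :* b) :+ con 10 :* (b :* b) := con 26 :* (b :* b)) refl B ⟩
    26 * (B * B) ∎
    where
    open ≤-Reasoning
    open +-*-Solver
    B = maxLength
    pos₁ : Positive A₁
    pos₁ a = proj₁ (μ₁ a)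
    pos₂ : Positive A₂
    pos₂ a = proj₁ (μ₂ a)
    1≤B : 1 ≤ B
    1≤B = ≤-trans 1≤p (m≤n+m p (p * p))
    I₁≤ = valid-length l≤u μ₁ v
    I₂≤ = valid-length l≤u μ₂ w
    lengths : All (λ J → length J ≤ B) (value (I₁ ⊙ I₂))
    lengths = subst (All _) (sym (⊙-value I₁ I₂)) (Allₚ.++⁺
      (⊕-all I₁ (sound w) λ {y} _ _ _ → ≤-trans (cutRun-length I₁ (parts y)) I₁≤)
      (⊗-all I₂ (sound v) λ {x} _ → ≤-trans (joinRun-length x I₂) I₂≤))

-- Lists and adjacency

module _ {A : Set} where

  Unique-resp-↭ : ∀ {xs ys : List A} → xs ↭ ys → Unique xs → Unique ys
  Unique-resp-↭ xs↭ys = Permₛ.Unique-resp-↭ (setoid A) (↭⇒↭ₛ xs↭ys)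

  Unique-++⁻ : ∀ (xs : List A) {ys} → Unique (xs ++ ys) →
               Unique xs × Unique ys × (∀ {z} → z ∈ xs → z ∈ ys → ⊥)
  Unique-++⁻ [] u = [] , u , λ ()
  Unique-++⁻ (x ∷ xs) (x∉ ∷ u) with Unique-++⁻ xs u
  ... | uˡ , uʳ , disjoint = Allₚ.++⁻ˡ xs x∉ ∷ uˡ , uʳ , λ where
    (here refl)  z∈ys → All.lookup (Allₚ.++⁻ʳ xs x∉) z∈ys refl
    (there z∈xs) z∈ys → disjoint z∈xs z∈ys

  unique⇒↭ : ∀ {xs ys : List A} → Unique xs → Unique ys →
             (∀ {z} → z ∈ xs → z ∈ ys) → (∀ {z} → z ∈ ys → z ∈ xs) → xs ↭ ys
  unique⇒↭ u v f g = ∼bag⇒↭ (unique∧set⇒bag u v (mk⇔ f g))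

  ++-interchange : ∀ (as bs cs ds : List A) → (as ++ bs) ++ (cs ++ ds) ↭ (as ++ cs) ++ (bs ++ ds)
  ++-interchange as bs cs ds = begin
    (as ++ bs) ++ (cs ++ ds) ≡⟨ ++-assoc as bs (cs ++ ds) ⟩
    as ++ bs ++ cs ++ ds     ↭⟨ ++⁺ˡ as (shifts bs cs) ⟩
    as ++ cs ++ bs ++ ds     ≡⟨ ++-assoc as cs (bs ++ ds) ⟨
    (as ++ cs) ++ bs ++ ds   ∎
    where open PermutationReasoning

  concat-↭ : ∀ {xss yss : List (List A)} → xss ↭ yss → concat xss ↭ concat yss
  concat-↭ Perm.refl           = ↭-refl
  concat-↭ (Perm.prep xs p)    = ++⁺ˡ xs (concat-↭ p)
  concat-↭ (Perm.swap xs ys p) = ↭-trans (++⁺ˡ xs (++⁺ˡ ys (concat-↭ p))) (shifts xs ys)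
  concat-↭ (Perm.trans p q)    = ↭-trans (concat-↭ p) (concat-↭ q)

  firstFailure : ∀ {P : A → Set} → Decidable P → ∀ xs →
                 All P xs ⊎ (∃[ ys ] ∃[ z ] ∃[ zs ] xs ≡ ys ++ z ∷ zs × All P ys × ¬ P z)
  firstFailure P? [] = inj₁ []
  firstFailure P? (x ∷ xs) with P? x
  ... | no ¬p = inj₂ ([] , x , xs , refl , [] , ¬p)
  ... | yes p with firstFailure P? xs
  ...   | inj₁ ps                               = inj₁ (p ∷ ps)
  ...   | inj₂ (ys , z , zs , refl , ps , ¬p)   = inj₂ (x ∷ ys , z , zs , refl , p ∷ ps , ¬p)

-- Undirected adjacency and connected lists of vertices

module _ {A : Set} where

  pairs : List A → List (A × A)
  pairs []           = []
  pairs (x ∷ [])     = []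
  pairs (x ∷ y ∷ zs) = (x , y) ∷ pairs (y ∷ zs)

  Adj : List (A × A) → A → A → Set
  Adj E x y = (x , y) ∈ E ⊎ (y , x) ∈ E

  Adj-sym : ∀ {E x y} → Adj E x y → Adj E y x
  Adj-sym = Sum.swap

  Adj-mono : ∀ {E F x y} → (∀ {z} → z ∈ E → z ∈ F) → Adj E x y → Adj F x y
  Adj-mono f = Sum.map f f

  Adj-++⁻ : ∀ E {F x y} → Adj (E ++ F) x y → Adj E x y ⊎ Adj F x y
  Adj-++⁻ E (inj₁ e) = Sum.map inj₁ inj₁ (∈-++⁻ E e)
  Adj-++⁻ E (inj₂ e) = Sum.map inj₂ inj₂ (∈-++⁻ E e)

  Adj-∷⁻ : ∀ {e E x y} → Adj (e ∷ E) x y → (x , y) ≡ e ⊎ (y , x) ≡ e ⊎ Adj E x y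
  Adj-∷⁻ (inj₁ (here p))  = inj₁ p
  Adj-∷⁻ (inj₁ (there p)) = inj₂ (inj₂ (inj₁ p))
  Adj-∷⁻ (inj₂ (here p))  = inj₂ (inj₁ p)
  Adj-∷⁻ (inj₂ (there p)) = inj₂ (inj₂ (inj₂ p))

  lastOf : A → List A → A
  lastOf x []       = x
  lastOf x (y ∷ ys) = lastOf y ys

  pairs-++ : ∀ x xs y ys → pairs (x ∷ xs ++ y ∷ ys) ≡ pairs (x ∷ xs) ++ (lastOf x xs , y) ∷ pairs (y ∷ ys)
  pairs-++ x []        y ys = refl
  pairs-++ x (x′ ∷ xs) y ys = cong ((x , x′) ∷_) (pairs-++ x′ xs y ys)

  -- A cycle is a path that ends where it starts; in this form `pairs-++` can cut it at an edge.
  cyclicPairs≡pairs : ∀ x xs → cyclicPairs (x ∷ xs) ≡ pairs (x ∷ xs ∷ʳ x)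
  cyclicPairs≡pairs x xs = go x xs
    where
    go : ∀ y ys → zip (y ∷ ys) (ys ∷ʳ x) ≡ pairs (y ∷ ys ∷ʳ x)
    go y []        = refl
    go y (y′ ∷ ys) = cong ((y , y′) ∷_) (go y′ ys)

  Adj-pairs-ʳ++ : ∀ xs {y ys a b} → Adj (pairs (xs ʳ++ (y ∷ ys))) a b →
                  Adj (pairs (y ∷ xs)) a b ⊎ Adj (pairs (y ∷ ys)) a b
  Adj-pairs-ʳ++ [] e = inj₂ e
  Adj-pairs-ʳ++ (x ∷ xs) e with Adj-pairs-ʳ++ xs e
  ... | inj₁ e′ = inj₁ (Adj-mono there e′)
  ... | inj₂ e′ with Adj-∷⁻ e′
  ...   | inj₁ refl        = inj₁ (inj₂ (here refl))
  ...   | inj₂ (inj₁ refl) = inj₁ (inj₁ (here refl))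
  ...   | inj₂ (inj₂ e″)   = inj₂ e″

  Adj-pairs-reverse⁻ : ∀ xs {a b} → Adj (pairs (reverse xs)) a b → Adj (pairs xs) a b
  Adj-pairs-reverse⁻ (x ∷ xs) e with Adj-pairs-ʳ++ xs e
  ... | inj₁ e′ = e′
  ... | inj₂ (inj₁ ())
  ... | inj₂ (inj₂ ())
  Adj-pairs-reverse⁻ [] (inj₁ ())
  Adj-pairs-reverse⁻ [] (inj₂ ())

  Adj-pairs-reverse⁺ : ∀ xs {a b} → Adj (pairs xs) a b → Adj (pairs (reverse xs)) a b
  Adj-pairs-reverse⁺ xs e =
    Adj-pairs-reverse⁻ (reverse xs) (subst (λ zs → Adj (pairs zs) _ _) (sym (reverse-involutive xs)) e)

  Step : List (A × A) → List A → A → A → Set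
  Step E C a b = a ∈ C × b ∈ C × Adj E a b

  Conn : List (A × A) → List A → Set
  Conn E C = ∀ {x y} → x ∈ C → y ∈ C → Star (Step E C) x y

  Step-sym : ∀ {E C a b} → Step E C a b → Step E C b a
  Step-sym (p , q , e) = q , p , Adj-sym e

  Conn-map : ∀ {E F C} → (∀ {a b} → Step E C a b → Star (Step F C) a b) → Conn E C → Conn F C
  Conn-map f c p q = Star.concat (Star.map f (c p q))

  Conn-mono : ∀ {E F C} → (∀ {a b} → Adj E a b → Adj F a b) → Conn E C → Conn F C
  Conn-mono f = Conn-map (λ (p , q , e) → (p , q , f e) ◅ ε)

  pairs-path : ∀ {E C} x xs → (∀ {e} → e ∈ pairs (x ∷ xs) → e ∈ E) → All (_∈ C) (x ∷ xs) →
               ∀ {y} → y ∈ x ∷ xs → Star (Step E C) x y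
  pairs-path x xs       f ps            (here refl) = ε
  pairs-path x (y ∷ xs) f (p ∷ q ∷ ps) (there r)   =
    (p , q , inj₁ (f (here refl))) ◅ pairs-path y xs (f ∘ there) (q ∷ ps) r

-- Rooted pieces of a graph

record Piece (n : ℕ) : Set where
  constructor piece
  field
    root  : Fin n
    verts : List (Fin n)
    arcs  : List (Fin n × Fin n)
open Piece public

module _ {n : ℕ} where
  private V = Fin n

  record WellFormed (P : Piece n) : Set where
    field
      root∈  : root P ∈ verts P
      arcs∈  : ∀ {x y} → Adj (arcs P) x y → x ∈ verts P
      unique : Unique (verts P)

    arcs∈ʳ : ∀ {x y} → Adj (arcs P) x y → y ∈ verts P
    arcs∈ʳ e = arcs∈ (Adj-sym e)
  open WellFormed public

  single : V → Piece n
  single v = piece v (v ∷ []) []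

  link : Piece n → Piece n → Piece n
  link P Q = piece (root P) (verts P ++ verts Q) ((root P , root Q) ∷ arcs P ++ arcs Q)

  ring : Piece n → List (Piece n) → Piece n
  ring P Qs = piece (root P) (verts P ++ concatMap verts Qs)
    (cyclicPairs (root P ∷ map root Qs) ++ arcs P ++ concatMap arcs Qs)

  attach : Piece n → List (Piece n) → Piece n
  attach P []       = P
  attach P (Q ∷ Qs) = link P (attach Q Qs)

  -- T(C,j) with the pieces hanging from its vertices; the deleted edge joins
  -- the last piece of Ps to the first piece of Qs.
  cutRing : Piece n → (Ps Qs : List (Piece n)) → Piece n
  cutRing P Ps Qs = attach (attach P Ps) (reverse Qs)

  single-wf : ∀ v → WellFormed (single v)
  single-wf v = record { root∈ = here refl ; arcs∈ = λ { (inj₁ ()) ; (inj₂ ()) } ; unique = [] ∷ [] }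

  link-wf : ∀ {P Q} → WellFormed P → WellFormed Q → Unique (verts P ++ verts Q) → WellFormed (link P Q)
  link-wf {P} {Q} wP wQ u = record { root∈ = ∈-++⁺ˡ (root∈ wP) ; arcs∈ = go ; unique = u }
    where
    go : ∀ {x y} → Adj (arcs (link P Q)) x y → x ∈ verts P ++ verts Q
    go e with Adj-∷⁻ e
    ... | inj₁ refl        = ∈-++⁺ˡ (root∈ wP)
    ... | inj₂ (inj₁ refl) = ∈-++⁺ʳ (verts P) (root∈ wQ)
    ... | inj₂ (inj₂ e′) with Adj-++⁻ (arcs P) e′
    ...   | inj₁ e″ = ∈-++⁺ˡ (arcs∈ wP e″)
    ...   | inj₂ e″ = ∈-++⁺ʳ (verts P) (arcs∈ wQ e″)

  attach-root : ∀ P Qs → root (attach P Qs) ≡ root P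
  attach-root P []      = refl
  attach-root P (_ ∷ _) = refl

  attach-verts : ∀ P Qs → verts (attach P Qs) ≡ verts P ++ concatMap verts Qs
  attach-verts P []       = sym (++-identityʳ (verts P))
  attach-verts P (Q ∷ Qs) = cong (verts P ++_) (attach-verts Q Qs)

  attach-arcs : ∀ P Qs → arcs (attach P Qs) ↭ pairs (root P ∷ map root Qs) ++ arcs P ++ concatMap arcs Qs
  attach-arcs P []       = ↭-reflexive (sym (++-identityʳ (arcs P)))
  attach-arcs P (Q ∷ Qs) rewrite attach-root Q Qs = ↭-prep (root P , root Q)
    (↭-trans (++⁺ˡ (arcs P) (attach-arcs Q Qs)) (shifts (arcs P) (pairs (root Q ∷ map root Qs))))

  attach-wf : ∀ {P Qs} → WellFormed P → All WellFormed Qs → Unique (verts (attach P Qs)) → WellFormed (attach P Qs)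
  attach-wf wP [] u = wP
  attach-wf {P} wP (wQ ∷ wQs) u = link-wf wP (attach-wf wQ wQs (proj₁ (proj₂ (Unique-++⁻ (verts P) u)))) u

  cutRing-verts : ∀ P Ps Qs → verts (cutRing P Ps Qs) ↭ verts (ring P (Ps ++ Qs))
  cutRing-verts P Ps Qs = begin
    verts (attach (attach P Ps) (reverse Qs))                        ≡⟨ attach-verts (attach P Ps) (reverse Qs) ⟩
    verts (attach P Ps) ++ concatMap verts (reverse Qs)              ≡⟨ cong (_++ concatMap verts (reverse Qs)) (attach-verts P Ps) ⟩
    (verts P ++ concatMap verts Ps) ++ concatMap verts (reverse Qs)  ≡⟨ ++-assoc (verts P) _ _ ⟩
    verts P ++ concatMap verts Ps ++ concatMap verts (reverse Qs)    ↭⟨ ++⁺ˡ (verts P) (++⁺ˡ (concatMap verts Ps) (concat-↭ (map⁺ verts (↭-reverse Qs)))) ⟩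
    verts P ++ concatMap verts Ps ++ concatMap verts Qs              ≡⟨ cong (verts P ++_) (concatMap-++ verts Ps Qs) ⟨
    verts P ++ concatMap verts (Ps ++ Qs)                            ∎
    where open PermutationReasoning

  cutRing-arcs : ∀ P Ps Qs → arcs (cutRing P Ps Qs) ↭
    pairs (root P ∷ map root (reverse Qs)) ++ pairs (root P ∷ map root Ps) ++ arcs P ++ concatMap arcs (Ps ++ Qs)
  cutRing-arcs P Ps Qs = begin
    arcs (attach (attach P Ps) (reverse Qs))
      ↭⟨ attach-arcs (attach P Ps) (reverse Qs) ⟩
    pairs (root (attach P Ps) ∷ map root (reverse Qs)) ++ arcs (attach P Ps) ++ concatMap arcs (reverse Qs)
      ≡⟨ cong (λ r → pairs (r ∷ map root (reverse Qs)) ++ arcs (attach P Ps) ++ concatMap arcs (reverse Qs)) (attach-root P Ps) ⟩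
    F ++ arcs (attach P Ps) ++ concatMap arcs (reverse Qs)
      ↭⟨ ++⁺ˡ F (++⁺ (attach-arcs P Ps) (concat-↭ (map⁺ arcs (↭-reverse Qs)))) ⟩
    F ++ (G ++ arcs P ++ concatMap arcs Ps) ++ concatMap arcs Qs
      ≡⟨ cong (F ++_) (trans (++-assoc G _ _) (cong (G ++_) (trans (++-assoc (arcs P) _ _)
           (cong (arcs P ++_) (sym (concatMap-++ arcs Ps Qs)))))) ⟩
    F ++ G ++ arcs P ++ concatMap arcs (Ps ++ Qs) ∎
    where
    open PermutationReasoning
    F = pairs (root P ∷ map root (reverse Qs))
    G = pairs (root P ∷ map root Ps)

  private
    ring-cycle : ∀ (P : Piece n) Ps Q Qs → cyclicPairs (root P ∷ map root (Ps ++ Q ∷ Qs)) ≡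
      pairs (root P ∷ map root Ps) ++ (lastOf (root P) (map root Ps) , root Q) ∷ pairs (map root (Q ∷ Qs) ∷ʳ root P)
    ring-cycle P Ps Q Qs = begin
      cyclicPairs (root P ∷ map root (Ps ++ Q ∷ Qs))        ≡⟨ cyclicPairs≡pairs (root P) _ ⟩
      pairs (root P ∷ map root (Ps ++ Q ∷ Qs) ∷ʳ root P)    ≡⟨ cong (λ z → pairs (root P ∷ z ∷ʳ root P)) (map-++ root Ps (Q ∷ Qs)) ⟩
      pairs (root P ∷ (map root Ps ++ map root (Q ∷ Qs)) ∷ʳ root P) ≡⟨ cong (λ z → pairs (root P ∷ z)) (++-assoc (map root Ps) _ _) ⟩
      pairs (root P ∷ map root Ps ++ map root (Q ∷ Qs) ∷ʳ root P)   ≡⟨ pairs-++ (root P) (map root Ps) (root Q) _ ⟩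
      pairs (root P ∷ map root Ps) ++ (lastOf (root P) (map root Ps) , root Q) ∷ pairs (map root (Q ∷ Qs) ∷ʳ root P) ∎
      where open ≡-Reasoning

    back-path : ∀ (P : Piece n) Qs → root P ∷ map root (reverse Qs) ≡ reverse (map root Qs ∷ʳ root P)
    back-path P Qs = trans (cong (root P ∷_) (reverse-map root Qs)) (sym (reverse-++ (map root Qs) (root P ∷ [])))

  -- Cutting the closed walk before `root Q` leaves the front path, the deleted edge and a path back
  -- to `root P`. The second branch of `cutRing` traverses the latter in reverse, to which `Adj` is
  -- indifferent.
  ring⇒cutRing : ∀ P Ps Q Qs {x y} → Adj (arcs (ring P (Ps ++ Q ∷ Qs))) x y →
                 Adj (arcs (cutRing P Ps (Q ∷ Qs))) x y ⊎
                 Adj ((lastOf (root P) (map root Ps) , root Q) ∷ []) x y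
  ring⇒cutRing P Ps Q Qs {x} {y} e with Adj-++⁻ (cyclicPairs (root P ∷ map root (Ps ++ Q ∷ Qs))) e
  ... | inj₂ e′ = inj₁ (Adj-mono (∈-resp-↭ (↭-sym (cutRing-arcs P Ps (Q ∷ Qs))) ∘ ∈-++⁺ʳ F ∘ ∈-++⁺ʳ G) e′)
    where
    F = pairs (root P ∷ map root (reverse (Q ∷ Qs)))
    G = pairs (root P ∷ map root Ps)
  ... | inj₁ e′ with Adj-++⁻ (pairs (root P ∷ map root Ps)) (subst (λ E → Adj E x y) (ring-cycle P Ps Q Qs) e′)
  ...   | inj₁ e″ = inj₁ (Adj-mono (∈-resp-↭ (↭-sym (cutRing-arcs P Ps (Q ∷ Qs))) ∘ ∈-++⁺ʳ F ∘ ∈-++⁺ˡ) e″)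
    where
    F = pairs (root P ∷ map root (reverse (Q ∷ Qs)))
  ...   | inj₂ e″ with Adj-++⁻ ((lastOf (root P) (map root Ps) , root Q) ∷ []) e″
  ...     | inj₁ e‴ = inj₂ e‴
  ...     | inj₂ e‴ = inj₁ (Adj-mono (∈-resp-↭ (↭-sym (cutRing-arcs P Ps (Q ∷ Qs))) ∘ ∈-++⁺ˡ)
      (subst (λ zs → Adj (pairs zs) x y) (sym (back-path P (Q ∷ Qs))) (Adj-pairs-reverse⁺ (map root (Q ∷ Qs) ∷ʳ root P) e‴)))

  cutRing⇒ring : ∀ P Ps Q Qs {x y} → Adj (arcs (cutRing P Ps (Q ∷ Qs))) x y →
                 Adj (arcs (ring P (Ps ++ Q ∷ Qs))) x y
  cutRing⇒ring P Ps Q Qs {x} {y} e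
    with Adj-++⁻ F (Adj-mono (∈-resp-↭ (cutRing-arcs P Ps (Q ∷ Qs))) e)
    where
    F = pairs (root P ∷ map root (reverse (Q ∷ Qs)))
  ... | inj₁ e′ = Adj-mono ∈-++⁺ˡ (subst (λ E → Adj E x y) (sym (ring-cycle P Ps Q Qs))
      (Adj-mono (∈-++⁺ʳ (pairs (root P ∷ map root Ps)) ∘ there)
        (Adj-pairs-reverse⁻ (map root (Q ∷ Qs) ∷ʳ root P) (subst (λ zs → Adj (pairs zs) x y) (back-path P (Q ∷ Qs)) e′))))
  ... | inj₂ e′ with Adj-++⁻ (pairs (root P ∷ map root Ps)) e′
  ...   | inj₁ e″ = Adj-mono ∈-++⁺ˡ (subst (λ E → Adj E x y) (sym (ring-cycle P Ps Q Qs)) (Adj-mono ∈-++⁺ˡ e″))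
  ...   | inj₂ e″ = Adj-mono (∈-++⁺ʳ (cyclicPairs (root P ∷ map root (Ps ++ Q ∷ Qs)))) e″

  ring-wf : ∀ {P Qs} → WellFormed P → All WellFormed Qs → Unique (verts (ring P Qs)) → WellFormed (ring P Qs)
  -- With no further pieces the only cyclic pair is a loop at `root P`.
  ring-wf {P} {[]} wP [] u = record
    { root∈  = ∈-++⁺ˡ (root∈ wP) ; unique = u
    ; arcs∈  = λ e → case Adj-∷⁻ e of λ where
        (inj₁ refl)        → ∈-++⁺ˡ (root∈ wP)
        (inj₂ (inj₁ refl)) → ∈-++⁺ˡ (root∈ wP)
        (inj₂ (inj₂ e′))   → ∈-++⁺ˡ (arcs∈ wP (Adj-mono (λ {z} z∈ → subst (z ∈_) (++-identityʳ (arcs P)) z∈) e′)) }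
  ring-wf {P} {Q ∷ Qs} wP (wQ ∷ wQs) u = record
    { root∈ = ∈-++⁺ˡ (root∈ wP) ; arcs∈ = go ; unique = u }
    where
    -- All arcs of the ring except the deleted one belong to a piece assembled by links, which is
    -- known to be well-formed.
    cut-wf : WellFormed (cutRing P [] (Q ∷ Qs))
    cut-wf = attach-wf wP (All-resp-↭ (↭-sym (↭-reverse (Q ∷ Qs))) (wQ ∷ wQs)) (Unique-resp-↭ (↭-sym (cutRing-verts P [] (Q ∷ Qs))) u)
    go : ∀ {x y} → Adj (arcs (ring P (Q ∷ Qs))) x y → x ∈ verts (ring P (Q ∷ Qs))
    go e with ring⇒cutRing P [] Q Qs e
    ... | inj₁ e′ = ∈-resp-↭ (cutRing-verts P [] (Q ∷ Qs)) (arcs∈ cut-wf e′)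
    ... | inj₂ e′ with Adj-∷⁻ e′
    ...   | inj₁ refl                = ∈-++⁺ˡ (root∈ wP)
    ...   | inj₂ (inj₁ refl)         = ∈-++⁺ʳ (verts P) (∈-++⁺ˡ (root∈ wQ))
    ...   | inj₂ (inj₂ (inj₁ ()))
    ...   | inj₂ (inj₂ (inj₂ ()))

-- Partitions of pieces

-- The edge `r₁ r₂` is the only one between the sides `L₁` and `L₂`. The description is one-sided,
-- giving arcs for `L₁` alone, so that each fact about restriction is proved once and applied to
-- either side.
record Bridge {A : Set} (E E₁ : List (A × A)) (L₁ L₂ : List A) (r₁ r₂ : A) : Set where
  field
    inside   : ∀ {a b} → Adj E a b → a ∈ L₁ → b ∈ L₁ → Adj E₁ a b
    cross    : ∀ {a b} → Adj E a b → a ∈ L₁ → b ∈ L₂ → a ≡ r₁ × b ≡ r₂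
    disjoint : ∀ {z} → z ∈ L₁ → z ∈ L₂ → ⊥

module _ {A : Set} {E E₁ : List (A × A)} {L₁ L₂ : List A} {r₁ r₂ : A}
         (bridge : Bridge E E₁ L₁ L₂ r₁ r₂) {C : List A}
         (C⊆ : ∀ {z} → z ∈ C → z ∈ L₁ ⊎ z ∈ L₂) where
  open Bridge bridge

  restrict : ∀ {C₁ x y} → (∀ {z} → z ∈ C → z ∈ L₁ → z ∈ C₁) → Star (Step E C) x y → y ∈ L₁ →
             (x ∈ L₁ → Star (Step E₁ C₁) x y) × (x ∈ L₂ → r₁ ∈ C × r₂ ∈ C × Star (Step E₁ C₁) r₁ y)
  restrict f ε y∈L₁ = (λ _ → ε) , λ x∈L₂ → ⊥-elim (disjoint y∈L₁ x∈L₂)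
  restrict f ((x∈C , z∈C , e) ◅ path) y∈L₁ with C⊆ z∈C | restrict f path y∈L₁
  ... | inj₁ z∈L₁ | go , _ =
    (λ x∈L₁ → (f x∈C x∈L₁ , f z∈C z∈L₁ , inside e x∈L₁ z∈L₁) ◅ go z∈L₁) ,
    (λ x∈L₂ → case cross (Adj-sym e) z∈L₁ x∈L₂ of λ { (refl , refl) → z∈C , x∈C , go z∈L₁ })
  ... | inj₂ z∈L₂ | _ , go =
    (λ x∈L₁ → case cross e x∈L₁ z∈L₂ of λ { (refl , refl) → proj₂ (proj₂ (go z∈L₂)) }) ,
    (λ x∈L₂ → go z∈L₂)

  crossing : ∀ {x y} → Conn E C → x ∈ C → x ∈ L₂ → y ∈ C → y ∈ L₁ → r₁ ∈ C × r₂ ∈ C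
  crossing c x∈C x∈L₂ y∈C y∈L₁ with proj₂ (restrict (λ {z} z∈C _ → z∈C) (c x∈C y∈C) y∈L₁) x∈L₂
  ... | r₁∈C , r₂∈C , _ = r₁∈C , r₂∈C

  Conn-restrict : ∀ {C₁} → (∀ {z} → z ∈ C → z ∈ L₁ → z ∈ C₁) → (∀ {z} → z ∈ C₁ → z ∈ C × z ∈ L₁) →
                  Conn E C → Conn E₁ C₁
  Conn-restrict f g c x∈C₁ y∈C₁ with g x∈C₁ | g y∈C₁
  ... | x∈C , x∈L₁ | y∈C , y∈L₁ = proj₁ (restrict f (c x∈C y∈C) y∈L₁) x∈L₁

-- Clusters and partitions of a piece

module _ {n : ℕ} (w : Fin n → ℕ) (l u : ℕ) where
  private V = Fin n
  open DecMembership (_≟_ {n}) using (_∈?_)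

  wt : List V → ℕ
  wt C = sum (map w C)

  wt-++ : ∀ C D → wt (C ++ D) ≡ wt C + wt D
  wt-++ C D = trans (cong sum (map-++ w C D)) (sum-++ (map w C) (map w D))

  wt-↭ : ∀ {C D} → C ↭ D → wt C ≡ wt D
  wt-↭ p = sum-↭ (map⁺ w p)

  -- `inhabited` has force when `l` is 0: the empty list is vacuously connected and weighs 0.
  record Cluster (E : List (V × V)) (C : List V) : Set where
    field
      connected : Conn E C
      inhabited : ∃[ v ] v ∈ C
      lower     : l ≤ wt C
      upper     : wt C ≤ u
  open Cluster

  -- R is the cluster of the root; its weight is not yet constrained.
  record Part (P : Piece n) (R : List V) (Cs : List (List V)) : Set where
    field
      covers   : R ++ concat Cs ↭ verts P
      root∈R   : root P ∈ R
      R-conn   : Conn (arcs P) R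
      clusters : All (Cluster (arcs P)) Cs
  open Part

  Achieves : Piece n → ℕ → ℕ → Set
  Achieves P x k = ∃[ R ] ∃[ Cs ] Part P R Cs × wt R ≡ x × suc (length Cs) ≡ k

  Cluster-map : ∀ {E F C} → (Conn E C → Conn F C) → Cluster E C → Cluster F C
  Cluster-map f c = record
    { connected = f (connected c) ; inhabited = inhabited c ; lower = lower c ; upper = upper c }

  Part-mono : ∀ {P Q} → root P ≡ root Q → verts P ↭ verts Q →
              (∀ {x y} → Adj (arcs P) x y → Adj (arcs Q) x y) → ∀ {R Cs} → Part P R Cs → Part Q R Cs
  Part-mono refl p f π = record
    { covers = ↭-trans (covers π) p ; root∈R = root∈R π ; R-conn = Conn-mono f (R-conn π)
    ; clusters = All.map (Cluster-map (Conn-mono f)) (clusters π) }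

  Achieves-mono : ∀ {P Q} → root P ≡ root Q → verts P ↭ verts Q →
                  (∀ {x y} → Adj (arcs P) x y → Adj (arcs Q) x y) → ∀ {x k} → Achieves P x k → Achieves Q x k
  Achieves-mono r p f (R , Cs , π , e) = R , Cs , Part-mono r p f π , e

  clusters-weight : ∀ {E Cs} → All (Cluster E) Cs →
                    wt (concat Cs) ≤ length Cs * u × length Cs * l ≤ wt (concat Cs)
  clusters-weight [] = z≤n , z≤n
  clusters-weight {Cs = C ∷ Cs} (c ∷ cs) with clusters-weight cs
  ... | p , q = ≤-trans (≤-reflexive (wt-++ C (concat Cs))) (+-mono-≤ (upper c) p)
              , ≤-trans (+-mono-≤ (lower c) q) (≤-reflexive (sym (wt-++ C (concat Cs))))

  Achieves-measured : ∀ p P → Measured l u p (wt (verts P)) (Achieves P)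
  Achieves-measured p P (R , Cs , π , refl , refl) = s≤s z≤n , above , below
    where
    open ≤-Reasoning
    total : wt R + wt (concat Cs) ≡ wt (verts P)
    total = trans (sym (wt-++ R (concat Cs))) (wt-↭ (covers π))
    above : wt (verts P) + u ≤ wt R + suc (length Cs) * u
    above = begin
      wt (verts P) + u              ≡⟨ cong (_+ u) total ⟨
      wt R + wt (concat Cs) + u     ≡⟨ +-assoc (wt R) _ u ⟩
      wt R + (wt (concat Cs) + u)   ≤⟨ +-monoʳ-≤ (wt R) (+-monoˡ-≤ u (proj₁ (clusters-weight (clusters π)))) ⟩
      wt R + (length Cs * u + u)    ≡⟨ cong (wt R +_) (+-comm (length Cs * u) u) ⟩
      wt R + suc (length Cs) * u    ∎
    below : wt R + suc (length Cs) * l ≤ wt (verts P) + l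
    below = begin
      wt R + suc (length Cs) * l    ≡⟨ cong (wt R +_) (+-comm l _) ⟩
      wt R + (length Cs * l + l)    ≤⟨ +-monoʳ-≤ (wt R) (+-monoˡ-≤ l (proj₂ (clusters-weight (clusters π)))) ⟩
      wt R + (wt (concat Cs) + l)   ≡⟨ +-assoc (wt R) _ l ⟨
      wt R + wt (concat Cs) + l     ≡⟨ cong (_+ l) total ⟩
      wt (verts P) + l              ∎

  private
    -- Lists of distinct vertices with the same members are permutations of each other, so knowing
    -- the side of each vertex suffices to split a permutation of the whole.
    separate : ∀ {xs ys L₁ L₂ : List V} → xs ++ ys ↭ L₁ ++ L₂ → Unique (L₁ ++ L₂) →
               All (_∈ L₁) xs → All (_∈ L₂) ys → xs ↭ L₁ × ys ↭ L₂
    separate {xs} {ys} {L₁} {L₂} p u₁₂ xs⊆ ys⊆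
      with Unique-++⁻ L₁ u₁₂ | Unique-++⁻ xs (Unique-resp-↭ (↭-sym p) u₁₂)
    ... | uL₁ , uL₂ , disj | uxs , uys , _ =
      unique⇒↭ uxs uL₁ (All.lookup xs⊆) (λ z∈ → case ∈-++⁻ xs (∈-resp-↭ (↭-sym p) (∈-++⁺ˡ z∈)) of λ where
        (inj₁ q) → q
        (inj₂ q) → ⊥-elim (disj z∈ (All.lookup ys⊆ q))) ,
      unique⇒↭ uys uL₂ (All.lookup ys⊆) (λ z∈ → case ∈-++⁻ xs (∈-resp-↭ (↭-sym p) (∈-++⁺ʳ L₁ z∈)) of λ where
        (inj₁ q) → ⊥-elim (disj (All.lookup xs⊆ q) z∈)
        (inj₂ q) → q)

  -- Two pieces joined by an edge

  module _ {P Q : Piece n} (wP : WellFormed P) (wQ : WellFormed Q) (u₁₂ : Unique (verts P ++ verts Q)) where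
    private
      L₁ = verts P
      L₂ = verts Q
      E = arcs (link P Q)
      disj : ∀ {z} → z ∈ L₁ → z ∈ L₂ → ⊥
      disj = proj₂ (proj₂ (Unique-++⁻ L₁ u₁₂))

    bridge₁ : Bridge E (arcs P) L₁ L₂ (root P) (root Q)
    bridge₁ = record { inside = inside ; cross = cross ; disjoint = disj }
      where
      inside : ∀ {a b} → Adj E a b → a ∈ L₁ → b ∈ L₁ → Adj (arcs P) a b
      inside e a∈ b∈ with Adj-∷⁻ e
      ... | inj₁ refl        = ⊥-elim (disj b∈ (root∈ wQ))
      ... | inj₂ (inj₁ refl) = ⊥-elim (disj a∈ (root∈ wQ))
      ... | inj₂ (inj₂ e′) with Adj-++⁻ (arcs P) e′
      ...   | inj₁ e″ = e″
      ...   | inj₂ e″ = ⊥-elim (disj a∈ (arcs∈ wQ e″))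
      cross : ∀ {a b} → Adj E a b → a ∈ L₁ → b ∈ L₂ → a ≡ root P × b ≡ root Q
      cross e a∈ b∈ with Adj-∷⁻ e
      ... | inj₁ refl        = refl , refl
      ... | inj₂ (inj₁ refl) = ⊥-elim (disj a∈ (root∈ wQ))
      ... | inj₂ (inj₂ e′) with Adj-++⁻ (arcs P) e′
      ...   | inj₁ e″ = ⊥-elim (disj (arcs∈ʳ wP e″) b∈)
      ...   | inj₂ e″ = ⊥-elim (disj a∈ (arcs∈ wQ e″))

    bridge₂ : Bridge E (arcs Q) L₂ L₁ (root Q) (root P)
    bridge₂ = record { inside = inside ; cross = cross ; disjoint = λ p q → disj q p }
      where
      inside : ∀ {a b} → Adj E a b → a ∈ L₂ → b ∈ L₂ → Adj (arcs Q) a b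
      inside e a∈ b∈ with Adj-∷⁻ e
      ... | inj₁ refl        = ⊥-elim (disj (root∈ wP) a∈)
      ... | inj₂ (inj₁ refl) = ⊥-elim (disj (root∈ wP) b∈)
      ... | inj₂ (inj₂ e′) with Adj-++⁻ (arcs P) e′
      ...   | inj₁ e″ = ⊥-elim (disj (arcs∈ wP e″) a∈)
      ...   | inj₂ e″ = e″
      cross : ∀ {a b} → Adj E a b → a ∈ L₂ → b ∈ L₁ → a ≡ root Q × b ≡ root P
      cross e a∈ b∈ with Bridge.cross bridge₁ (Adj-sym e) b∈ a∈
      ... | p , q = q , p

    arcsˡ : ∀ {x y} → Adj (arcs P) x y → Adj E x y
    arcsˡ = Adj-mono (there ∘ ∈-++⁺ˡ)

    arcsʳ : ∀ {x y} → Adj (arcs Q) x y → Adj E x y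
    arcsʳ = Adj-mono (there ∘ ∈-++⁺ʳ (arcs P))

    link-cut : ∀ {R₁ Cs₁ R₂ Cs₂} → Part P R₁ Cs₁ → Part Q R₂ Cs₂ → l ≤ wt R₂ → wt R₂ ≤ u →
               Part (link P Q) R₁ (Cs₁ ++ R₂ ∷ Cs₂)
    link-cut {R₁} {Cs₁} {R₂} {Cs₂} π ρ l≤ ≤u = record
      { covers = ↭-trans (↭-reflexive (trans (cong (R₁ ++_) (sym (concat-++ Cs₁ (R₂ ∷ Cs₂)))) (sym (++-assoc R₁ _ _))))
                         (++⁺ (covers π) (covers ρ))
      ; root∈R = root∈R π
      ; R-conn = Conn-mono arcsˡ (R-conn π)
      ; clusters = Allₚ.++⁺ (All.map (Cluster-map (Conn-mono arcsˡ)) (clusters π))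
          (record { connected = Conn-mono arcsʳ (R-conn ρ) ; inhabited = root Q , root∈R ρ ; lower = l≤ ; upper = ≤u }
           ∷ All.map (Cluster-map (Conn-mono arcsʳ)) (clusters ρ)) }

    link-join : ∀ {R₁ Cs₁ R₂ Cs₂} → Part P R₁ Cs₁ → Part Q R₂ Cs₂ → Part (link P Q) (R₁ ++ R₂) (Cs₁ ++ Cs₂)
    link-join {R₁} {Cs₁} {R₂} {Cs₂} π ρ = record
      { covers = ↭-trans (↭-reflexive (cong ((R₁ ++ R₂) ++_) (sym (concat-++ Cs₁ Cs₂))))
                   (↭-trans (++-interchange R₁ R₂ (concat Cs₁) (concat Cs₂)) (++⁺ (covers π) (covers ρ)))
      ; root∈R = ∈-++⁺ˡ (root∈R π)
      ; R-conn = conn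
      ; clusters = Allₚ.++⁺ (All.map (Cluster-map (Conn-mono arcsˡ)) (clusters π))
                            (All.map (Cluster-map (Conn-mono arcsʳ)) (clusters ρ)) }
      where
      left : ∀ {x y} → x ∈ R₁ → y ∈ R₁ → Star (Step E (R₁ ++ R₂)) x y
      left p q = Star.map (λ (a , b , e) → ∈-++⁺ˡ a , ∈-++⁺ˡ b , arcsˡ e) (R-conn π p q)
      right : ∀ {x y} → x ∈ R₂ → y ∈ R₂ → Star (Step E (R₁ ++ R₂)) x y
      right p q = Star.map (λ (a , b , e) → ∈-++⁺ʳ R₁ a , ∈-++⁺ʳ R₁ b , arcsʳ e) (R-conn ρ p q)
      bridge : Step E (R₁ ++ R₂) (root P) (root Q)
      bridge = ∈-++⁺ˡ (root∈R π) , ∈-++⁺ʳ R₁ (root∈R ρ) , inj₁ (here refl)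
      conn : Conn E (R₁ ++ R₂)
      conn x∈ y∈ with ∈-++⁻ R₁ x∈ | ∈-++⁻ R₁ y∈
      ... | inj₁ p | inj₁ q = left p q
      ... | inj₁ p | inj₂ q = left p (root∈R π) ◅◅ bridge ◅ right (root∈R ρ) q
      ... | inj₂ p | inj₁ q = right p (root∈R ρ) ◅◅ Step-sym bridge ◅ left (root∈R π) q
      ... | inj₂ p | inj₂ q = right p q

    private
      _⊆L : List V → Set
      C ⊆L = ∀ {z} → z ∈ C → z ∈ L₁ ⊎ z ∈ L₂

      swapped : ∀ {C} → C ⊆L → ∀ {z} → z ∈ C → z ∈ L₂ ⊎ z ∈ L₁
      swapped f = Sum.swap ∘ f

      Cluster₁ Cluster₂ : List V → Set
      Cluster₁ C = Cluster (arcs P) C × All (_∈ L₁) C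
      Cluster₂ C = Cluster (arcs Q) C × All (_∈ L₂) C

      -- By `crossing`, a connected list with vertices on both sides contains both ends of the
      -- bridge, in particular `root P`.
      pure : ∀ {C} → C ⊆L → Cluster E C → root P ∉ C → Cluster₁ C ⊎ Cluster₂ C
      pure {C} C⊆ c r∉ with inhabited c
      ... | v , v∈ with C⊆ v∈
      ...   | inj₁ v∈L₁ = inj₁ (Cluster-map (Conn-restrict bridge₁ C⊆ (λ z∈ _ → z∈) (λ z∈ → z∈ , all z∈)) c , All.tabulate all)
        where
        all : ∀ {z} → z ∈ C → z ∈ L₁
        all z∈ with C⊆ z∈
        ... | inj₁ z∈L₁ = z∈L₁
        ... | inj₂ z∈L₂ = ⊥-elim (r∉ (proj₁ (crossing bridge₁ C⊆ (connected c) z∈ z∈L₂ v∈ v∈L₁)))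
      ...   | inj₂ v∈L₂ = inj₂ (Cluster-map (Conn-restrict bridge₂ (swapped {C} C⊆) (λ z∈ _ → z∈) (λ z∈ → z∈ , all z∈)) c , All.tabulate all)
        where
        all : ∀ {z} → z ∈ C → z ∈ L₂
        all z∈ with C⊆ z∈
        ... | inj₂ z∈L₂ = z∈L₂
        ... | inj₁ z∈L₁ = ⊥-elim (r∉ (proj₁ (crossing bridge₁ C⊆ (connected c) v∈ v∈L₂ z∈ z∈L₁)))

      distribute : ∀ {Cs} → All (λ C → Cluster₁ C ⊎ Cluster₂ C) Cs →
                   ∃[ Cs₁ ] ∃[ Cs₂ ] concat Cs ↭ concat Cs₁ ++ concat Cs₂ × length Cs ≡ length Cs₁ + length Cs₂
                                     × All Cluster₁ Cs₁ × All Cluster₂ Cs₂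
      distribute [] = [] , [] , ↭-refl , refl , [] , []
      distribute {C ∷ Cs} (c ∷ cs) with distribute cs | c
      ... | Cs₁ , Cs₂ , p , q , a , b | inj₁ c₁ = C ∷ Cs₁ , Cs₂ ,
        ↭-trans (++⁺ˡ C p) (↭-reflexive (sym (++-assoc C _ _))) , cong suc q , c₁ ∷ a , b
      ... | Cs₁ , Cs₂ , p , q , a , b | inj₂ c₂ = Cs₁ , C ∷ Cs₂ ,
        ↭-trans (++⁺ˡ C p) (shifts C (concat Cs₁)) , trans (cong suc q) (sym (+-suc _ _)) , a , c₂ ∷ b

      assemble : ∀ {R₁ R₂ Cs₁ Cs₂} → (R₁ ++ concat Cs₁) ++ (R₂ ++ concat Cs₂) ↭ L₁ ++ L₂ →
                 root P ∈ R₁ → root Q ∈ R₂ → Conn (arcs P) R₁ → Conn (arcs Q) R₂ →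
                 All (_∈ L₁) R₁ → All (_∈ L₂) R₂ → All Cluster₁ Cs₁ → All Cluster₂ Cs₂ →
                 Part P R₁ Cs₁ × Part Q R₂ Cs₂
      assemble p r₁∈ r₂∈ c₁ c₂ R₁⊆ R₂⊆ a b
        with separate p u₁₂ (Allₚ.++⁺ R₁⊆ (Allₚ.concat⁺ (All.map proj₂ a))) (Allₚ.++⁺ R₂⊆ (Allₚ.concat⁺ (All.map proj₂ b)))
      ... | p₁ , p₂ =
        record { covers = p₁ ; root∈R = r₁∈ ; R-conn = c₁ ; clusters = All.map proj₁ a } ,
        record { covers = p₂ ; root∈R = r₂∈ ; R-conn = c₂ ; clusters = All.map proj₁ b }

    -- The question is whether the root cluster reaches `Q`. If it does, it contains both roots, and
    -- its restrictions to the two sides are the root clusters there. If it does not, the cluster of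
    -- `root Q` misses `root P`, hence lies within `Q` and is its root cluster. The remaining
    -- clusters avoid `root P` and so fall on one side each.
    link-split : ∀ {R Cs} → Part (link P Q) R Cs →
      (∃[ R₂ ] ∃[ Cs₁ ] ∃[ Cs₂ ] Part P R Cs₁ × Part Q R₂ Cs₂ × l ≤ wt R₂ × wt R₂ ≤ u
         × suc (length Cs₁) + suc (length Cs₂) ≡ suc (length Cs)) ⊎
      (∃[ R₁ ] ∃[ R₂ ] ∃[ Cs₁ ] ∃[ Cs₂ ] Part P R₁ Cs₁ × Part Q R₂ Cs₂ × wt R₁ + wt R₂ ≡ wt R
         × length Cs₁ + length Cs₂ ≡ length Cs)
    link-split {R} {Cs} π with any? (_∈? L₂) R
    ... | yes R∩L₂ = inj₂ (R₁ , R₂ , Cs₁ , Cs₂ , proj₁ parts₁₂ , proj₂ parts₁₂ ,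
        trans (sym (wt-++ R₁ R₂)) (sym (wt-↭ R↭)) , sym (proj₁ (proj₂ (proj₂ (proj₂ ds)))))
      where
      uR : Unique (R ++ concat Cs)
      uR = Unique-resp-↭ (↭-sym (covers π)) u₁₂
      R⊆ : R ⊆L
      R⊆ z∈ = ∈-++⁻ L₁ (∈-resp-↭ (covers π) (∈-++⁺ˡ z∈))
      ds = distribute (All.tabulate (λ {C} C∈ → pure {C}
             (λ z∈ → ∈-++⁻ L₁ (∈-resp-↭ (covers π) (∈-++⁺ʳ R (∈-concat⁺′ z∈ C∈))))
             (All.lookup (clusters π) C∈)
             (λ r∈ → proj₂ (proj₂ (Unique-++⁻ R uR)) (root∈R π) (∈-concat⁺′ r∈ C∈))))
      Cs₁ = proj₁ ds
      Cs₂ = proj₁ (proj₂ ds)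
      R₁ = filter (_∈? L₁) R
      R₂ = filter (_∈? L₂) R
      split₁ : ∀ {z} → z ∈ R₁ → z ∈ R × z ∈ L₁
      split₁ = ∈-filter⁻ (_∈? L₁) {xs = R}
      split₂ : ∀ {z} → z ∈ R₂ → z ∈ R × z ∈ L₂
      split₂ = ∈-filter⁻ (_∈? L₂) {xs = R}
      rQ∈R : root Q ∈ R
      rQ∈R with find R∩L₂
      ... | z , z∈R , z∈L₂ = proj₁ (crossing bridge₂ (swapped {R} R⊆) (R-conn π) (root∈R π) (root∈ wP) z∈R z∈L₂)
      R↭ : R ↭ R₁ ++ R₂
      R↭ = unique⇒↭ (proj₁ (Unique-++⁻ R uR))
        (Uniqueₚ.++⁺ (Uniqueₚ.filter⁺ (_∈? L₁) (proj₁ (Unique-++⁻ R uR))) (Uniqueₚ.filter⁺ (_∈? L₂) (proj₁ (Unique-++⁻ R uR)))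
          (λ (p , q) → disj (proj₂ (split₁ p)) (proj₂ (split₂ q))))
        (λ z∈ → case R⊆ z∈ of λ where
          (inj₁ q) → ∈-++⁺ˡ (∈-filter⁺ (_∈? L₁) z∈ q)
          (inj₂ q) → ∈-++⁺ʳ R₁ (∈-filter⁺ (_∈? L₂) z∈ q))
        (λ z∈ → case ∈-++⁻ R₁ z∈ of λ where
          (inj₁ q) → proj₁ (split₁ q)
          (inj₂ q) → proj₁ (split₂ q))
      parts₁₂ : Part P R₁ Cs₁ × Part Q R₂ Cs₂
      parts₁₂ with ds
      ... | Ds₁ , Ds₂ , p , _ , a , b = assemble
        (↭-trans (++-interchange R₁ (concat Ds₁) R₂ (concat Ds₂)) (↭-trans (++⁺ (↭-sym R↭) (↭-sym p)) (covers π)))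
        (∈-filter⁺ (_∈? L₁) (root∈R π) (root∈ wP)) (∈-filter⁺ (_∈? L₂) rQ∈R (root∈ wQ))
        (Conn-restrict bridge₁ R⊆ (∈-filter⁺ (_∈? L₁)) split₁ (R-conn π))
        (Conn-restrict bridge₂ (swapped {R} R⊆) (∈-filter⁺ (_∈? L₂)) split₂ (R-conn π))
        (All.tabulate (λ z∈ → proj₂ (split₁ z∈))) (All.tabulate (λ z∈ → proj₂ (split₂ z∈))) a b
    ... | no ¬R∩L₂ with ∈-concat⁻′ Cs (rQ∈ (∈-++⁻ R (∈-resp-↭ (↭-sym (covers π)) (∈-++⁺ʳ L₁ (root∈ wQ)))))
      where
      rQ∈ : root Q ∈ R ⊎ root Q ∈ concat Cs → root Q ∈ concat Cs
      rQ∈ (inj₁ r∈R) = ⊥-elim (¬R∩L₂ (lose r∈R (root∈ wQ)))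
      rQ∈ (inj₂ r∈)  = r∈
    ...   | C , rQ∈C , C∈ with ∈-∃++ C∈
    ...     | Ds , Ds′ , refl = inj₁ (C , Cs₁ , Cs₂ , proj₁ parts₁₂ , proj₂ parts₁₂ , lower C-cluster , upper C-cluster , count)
      where
      uR : Unique (R ++ concat (Ds ++ C ∷ Ds′))
      uR = Unique-resp-↭ (↭-sym (covers π)) u₁₂
      R⊆ : R ⊆L
      R⊆ z∈ = ∈-++⁻ L₁ (∈-resp-↭ (covers π) (∈-++⁺ˡ z∈))
      R⊆L₁ : ∀ {z} → z ∈ R → z ∈ L₁
      R⊆L₁ z∈ with R⊆ z∈
      ... | inj₁ q = q
      ... | inj₂ q = ⊥-elim (¬R∩L₂ (lose z∈ q))
      pures : All (λ D → Cluster₁ D ⊎ Cluster₂ D) (Ds ++ C ∷ Ds′)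
      pures = All.tabulate (λ {D} D∈ → pure {D}
             (λ z∈ → ∈-++⁻ L₁ (∈-resp-↭ (covers π) (∈-++⁺ʳ R (∈-concat⁺′ z∈ D∈))))
             (All.lookup (clusters π) D∈)
             (λ r∈ → proj₂ (proj₂ (Unique-++⁻ R uR)) (root∈R π) (∈-concat⁺′ r∈ D∈)))
      C-cluster : Cluster E C
      C-cluster = All.lookup (clusters π) C∈
      C-cluster₂ : Cluster₂ C
      C-cluster₂ with All.lookup pures C∈
      ... | inj₁ (_ , C⊆L₁) = ⊥-elim (disj (All.lookup C⊆L₁ rQ∈C) (root∈ wQ))
      ... | inj₂ c₂         = c₂
      rearranged : C ∷ Ds ++ Ds′ ↭ Ds ++ C ∷ Ds′
      rearranged = ↭-sym (shift C Ds Ds′)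
      ds = distribute (All.tail (All-resp-↭ (↭-sym rearranged) pures))
      Cs₁ = proj₁ ds
      Cs₂ = proj₁ (proj₂ ds)
      count : suc (length Cs₁) + suc (length Cs₂) ≡ suc (length (Ds ++ C ∷ Ds′))
      count = trans (cong suc (+-suc _ _)) (cong suc (trans (cong suc (sym (proj₁ (proj₂ (proj₂ (proj₂ ds))))))
                (↭-length rearranged)))
      parts₁₂ : Part P R Cs₁ × Part Q C Cs₂
      parts₁₂ with ds
      ... | Ds₁ , Ds₂ , p , _ , a , b = assemble
        (begin
          (R ++ concat Ds₁) ++ (C ++ concat Ds₂)  ≡⟨ ++-assoc R (concat Ds₁) (C ++ concat Ds₂) ⟩
          R ++ concat Ds₁ ++ C ++ concat Ds₂      ↭⟨ ++⁺ˡ R (shifts (concat Ds₁) C) ⟩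
          R ++ C ++ concat Ds₁ ++ concat Ds₂      ↭⟨ ++⁺ˡ R (++⁺ˡ C (↭-sym p)) ⟩
          R ++ concat (C ∷ Ds ++ Ds′)             ↭⟨ ++⁺ˡ R (concat-↭ rearranged) ⟩
          R ++ concat (Ds ++ C ∷ Ds′)             ↭⟨ covers π ⟩
          L₁ ++ L₂                                ∎)
        (root∈R π) rQ∈C
        (Conn-restrict bridge₁ R⊆ (λ z∈ _ → z∈) (λ z∈ → z∈ , R⊆L₁ z∈) (R-conn π))
        (connected (proj₁ C-cluster₂))
        (All.tabulate R⊆L₁) (proj₂ C-cluster₂) a b
        where
        open PermutationReasoning

    link-composition : ∀ p → Composition l u p (Achieves P) (Achieves Q) (Achieves (link P Q))
    link-composition p = record
      { cut   = λ { (R₁ , Cs₁ , π , refl , refl) (R₂ , Cs₂ , ρ , refl , refl) l≤ ≤u →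
                    R₁ , Cs₁ ++ R₂ ∷ Cs₂ , link-cut π ρ l≤ ≤u , refl , cong suc (length-++ Cs₁) }
      ; join  = λ { (R₁ , Cs₁ , π , refl , refl) (R₂ , Cs₂ , ρ , refl , refl) →
                    R₁ ++ R₂ , Cs₁ ++ Cs₂ , link-join π ρ , wt-++ R₁ R₂ ,
                    trans (cong suc (length-++ Cs₁)) (sym (+-suc _ _)) }
      ; split = λ { (R , Cs , π , refl , refl) → case link-split π of λ where
          (inj₁ (R₂ , Cs₁ , Cs₂ , π₁ , π₂ , l≤ , ≤u , e)) → inj₁
            (_ , _ , _ , (R , Cs₁ , π₁ , refl , refl) , (R₂ , Cs₂ , π₂ , refl , refl) , l≤ , ≤u , e)
          (inj₂ (R₁ , R₂ , Cs₁ , Cs₂ , π₁ , π₂ , e , e′)) → inj₂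
            (_ , _ , _ , _ , (R₁ , Cs₁ , π₁ , refl , refl) , (R₂ , Cs₂ , π₂ , refl , refl) , e ,
             trans (+-suc _ _) (cong suc e′)) } }

  -- Cycles of pieces and their cuts

  private
    -- A cluster stays connected without the deleted edge if, whenever it contains both ends, it
    -- joins them by another path: that detour replaces each use of the edge.
    reroute : ∀ P Ps Q Qs {R Cs} →
      (∀ {C} → C ∈ R ∷ Cs → lastOf (root P) (map root Ps) ∈ C → root Q ∈ C →
         Star (Step (arcs (cutRing P Ps (Q ∷ Qs))) C) (lastOf (root P) (map root Ps)) (root Q)) →
      Part (ring P (Ps ++ Q ∷ Qs)) R Cs → Part (cutRing P Ps (Q ∷ Qs)) R Cs
    reroute P Ps Q Qs {R} {Cs} detour π = record
      { covers   = ↭-trans (covers π) (↭-sym (cutRing-verts P Ps (Q ∷ Qs)))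
      ; root∈R   = subst (_∈ R) (sym (trans (attach-root (attach P Ps) (reverse (Q ∷ Qs))) (attach-root P Ps))) (root∈R π)
      ; R-conn   = Conn-map (step (here refl)) (R-conn π)
      ; clusters = All.tabulate (λ C∈ → Cluster-map (Conn-map (step (there C∈))) (All.lookup (clusters π) C∈)) }
      where
      step : ∀ {C a b} → C ∈ R ∷ Cs → Step (arcs (ring P (Ps ++ Q ∷ Qs))) C a b →
             Star (Step (arcs (cutRing P Ps (Q ∷ Qs))) C) a b
      step C∈ (a∈ , b∈ , e) with ring⇒cutRing P Ps Q Qs e
      ... | inj₁ e′ = (a∈ , b∈ , e′) ◅ ε
      ... | inj₂ e′ with Adj-∷⁻ e′
      ...   | inj₁ refl              = detour C∈ a∈ b∈
      ...   | inj₂ (inj₁ refl)       = Star.reverse Step-sym (detour C∈ b∈ a∈)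
      ...   | inj₂ (inj₂ (inj₁ ()))
      ...   | inj₂ (inj₂ (inj₂ ()))

    lastOf∈ : ∀ {R : List V} (P : Piece n) Ps → root P ∈ R → All (λ Q → root Q ∈ R) Ps → lastOf (root P) (map root Ps) ∈ R
    lastOf∈ P []       r∈ []       = r∈
    lastOf∈ P (Q ∷ Qs) _  (q ∷ qs) = lastOf∈ Q Qs q qs

  -- If some vertex of the cycle is outside R, the edge entering the first such
  -- vertex is used by no cluster; otherwise the whole cycle lies in R, and the
  -- other edges of the cycle make up for the deleted one.
  ring-split : ∀ {P Q Qs R Cs} → Unique (verts (ring P (Q ∷ Qs))) → Part (ring P (Q ∷ Qs)) R Cs →
               ∃[ Ps ] ∃[ X ] ∃[ Ys ] Q ∷ Qs ≡ Ps ++ X ∷ Ys × Part (cutRing P Ps (X ∷ Ys)) R Cs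
  ring-split {P} {Q} {Qs} {R} {Cs} u₁₂ π with firstFailure (λ X → root X ∈? R) (Q ∷ Qs)
  ... | inj₂ (Ps , X , Ys , e , Ps⊆R , X∉R) = Ps , X , Ys , e , reroute P Ps X Ys detour (subst (λ Zs → Part (ring P Zs) R Cs) e π)
    where
    disj : ∀ {z} → z ∈ R → z ∈ concat Cs → ⊥
    disj = proj₂ (proj₂ (Unique-++⁻ R (Unique-resp-↭ (↭-sym (covers π)) u₁₂)))
    detour : ∀ {C} → C ∈ R ∷ Cs → lastOf (root P) (map root Ps) ∈ C → root X ∈ C → Star (Step (arcs (cutRing P Ps (X ∷ Ys))) C) _ _
    detour (here refl) _     X∈R = contradiction X∈R X∉R
    detour (there C∈)  last∈ _   = ⊥-elim (disj (lastOf∈ P Ps (root∈R π) Ps⊆R) (∈-concat⁺′ last∈ C∈))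
  ... | inj₁ Qs⊆R = [] , Q , Qs , refl , reroute P [] Q Qs detour π
    where
    disj : ∀ {z} → z ∈ R → z ∈ concat Cs → ⊥
    disj = proj₂ (proj₂ (Unique-++⁻ R (Unique-resp-↭ (↭-sym (covers π)) u₁₂)))
    detour : ∀ {C} → C ∈ R ∷ Cs → root P ∈ C → root Q ∈ C → Star (Step (arcs (cutRing P [] (Q ∷ Qs))) C) (root P) (root Q)
    -- The back branch leads from `root P` round the whole cycle to `root Q`, and in this case stays
    -- within `R`.
    detour (here refl) _ _ = pairs-path (root P) (map root (reverse (Q ∷ Qs)))
      (∈-resp-↭ (↭-sym (cutRing-arcs P [] (Q ∷ Qs))) ∘ ∈-++⁺ˡ)
      (root∈R π ∷ Allₚ.map⁺ (All-resp-↭ (↭-sym (↭-reverse (Q ∷ Qs))) Qs⊆R))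
      (there (∈-map⁺ root (∈-resp-↭ (↭-sym (↭-reverse (Q ∷ Qs))) (here refl))))
    detour (there C∈) P∈C _ = ⊥-elim (disj (root∈R π) (∈-concat⁺′ P∈C C∈))

  cutRing-achieves : ∀ P Ps Q Qs {x k} → Achieves (cutRing P Ps (Q ∷ Qs)) x k → Achieves (ring P (Ps ++ Q ∷ Qs)) x k
  cutRing-achieves P Ps Q Qs = Achieves-mono
    (trans (attach-root (attach P Ps) (reverse (Q ∷ Qs))) (attach-root P Ps))
    (cutRing-verts P Ps (Q ∷ Qs)) (cutRing⇒ring P Ps Q Qs)

-- The algorithm on paths and cycles

reverseOnto-value : ∀ {A : Set} (acc xs : List A) → value (reverseOnto acc xs) ≡ xs ʳ++ acc
reverseOnto-value acc []       = refl
reverseOnto-value acc (x ∷ xs) = reverseOnto-value (x ∷ acc) xs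

reverseOnto-steps : ∀ {A : Set} (acc xs : List A) → steps (reverseOnto acc xs) ≡ suc (length xs)
reverseOnto-steps acc []       = refl
reverseOnto-steps acc (x ∷ xs) = cong suc (reverseOnto-steps (x ∷ acc) xs)

module _ {n : ℕ} (w : Fin n → ℕ) (l u p : ℕ) (l≤u : l ≤ u) (1≤p : 1 ≤ p) where
  open Algorithm l u p hiding (cactusPartitionPoly)

  Represents : Piece n → IntervalPartitionSet → Set
  Represents P I = Valid l u p (Achieves w l u P) I

  Achieves-positive : ∀ P → Positive l u p (Achieves w l u P)
  Achieves-positive P a = proj₁ (Achieves-measured w l u p P a)

  single-represents : ∀ v → Represents (single v) (singleton w v)
  single-represents v = record
    { sound     = record
        { parts≤p = 1≤p ; lo≤hi = ≤-refl ; attained = achieved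
        ; near = λ {y} q r → w v , achieved , q , ≤-trans r (m≤m+n (w v) d) } ∷ []
    ; separated = inj₁ z<s ∷ [-]
    ; complete  = λ { (R , [] , π , refl , refl) _ _ → here (refl , weight π , ≤-reflexive (sym (weight′ π)))
                    ; (R , C ∷ Cs , π , refl , refl) _ _ → ⊥-elim (overfull π) } }
    where
    achieved : Achieves w l u (single v) (w v) 1
    achieved = v ∷ [] , [] , record
      { covers = ↭-refl ; root∈R = here refl ; R-conn = λ { (here refl) (here refl) → ε } ; clusters = [] }
      , +-identityʳ (w v) , refl
    weight′ : ∀ {R} → Part w l u (single v) R [] → w v ≡ wt w l u R
    weight′ {R} π = trans (sym (+-identityʳ (w v))) (sym (wt-↭ w l u (↭-trans (↭-reflexive (sym (++-identityʳ R))) (Part.covers π))))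
    weight : ∀ {R} → Part w l u (single v) R [] → w v ≤ wt w l u R
    weight π = ≤-reflexive (weight′ π)
    -- `R` and `C` are both nonempty, while there is only one vertex to share.
    overfull : ∀ {R C Cs} → Part w l u (single v) R (C ∷ Cs) → ⊥
    overfull {x ∷ R} {C} {Cs} π with Part.clusters π
    ... | c ∷ _ with Cluster.inhabited c | ↭-length (Part.covers π)
    ...   | z , z∈C | e with C
    ...     | y ∷ C′ = 1+n≢0 {length R + length (C′ ++ concat Cs)}
        (trans (sym (trans (length-++ R) (+-suc (length R) (length (C′ ++ concat Cs))))) (suc-injective e))

  module _ {P Q : Piece n} (wP : WellFormed P) (wQ : WellFormed Q) (u₁₂ : Unique (verts P ++ verts Q))
           {I J} (v₁ : Represents P I) (v₂ : Represents Q J) where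

    link-represents : Represents (link P Q) (value (M (value (I ⊙ J))))
    link-represents = ⊙-valid l u p l≤u (Achieves-positive P) (Achieves-positive Q)
                        (link-composition w l u wP wQ u₁₂ p) v₁ v₂

    link-steps : steps (I ⊙ J) + steps (M (value (I ⊙ J))) ≤ unit l u p
    link-steps = ⊙M-steps l u p l≤u 1≤p (Achieves-measured w l u p P) (Achieves-measured w l u p Q)
                   (Achieves-measured w l u p (link P Q)) (link-composition w l u wP wQ u₁₂ p) v₁ v₂

  -- Paths of pieces

  branchTree : IntervalPartitionSet → List IntervalPartitionSet → Tree
  branchTree I Is = tree I (value (branch Is))

  branch-steps : ∀ Is → steps (branch Is) ≡ suc (length Is)
  branch-steps []       = refl
  branch-steps (I ∷ Is) = cong suc (trans (+-identityʳ _) (branch-steps Is))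

  branch-length : ∀ Is → length (value (branch Is)) ≤ 1
  branch-length []       = z≤n
  branch-length (I ∷ Is) = ≤-refl

  private
    tail-unique : ∀ (P Q : Piece n) Qs → Unique (verts (attach P (Q ∷ Qs))) → Unique (verts (attach Q Qs))
    tail-unique P Q Qs u₁₂ = proj₁ (proj₂ (Unique-++⁻ (verts P) u₁₂))

  attach-represents : ∀ {P Qs I Is} → WellFormed P → All WellFormed Qs → Unique (verts (attach P Qs)) →
                      Represents P I → Pointwise Represents Qs Is →
                      Represents (attach P Qs) (value (treePartition (branchTree I Is)))
  attach-represents wP [] u₁₂ v [] = v
  attach-represents {P} {Q ∷ Qs} wP (wQ ∷ wQs) u₁₂ v (v′ ∷ vs) =
    link-represents wP (attach-wf wQ wQs u₂) u₁₂ v (attach-represents wQ wQs u₂ v′ vs)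
    where u₂ = tail-unique P Q Qs u₁₂

  attach-steps : ∀ {P Qs I Is} → WellFormed P → All WellFormed Qs → Unique (verts (attach P Qs)) →
                 Represents P I → Pointwise Represents Qs Is →
                 steps (treePartition (branchTree I Is)) ≤ length Is * (3 + unit l u p) + 2
  attach-steps wP [] u₁₂ v [] = ≤-refl
  attach-steps {P} {Q ∷ Qs} {I} {J ∷ Js} wP (wQ ∷ wQs) u₁₂ v (v′ ∷ vs) = begin
    2 + (t + (a + (b + 1)))               ≡⟨ solve 3 (λ t a b → con 2 :+ (t :+ (a :+ (b :+ con 1))) := con 3 :+ (a :+ b) :+ t) refl t a b ⟩
    3 + (a + b) + t                       ≤⟨ +-mono-≤ (+-monoʳ-≤ 3 (link-steps wP (attach-wf wQ wQs u₂) u₁₂ v (attach-represents wQ wQs u₂ v′ vs)))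
                                                      (attach-steps wQ wQs u₂ v′ vs) ⟩
    3 + unit l u p + (length Js * (3 + unit l u p) + 2) ≡⟨ +-assoc (3 + unit l u p) (length Js * (3 + unit l u p)) 2 ⟨
    suc (length Js) * (3 + unit l u p) + 2      ∎
    where
    open ≤-Reasoning
    open +-*-Solver
    u₂ = tail-unique P Q Qs u₁₂
    K = value (treePartition (branchTree J Js))
    t = steps (treePartition (branchTree J Js))
    a = steps (I ⊙ K)
    b = steps (M (value (I ⊙ K)))

  treePartition-++ : ∀ I Is ts → value (treePartition (tree I (value (branch Is) ++ ts))) ≡
                                 value (treePartition (tree (value (treePartition (branchTree I Is))) ts))
  treePartition-++ I []       ts = refl
  treePartition-++ I (J ∷ Is) ts = refl

  -- Processing the front branch on its own costs two ticks more: one to close its list of children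
  -- and one to enter the second tree.
  treePartition-++-steps : ∀ I Is ts → 2 + steps (treePartition (tree I (value (branch Is) ++ ts))) ≡
    steps (treePartition (branchTree I Is)) + steps (treePartition (tree (value (treePartition (branchTree I Is))) ts))
  treePartition-++-steps I []       ts = refl
  treePartition-++-steps I (J ∷ Js) ts =
    solve 4 (λ t a b c → con 4 :+ (t :+ (a :+ (b :+ c))) := con 2 :+ (t :+ (a :+ (b :+ con 1))) :+ (con 1 :+ c)) refl
      (steps (treePartition (branchTree J Js))) (steps (I ⊙ value (treePartition (branchTree J Js))))
      (steps (M (value (I ⊙ value (treePartition (branchTree J Js))))))
      (steps (treePartitionFrom (value (treePartition (branchTree I (J ∷ Js)))) ts))
    where open +-*-Solver

  cutTree-value : ∀ I Fs Bs → value (cutTree I Fs Bs) ≡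
                  tree I (value (branch (reverse Fs)) ++ value (branch (reverse Bs)))
  cutTree-value I Fs Bs
    rewrite reverseOnto-value [] Fs | reverseOnto-value [] Bs
    = cong (tree I) (append-value (value (branch (reverse Fs))) _)

  cutTree-steps : ∀ I Fs Bs → steps (cutTree I Fs Bs) ≤ 7 + 2 * (length Fs + length Bs)
  cutTree-steps I Fs Bs
    rewrite reverseOnto-value [] Fs | reverseOnto-value [] Bs | reverseOnto-steps [] Fs | reverseOnto-steps [] Bs
          | branch-steps (reverse Fs) | branch-steps (reverse Bs)
          | append-steps (value (branch (reverse Fs))) (value (branch (reverse Bs)))
          | length-reverse Fs | length-reverse Bs = begin
    suc (suc f + (suc b + (suc f + (suc b + (suc c + 0)))))
      ≡⟨ solve 3 (λ f b c → con 1 :+ ((con 1 :+ f) :+ ((con 1 :+ b) :+ ((con 1 :+ f) :+ ((con 1 :+ b) :+ ((con 1 :+ c) :+ con 0)))))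
                            := con 6 :+ con 2 :* (f :+ b) :+ c) refl f b c ⟩
    6 + 2 * (f + b) + c ≤⟨ +-monoʳ-≤ (6 + 2 * (f + b)) (branch-length (reverse Fs)) ⟩
    6 + 2 * (f + b) + 1 ≡⟨ +-comm (6 + 2 * (f + b)) 1 ⟩
    7 + 2 * (f + b)     ∎
    where
    open ≤-Reasoning
    open +-*-Solver
    f = length Fs
    b = length Bs
    c = length (value (branch (reverse Fs)))

  -- All cuts of a cycle

  module _ {P : Piece n} {I} (wP : WellFormed P) (v : Represents P I) where

    cut-represents : ∀ {Ps Qs Fs Bs} → All WellFormed Ps → All WellFormed Qs → Unique (verts (cutRing P (reverse Ps) Qs)) →
                     Pointwise Represents Ps Fs → Pointwise Represents Qs Bs →
                     Represents (cutRing P (reverse Ps) Qs) (value (treePartition (value (cutTree I Fs Bs))))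
    cut-represents {Ps} {Qs} {Fs} {Bs} wPs wQs u₁₂ vs vs′ =
      subst (Represents (cutRing P (reverse Ps) Qs))
        (sym (trans (cong (value ∘ treePartition) (cutTree-value I Fs Bs))
                    (treePartition-++ I (reverse Fs) (value (branch (reverse Bs))))))
        (attach-represents (attach-wf wP wPs′ u₁) wQs′ u₁₂
          (attach-represents wP wPs′ u₁ v (Pointwise.reverse⁺ vs)) (Pointwise.reverse⁺ vs′))
      where
      wPs′ = All-resp-↭ (↭-sym (↭-reverse Ps)) wPs
      wQs′ = All-resp-↭ (↭-sym (↭-reverse Qs)) wQs
      u₁ : Unique (verts (attach P (reverse Ps)))
      u₁ = proj₁ (Unique-++⁻ (verts (attach P (reverse Ps)))
             (subst Unique (attach-verts (attach P (reverse Ps)) (reverse Qs)) u₁₂))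

    cut-steps : ∀ {Ps Qs Fs Bs} → All WellFormed Ps → All WellFormed Qs → Unique (verts (cutRing P (reverse Ps) Qs)) →
                Pointwise Represents Ps Fs → Pointwise Represents Qs Bs →
                steps (treePartition (value (cutTree I Fs Bs))) ≤ (length Fs + length Bs) * (3 + unit l u p) + 2
    cut-steps {Ps} {Qs} {Fs} {Bs} wPs wQs u₁₂ vs vs′ = +-cancelˡ-≤ 2 _ _ (begin
      2 + steps (treePartition (value (cutTree I Fs Bs)))
        ≡⟨ cong (λ t → 2 + steps (treePartition t)) (cutTree-value I Fs Bs) ⟩
      2 + steps (treePartition (tree I (value (branch (reverse Fs)) ++ value (branch (reverse Bs)))))
        ≡⟨ treePartition-++-steps I (reverse Fs) (value (branch (reverse Bs))) ⟩
      steps (treePartition (branchTree I (reverse Fs))) + steps (treePartition (branchTree I′ (reverse Bs)))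
        ≤⟨ +-mono-≤ (attach-steps wP wPs′ u₁ v (Pointwise.reverse⁺ vs))
                    (attach-steps (attach-wf wP wPs′ u₁) wQs′ u₁₂
                      (attach-represents wP wPs′ u₁ v (Pointwise.reverse⁺ vs)) (Pointwise.reverse⁺ vs′)) ⟩
      (length (reverse Fs) * (3 + unit l u p) + 2) + (length (reverse Bs) * (3 + unit l u p) + 2)
        ≡⟨ cong₂ (λ a b → (a * (3 + unit l u p) + 2) + (b * (3 + unit l u p) + 2)) (length-reverse Fs) (length-reverse Bs) ⟩
      (length Fs * (3 + unit l u p) + 2) + (length Bs * (3 + unit l u p) + 2)
        ≡⟨ solve 3 (λ f b c → f :* c :+ con 2 :+ (b :* c :+ con 2) := con 2 :+ ((f :+ b) :* c :+ con 2)) refl (length Fs) (length Bs) (3 + unit l u p) ⟩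
      2 + ((length Fs + length Bs) * (3 + unit l u p) + 2) ∎)
      where
      open ≤-Reasoning
      open +-*-Solver
      I′ = value (treePartition (branchTree I (reverse Fs)))
      wPs′ = All-resp-↭ (↭-sym (↭-reverse Ps)) wPs
      wQs′ = All-resp-↭ (↭-sym (↭-reverse Qs)) wQs
      u₁ : Unique (verts (attach P (reverse Ps)))
      u₁ = proj₁ (Unique-++⁻ (verts (attach P (reverse Ps)))
             (subst Unique (attach-verts (attach P (reverse Ps)) (reverse Qs)) u₁₂))

    private
      ring-ʳ++ : ∀ Ps Qs → verts (cutRing P (reverse Ps) Qs) ↭ verts (ring P (Ps ʳ++ Qs))
      ring-ʳ++ Ps Qs = ↭-trans (cutRing-verts P (reverse Ps) Qs)
                               (↭-reflexive (cong (λ Xs → verts (ring P Xs)) (sym (ʳ++-defn Ps))))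

      cut-unique : ∀ Ps Qs → Unique (verts (ring P (Ps ʳ++ Qs))) → Unique (verts (cutRing P (reverse Ps) Qs))
      cut-unique Ps Qs = Unique-resp-↭ (↭-sym (ring-ʳ++ Ps Qs))

    -- `Ps ʳ++ Qs` is the list of pieces round the cycle. Moving the head of `Qs` onto `Ps` leaves
    -- it definitionally unchanged, so all cuts are compared with one and the same ring.
    cutsFrom-sound : ∀ {Ps Qs Fs Bs} → All WellFormed Ps → All WellFormed Qs → Unique (verts (ring P (Ps ʳ++ Qs))) →
                     Pointwise Represents Ps Fs → Pointwise Represents Qs Bs →
                     All (λ J → ∃[ B ] Valid l u p B J × (∀ {x k} → B x k → Achieves w l u (ring P (Ps ʳ++ Qs)) x k))
                         (value (cutsFrom I Fs Bs))
    cutsFrom-sound wPs [] u₁₂ vs [] = []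
    cutsFrom-sound {Ps} {Q ∷ Qs} wPs (wQ ∷ wQs) u₁₂ vs (v′ ∷ vs′) =
      (Achieves w l u (cutRing P (reverse Ps) (Q ∷ Qs))
      , cut-represents wPs (wQ ∷ wQs) (cut-unique Ps (Q ∷ Qs) u₁₂) vs (v′ ∷ vs′)
      , λ {x} {k} a → subst (λ Xs → Achieves w l u (ring P Xs) x k) (sym (ʳ++-defn Ps)) (cutRing-achieves w l u P (reverse Ps) Q Qs a))
      ∷ cutsFrom-sound (wQ ∷ wPs) wQs u₁₂ (v′ ∷ vs) vs′

    cutsFrom-complete : ∀ {Ps Qs Fs Bs} → All WellFormed Ps → All WellFormed Qs → Unique (verts (ring P (Ps ʳ++ Qs))) →
                        Pointwise Represents Ps Fs → Pointwise Represents Qs Bs →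
                        ∀ Xs Y Ys → Qs ≡ Xs ++ Y ∷ Ys →
                        Any (Represents (cutRing P (Ps ʳ++ Xs) (Y ∷ Ys))) (value (cutsFrom I Fs Bs))
    cutsFrom-complete {Ps} wPs wQs u₁₂ vs vs′@(_ ∷ _) [] Y Ys refl =
      here (cut-represents wPs wQs (cut-unique Ps (Y ∷ Ys) u₁₂) vs vs′)
    cutsFrom-complete wPs (wQ ∷ wQs) u₁₂ vs (v′ ∷ vs′) (X ∷ Xs) Y Ys refl =
      there (cutsFrom-complete (wQ ∷ wPs) wQs u₁₂ (v′ ∷ vs) vs′ Xs Y Ys refl)

    cutsFrom-length : ∀ Fs Bs → length (value (cutsFrom I Fs Bs)) ≡ length Bs
    cutsFrom-length Fs []       = refl
    cutsFrom-length Fs (B ∷ Bs) = cong suc (cutsFrom-length (B ∷ Fs) Bs)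

    -- `e` is the number of vertices of the cycle other than `w₁` and stays constant as the cut
    -- advances. Each cut takes `8 + 2 e` steps for building its tree, the tick included, and
    -- `e (3 + unit) + 2` for processing it.
    cutsFrom-steps : ∀ {Ps Qs Fs Bs e} → All WellFormed Ps → All WellFormed Qs → Unique (verts (ring P (Ps ʳ++ Qs))) →
                     Pointwise Represents Ps Fs → Pointwise Represents Qs Bs → length Fs + length Bs ≡ e →
                     steps (cutsFrom I Fs Bs) ≤ length Bs * (10 + e * (5 + unit l u p)) + 1
    cutsFrom-steps wPs [] u₁₂ vs [] _ = ≤-refl
    cutsFrom-steps {Ps} {Q ∷ Qs} {Fs} {B ∷ Bs} {e} wPs (wQ ∷ wQs) u₁₂ vs (v′ ∷ vs′) refl = begin
      suc (steps (cutTree I Fs (B ∷ Bs)) + (steps (treePartition (value (cutTree I Fs (B ∷ Bs)))) + (steps (cutsFrom I (B ∷ Fs) Bs) + 0)))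
        ≤⟨ s≤s (+-mono-≤ (cutTree-steps I Fs (B ∷ Bs)) (+-mono-≤
             (cut-steps wPs (wQ ∷ wQs) (cut-unique Ps (Q ∷ Qs) u₁₂) vs (v′ ∷ vs′))
             (+-monoˡ-≤ 0 (cutsFrom-steps {e = e} (wQ ∷ wPs) wQs u₁₂ (v′ ∷ vs) vs′ (sym (+-suc (length Fs) (length Bs))))))) ⟩
      suc (7 + 2 * e + (e * (3 + unit l u p) + 2 + (length Bs * c + 1 + 0)))
        ≡⟨ solve 3 (λ e U r → con 1 :+ (con 7 :+ con 2 :* e :+ (e :* (con 3 :+ U) :+ con 2 :+ (r :+ con 1 :+ con 0)))
                      := con 10 :+ e :* (con 5 :+ U) :+ r :+ con 1) refl e (unit l u p) (length Bs * c) ⟩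
      c + length Bs * c + 1 ∎
      where
      open ≤-Reasoning
      open +-*-Solver
      c = 10 + e * (5 + unit l u p)

    ring-represents : ∀ {Qs Is} → 1 ≤ length Qs → All WellFormed Qs → Unique (verts (ring P Qs)) →
                      Pointwise Represents Qs Is → Represents (ring P Qs) (value (polyCyclePartition I Is))
    ring-represents {Q ∷ Qs} _ wQs u₁₂ vs = ∪-valid l u p l≤u (Achieves-positive (ring P (Q ∷ Qs)))
      (cutsFrom-sound [] wQs u₁₂ [] vs)
      λ { (R , Cs , π , e) → case ring-split w l u u₁₂ π of λ
          (Xs , Y , Ys , e′ , π′) → Any.map (λ v″ → _ , v″ , R , Cs , π′ , e)
                                            (cutsFrom-complete [] wQs u₁₂ [] vs Xs Y Ys e′) }

    -- The cost is quadratic in the length of the cycle, through the number of cuts and the size of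
    -- each. Only the second factor is relaxed to `N`; the first is left to be summed over all
    -- cycles. What comes on top of `unit` is at most `25 maxLength²`, hence below a second `unit`.
    ring-steps : ∀ {Qs Is N} → 1 ≤ length Qs → All WellFormed Qs → Unique (verts (ring P Qs)) →
                 Pointwise Represents Qs Is → length Is ≤ N →
                 steps (polyCyclePartition I Is) ≤ length Is * (N * (2 * unit l u p))
    ring-steps {Q ∷ Qs} {Is} {N} _ wQs u₁₂ vs e≤N = begin
      suc (steps (cutsFrom I [] Is) + steps (M (value (cutsFrom I [] Is))))
        ≤⟨ s≤s (+-mono-≤ (cutsFrom-steps [] wQs u₁₂ [] vs refl)
             (≤-trans (∪-steps l u p l≤u (Achieves-measured w l u p (ring P (Q ∷ Qs))) (cutsFrom-sound [] wQs u₁₂ [] vs))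
                      (≤-reflexive (cong (λ j → suc (j * (3 + 4 * B))) (cutsFrom-length [] Is))))) ⟩
      suc (e * (10 + e * (5 + unit l u p)) + 1 + suc (e * (3 + 4 * B)))
        ≡⟨ solve 3 (λ e U b → con 1 :+ (e :* (con 10 :+ e :* (con 5 :+ U)) :+ con 1 :+ (con 1 :+ e :* (con 3 :+ con 4 :* b)))
                      := con 3 :+ e :* (e :* (con 5 :+ U) :+ (con 13 :+ con 4 :* b))) refl e (unit l u p) B ⟩
      3 + e * (e * (5 + unit l u p) + (13 + 4 * B))
        ≤⟨ +-monoˡ-≤ _ (*-monoˡ-≤ 3 1≤e) ⟩
      e * 3 + e * (e * (5 + unit l u p) + (13 + 4 * B))
        ≡⟨ *-distribˡ-+ e 3 _ ⟨
      e * (3 + (e * (5 + unit l u p) + (13 + 4 * B)))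
        ≤⟨ *-monoʳ-≤ e (begin
          3 + (e * (5 + unit l u p) + (13 + 4 * B)) ≡⟨ solve 2 (λ x b → con 3 :+ (x :+ (con 13 :+ con 4 :* b)) := x :+ (con 16 :+ con 4 :* b)) refl (e * (5 + unit l u p)) B ⟩
          e * (5 + unit l u p) + (16 + 4 * B)       ≤⟨ +-mono-≤ (*-monoˡ-≤ (5 + unit l u p) e≤N) (m≤n*m (16 + 4 * B) N {{>-nonZero 1≤N}}) ⟩
          N * (5 + unit l u p) + N * (16 + 4 * B)   ≡⟨ *-distribˡ-+ N (5 + unit l u p) _ ⟨
          N * (5 + unit l u p + (16 + 4 * B))       ≤⟨ *-monoʳ-≤ N (begin
            5 + unit l u p + (16 + 4 * B) ≡⟨ solve 2 (λ U b → con 5 :+ U :+ (con 16 :+ con 4 :* b) := U :+ (con 21 :+ con 4 :* b)) refl (unit l u p) B ⟩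
            unit l u p + (21 + 4 * B)     ≤⟨ +-monoʳ-≤ (unit l u p) (+-mono-≤ (*-monoʳ-≤ 21 1≤B²) (*-monoʳ-≤ 4 (m≤n*m B B {{>-nonZero 1≤B}}))) ⟩
            unit l u p + (21 * (B * B) + 4 * (B * B)) ≤⟨ +-monoʳ-≤ (unit l u p) (≤-trans (≤-reflexive (sym (*-distribʳ-+ (B * B) 21 4))) (*-monoˡ-≤ (B * B) (n≤1+n 25))) ⟩
            unit l u p + unit l u p             ≡⟨ cong (unit l u p +_) (+-identityʳ (unit l u p)) ⟨
            2 * unit l u p                ∎) ⟩
          N * (2 * unit l u p)                      ∎) ⟩
      e * (N * (2 * unit l u p)) ∎
      where
      open ≤-Reasoning
      open +-*-Solver
      B = maxLength l u p
      e = length Is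
      1≤e : 1 ≤ e
      1≤e = subst (1 ≤_) (Pointwise-length vs) (s≤s z≤n)
      1≤N = ≤-trans 1≤e e≤N
      1≤B : 1 ≤ B
      1≤B = ≤-trans 1≤p (m≤n+m p (p * p))
      1≤B² : 1 ≤ B * B
      1≤B² = *-mono-≤ 1≤B 1≤B

-- The algorithm on tree representations

module _ {n : ℕ} where

  -- Children are absorbed in the order of `partitionFrom`, so that at each moment the accumulator
  -- is the piece represented by the set computed so far.
  pieceOf   : VertexNode n → Piece n
  pieceFrom : Piece n → List (Child n) → Piece n
  piecesOf  : List (Entry n) → List (Piece n)
  pieceOf (node v cs) = pieceFrom (single v) cs
  pieceFrom P []                  = P
  pieceFrom P (vertexNode t ∷ cs) = pieceFrom (link P (pieceOf t)) cs
  pieceFrom P (cycleNode es ∷ cs) = pieceFrom (ring P (piecesOf es)) cs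
  piecesOf []               = []
  piecesOf (cVertex v ∷ es) = single v ∷ piecesOf es
  piecesOf (hVertex t ∷ es) = pieceOf t ∷ piecesOf es

  pieceFrom-root : ∀ P cs → root (pieceFrom P cs) ≡ root P
  pieceFrom-root P []                  = refl
  pieceFrom-root P (vertexNode t ∷ cs) = pieceFrom-root (link P (pieceOf t)) cs
  pieceFrom-root P (cycleNode es ∷ cs) = pieceFrom-root (ring P (piecesOf es)) cs

  pieceOf-root : ∀ t → root (pieceOf t) ≡ label t
  pieceOf-root (node v cs) = pieceFrom-root (single v) cs

  piecesOf-roots : ∀ es → map root (piecesOf es) ≡ map entryLabel es
  piecesOf-roots []               = refl
  piecesOf-roots (cVertex v ∷ es) = cong (v ∷_) (piecesOf-roots es)
  piecesOf-roots (hVertex t ∷ es) = cong₂ _∷_ (pieceOf-root t) (piecesOf-roots es)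

  -- Absorbing children only appends vertices; thus distinctness and the size bound for the final
  -- piece pass back to every intermediate one.
  pieceFrom-extends : ∀ P cs → ∃[ vs ] verts (pieceFrom P cs) ≡ verts P ++ vs
  pieceFrom-extends P [] = [] , sym (++-identityʳ (verts P))
  pieceFrom-extends P (vertexNode t ∷ cs) with pieceFrom-extends (link P (pieceOf t)) cs
  ... | vs , e = verts (pieceOf t) ++ vs , trans e (++-assoc (verts P) (verts (pieceOf t)) vs)
  pieceFrom-extends P (cycleNode es ∷ cs) with pieceFrom-extends (ring P (piecesOf es)) cs
  ... | vs , e = concatMap verts (piecesOf es) ++ vs , trans e (++-assoc (verts P) (concatMap verts (piecesOf es)) vs)

  pieceFrom-unique : ∀ P cs → Unique (verts (pieceFrom P cs)) → Unique (verts P)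
  pieceFrom-unique P cs u₁ with pieceFrom-extends P cs
  ... | vs , e = proj₁ (Unique-++⁻ (verts P) (subst Unique e u₁))

  pieceFrom-length : ∀ P cs → length (verts P) ≤ length (verts (pieceFrom P cs))
  pieceFrom-length P cs with pieceFrom-extends P cs
  ... | vs , e rewrite e | length-++ (verts P) {vs} = m≤m+n (length (verts P)) (length vs)

  pieceOf-wf   : ∀ t → Unique (verts (pieceOf t)) → WellFormed (pieceOf t)
  pieceFrom-wf : ∀ {P} cs → WellFormed P → Unique (verts (pieceFrom P cs)) → WellFormed (pieceFrom P cs)
  piecesOf-wf  : ∀ es → Unique (concatMap verts (piecesOf es)) → All WellFormed (piecesOf es)
  pieceOf-wf (node v cs) = pieceFrom-wf cs (single-wf v)
  pieceFrom-wf [] wP _ = wP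
  pieceFrom-wf {P} (vertexNode t ∷ cs) wP u₁ = pieceFrom-wf cs
    (link-wf wP (pieceOf-wf t (proj₁ (proj₂ (Unique-++⁻ (verts P) u₂)))) u₂) u₁
    where u₂ = pieceFrom-unique (link P (pieceOf t)) cs u₁
  pieceFrom-wf {P} (cycleNode es ∷ cs) wP u₁ = pieceFrom-wf cs
    (ring-wf wP (piecesOf-wf es (proj₁ (proj₂ (Unique-++⁻ (verts P) u₂)))) u₂) u₁
    where u₂ = pieceFrom-unique (ring P (piecesOf es)) cs u₁
  piecesOf-wf [] _ = []
  piecesOf-wf (cVertex v ∷ es) (_ ∷ u₁) = single-wf v ∷ piecesOf-wf es u₁
  piecesOf-wf (hVertex t ∷ es) u₁ with Unique-++⁻ (verts (pieceOf t)) u₁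
  ... | u₂ , u₃ , _ = pieceOf-wf t u₂ ∷ piecesOf-wf es u₃

  wf-length : ∀ {Qs : List (Piece n)} → All WellFormed Qs → length Qs ≤ length (concatMap verts Qs)
  wf-length [] = z≤n
  wf-length {Q ∷ Qs} (wQ ∷ wQs) rewrite length-++ (verts Q) {concatMap verts Qs} with verts Q | root∈ wQ
  ... | _ ∷ vs | _ = s≤s (≤-trans (wf-length wQs) (m≤n+m _ (length vs)))

  piecesOf-length : ∀ es → length (piecesOf es) ≡ length es
  piecesOf-length []               = refl
  piecesOf-length (cVertex _ ∷ es) = cong suc (piecesOf-length es)
  piecesOf-length (hVertex _ ∷ es) = cong suc (piecesOf-length es)

  -- `polyCyclePartition` returns the empty set if there is no edge to cut, which would be
  -- incomplete; a cycle of length at least 3 always offers one.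
  long-nonempty : ∀ es → 3 ≤ suc (length (map entryLabel es)) → 1 ≤ length (piecesOf es)
  long-nonempty []               (s≤s ())
  long-nonempty (cVertex _ ∷ es) _ = s≤s z≤n
  long-nonempty (hVertex _ ∷ es) _ = s≤s z≤n

  LongCycles : List (List (Fin n)) → Set
  LongCycles = All (λ C → 3 ≤ length C)

module _ {n : ℕ} (w : Fin n → ℕ) (l u p : ℕ) (l≤u : l ≤ u) (1≤p : 1 ≤ p) where
  open Algorithm l u p hiding (cactusPartitionPoly)

  private
    Rep : Piece n → IntervalPartitionSet → Set
    Rep = Represents w l u p l≤u 1≤p

  partition-represents        : ∀ t → LongCycles (cycles t) → Unique (verts (pieceOf t)) →
                                Rep (pieceOf t) (value (partition w t))
  partitionFrom-represents    : ∀ {P I} cs → LongCycles (cyclesChildren (root P) cs) → WellFormed P →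
                                Unique (verts (pieceFrom P cs)) → Rep P I →
                                Rep (pieceFrom P cs) (value (partitionFrom w I cs))
  partitionEntries-represents : ∀ es → LongCycles (cyclesEntries es) → Unique (concatMap verts (piecesOf es)) →
                                Pointwise Rep (piecesOf es) (value (partitionEntries w es))
  partition-represents (node v cs) long u₁ =
    partitionFrom-represents cs long (single-wf v) u₁ (single-represents w l u p l≤u 1≤p v)
  partitionFrom-represents [] _ _ _ v = v
  partitionFrom-represents {P} (vertexNode t ∷ cs) long wP u₁ v =
    partitionFrom-represents cs (Allₚ.++⁻ʳ (cycles t) long) (link-wf wP wT u₂) u₁
      (link-represents w l u p l≤u 1≤p wP wT u₂ v (partition-represents t (Allₚ.++⁻ˡ (cycles t) long) u₃))
    where
    u₂ = pieceFrom-unique (link P (pieceOf t)) cs u₁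
    u₃ = proj₁ (proj₂ (Unique-++⁻ (verts P) u₂))
    wT = pieceOf-wf t u₃
  partitionFrom-represents {P} (cycleNode es ∷ cs) (q ∷ long) wP u₁ v =
    partitionFrom-represents cs (Allₚ.++⁻ʳ (cyclesEntries es) long) (ring-wf wP wes u₂) u₁
      (ring-represents w l u p l≤u 1≤p wP v (long-nonempty es q) wes u₂ (partitionEntries-represents es (Allₚ.++⁻ˡ (cyclesEntries es) long) u₃))
    where
    u₂ = pieceFrom-unique (ring P (piecesOf es)) cs u₁
    u₃ = proj₁ (proj₂ (Unique-++⁻ (verts P) u₂))
    wes = piecesOf-wf es u₃
  partitionEntries-represents [] _ _ = []
  partitionEntries-represents (cVertex v ∷ es) long (_ ∷ u₁) =
    single-represents w l u p l≤u 1≤p v ∷ partitionEntries-represents es long u₁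
  partitionEntries-represents (hVertex t ∷ es) long u₁ with Unique-++⁻ (verts (pieceOf t)) u₁
  ... | u₂ , u₃ , _ = partition-represents t (Allₚ.++⁻ˡ (cycles t) long) u₂
                    ∷ partitionEntries-represents es (Allₚ.++⁻ʳ (cycles t) long) u₃

  -- Running time on a tree representation

  module _ (N : ℕ) where
    private
      U = unit l u p

      Z : ℕ
      Z = N * U

      26≤U : 26 ≤ U
      26≤U = *-monoʳ-≤ 26 (*-mono-≤ 1≤B 1≤B)
        where
        1≤B : 1 ≤ maxLength l u p
        1≤B = ≤-trans 1≤p (m≤n+m p (p * p))

      U≤Z : 1 ≤ N → U ≤ Z
      U≤Z 1≤N = m≤n*m U N {{>-nonZero 1≤N}}

    -- 5 Z per vertex: the surplus 3 Z pays for the ⊙ at the parent, or for the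
    -- share of the vertex in the cost of its cycle.
    partition-steps        : ∀ t → LongCycles (cycles t) → Unique (verts (pieceOf t)) → 1 ≤ N → length (verts (pieceOf t)) ≤ N →
                             steps (partition w t) + 3 * Z ≤ length (verts (pieceOf t)) * (5 * Z)
    partitionFrom-steps    : ∀ {P I} cs → LongCycles (cyclesChildren (root P) cs) → WellFormed P →
                             Unique (verts (pieceFrom P cs)) → Rep P I → 1 ≤ N → length (verts (pieceFrom P cs)) ≤ N →
                             steps (partitionFrom w I cs) + length (verts P) * (5 * Z) ≤ 1 + length (verts (pieceFrom P cs)) * (5 * Z)
    partitionEntries-steps : ∀ es → LongCycles (cyclesEntries es) → Unique (concatMap verts (piecesOf es)) → 1 ≤ N →
                             length (concatMap verts (piecesOf es)) ≤ N →
                             steps (partitionEntries w es) + length es * (2 + 2 * Z) ≤ 1 + length (concatMap verts (piecesOf es)) * (5 * Z)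
    partition-steps (node v cs) long u₁ 1≤N ≤N = begin
      suc (steps (partitionFrom w (singleton w v) cs)) + 3 * Z
        ≡⟨ solve 2 (λ f z → con 1 :+ f :+ con 3 :* z := f :+ (con 1 :+ con 3 :* z)) refl f Z ⟩
      f + (1 + 3 * Z)       ≤⟨ +-cancelˡ-≤ 1 _ _ (begin
        1 + (f + (1 + 3 * Z)) ≡⟨ solve 2 (λ f z → con 1 :+ (f :+ (con 1 :+ con 3 :* z)) := f :+ (con 2 :+ con 3 :* z)) refl f Z ⟩
        -- Of the `5 Z` belonging to the vertex of this node, `2 Z` covers the tick here and the
        -- additive 1 of `partitionFrom-steps`; the other `3 Z` is the surplus.
        f + (2 + 3 * Z)       ≤⟨ +-monoʳ-≤ f (+-monoˡ-≤ (3 * Z) (*-monoʳ-≤ 2 1≤Z)) ⟩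
        f + (2 * Z + 3 * Z)   ≡⟨ solve 2 (λ f z → f :+ (con 2 :* z :+ con 3 :* z) := f :+ con 1 :* (con 5 :* z)) refl f Z ⟩
        f + 1 * (5 * Z)       ≤⟨ partitionFrom-steps cs long (single-wf v) u₁ (single-represents w l u p l≤u 1≤p v) 1≤N ≤N ⟩
        1 + length (verts (pieceOf (node v cs))) * (5 * Z) ∎) ⟩
      length (verts (pieceOf (node v cs))) * (5 * Z) ∎
      where
      open ≤-Reasoning
      open +-*-Solver
      f = steps (partitionFrom w (singleton w v) cs)
      1≤Z = ≤-trans (≤-trans (s≤s z≤n) 26≤U) (U≤Z 1≤N)
    partitionFrom-steps [] _ _ _ _ _ _ = ≤-refl
    partitionFrom-steps {P} {I} (vertexNode t ∷ cs) long wP u₁ v 1≤N ≤N = begin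
      1 + (s + (a + (b + f))) + |P| * (5 * Z)
        ≡⟨ solve 6 (λ s a b f q z → con 1 :+ (s :+ (a :+ (b :+ f))) :+ q :* (con 5 :* z) := (s :+ (con 1 :+ (a :+ b))) :+ (f :+ q :* (con 5 :* z))) refl s a b f |P| Z ⟩
      (s + (1 + (a + b))) + (f + |P| * (5 * Z))
        ≤⟨ +-monoˡ-≤ _ (+-monoʳ-≤ s (+-mono-≤ 1≤Z (≤-trans (link-steps w l u p l≤u 1≤p wP wT u₂ v vT) (U≤Z 1≤N)))) ⟩
      (s + (Z + Z)) + (f + |P| * (5 * Z))
        ≤⟨ +-monoˡ-≤ _ (+-monoʳ-≤ s (m≤m+n (Z + Z) Z)) ⟩
      (s + (Z + Z + Z)) + (f + |P| * (5 * Z))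
        ≡⟨ solve 4 (λ s z f q → (s :+ (z :+ z :+ z)) :+ (f :+ q) := (s :+ con 3 :* z) :+ (f :+ q)) refl s Z f (|P| * (5 * Z)) ⟩
      (s + 3 * Z) + (f + |P| * (5 * Z))
        ≤⟨ +-monoˡ-≤ _ (partition-steps t (Allₚ.++⁻ˡ (cycles t) long) u₃ 1≤N |t|≤N) ⟩
      |t| * (5 * Z) + (f + |P| * (5 * Z))
        ≡⟨ solve 4 (λ t z f q → t :* (con 5 :* z) :+ (f :+ q :* (con 5 :* z)) := f :+ (q :+ t) :* (con 5 :* z)) refl |t| Z f |P| ⟩
      f + (|P| + |t|) * (5 * Z)
        ≡⟨ cong (λ k → f + k * (5 * Z)) (length-++ (verts P)) ⟨
      f + length (verts (link P (pieceOf t))) * (5 * Z)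
        ≤⟨ partitionFrom-steps cs (Allₚ.++⁻ʳ (cycles t) long) (link-wf wP wT u₂) u₁
             (link-represents w l u p l≤u 1≤p wP wT u₂ v vT) 1≤N ≤N ⟩
      1 + length (verts (pieceFrom P (vertexNode t ∷ cs))) * (5 * Z) ∎
      where
      open ≤-Reasoning
      open +-*-Solver
      u₂ = pieceFrom-unique (link P (pieceOf t)) cs u₁
      u₃ = proj₁ (proj₂ (Unique-++⁻ (verts P) u₂))
      wT = pieceOf-wf t u₃
      vT = partition-represents t (Allₚ.++⁻ˡ (cycles t) long) u₃
      J = value (I ⊙ value (partition w t))
      s = steps (partition w t)
      a = steps (I ⊙ value (partition w t))
      b = steps (M J)
      f = steps (partitionFrom w (value (M J)) cs)
      |P| = length (verts P)
      |t| = length (verts (pieceOf t))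
      1≤Z = ≤-trans (≤-trans (s≤s z≤n) 26≤U) (U≤Z 1≤N)
      |t|≤N : |t| ≤ N
      |t|≤N = ≤-trans (m≤n+m |t| |P|) (≤-trans (≤-reflexive (sym (length-++ (verts P))))
                (≤-trans (pieceFrom-length (link P (pieceOf t)) cs) ≤N))
    partitionFrom-steps {P} {I} (cycleNode es ∷ cs) (q ∷ long) wP u₁ v 1≤N ≤N = begin
      1 + (s + (a + f)) + |P| * (5 * Z)
        ≡⟨ solve 4 (λ s a f q → con 1 :+ (s :+ (a :+ f)) :+ q := (con 1 :+ s :+ a) :+ (f :+ q)) refl s a f (|P| * (5 * Z)) ⟩
      (1 + s + a) + (f + |P| * (5 * Z))
        -- The entries have `2 + 2 Z` each to spare: `2 Z` for the cuts of the cycle, and 2 for the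
        -- tick here and the additive 1 of `partitionEntries-steps`, as there is at least one entry.
        ≤⟨ +-monoˡ-≤ _ (+-cancelˡ-≤ 1 _ _ (begin
           1 + (1 + s + a)               ≤⟨ +-mono-≤ 1≤e (s≤s (+-monoʳ-≤ s cycle-steps)) ⟩
           e + (1 + s + e * (2 * Z))     ≤⟨ +-monoʳ-≤ e (+-monoˡ-≤ (e * (2 * Z)) (+-monoˡ-≤ s 1≤e)) ⟩
           e + (e + s + e * (2 * Z))     ≡⟨ solve 3 (λ e s z → e :+ (e :+ s :+ e :* (con 2 :* z)) := s :+ e :* (con 2 :+ con 2 :* z)) refl e s Z ⟩
           s + e * (2 + 2 * Z)           ≤⟨ partitionEntries-steps es (Allₚ.++⁻ˡ (cyclesEntries es) long) u₃ 1≤N |es|≤N ⟩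
           1 + |es| * (5 * Z)            ∎)) ⟩
      |es| * (5 * Z) + (f + |P| * (5 * Z))
        ≡⟨ solve 4 (λ t z f q → t :* (con 5 :* z) :+ (f :+ q :* (con 5 :* z)) := f :+ (q :+ t) :* (con 5 :* z)) refl |es| Z f |P| ⟩
      f + (|P| + |es|) * (5 * Z)
        ≡⟨ cong (λ k → f + k * (5 * Z)) (length-++ (verts P)) ⟨
      f + length (verts (ring P (piecesOf es))) * (5 * Z)
        ≤⟨ partitionFrom-steps cs (Allₚ.++⁻ʳ (cyclesEntries es) long) (ring-wf wP wes u₂) u₁
             (ring-represents w l u p l≤u 1≤p wP v (long-nonempty es q) wes u₂ ves) 1≤N ≤N ⟩
      1 + length (verts (pieceFrom P (cycleNode es ∷ cs))) * (5 * Z) ∎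
      where
      open ≤-Reasoning
      open +-*-Solver
      u₂ = pieceFrom-unique (ring P (piecesOf es)) cs u₁
      u₃ = proj₁ (proj₂ (Unique-++⁻ (verts P) u₂))
      wes = piecesOf-wf es u₃
      ves = partitionEntries-represents es (Allₚ.++⁻ˡ (cyclesEntries es) long) u₃
      Is = value (partitionEntries w es)
      s = steps (partitionEntries w es)
      a = steps (polyCyclePartition I Is)
      f = steps (partitionFrom w (value (polyCyclePartition I Is)) cs)
      e = length es
      |P| = length (verts P)
      |es| = length (concatMap verts (piecesOf es))
      |Is|≡e : length Is ≡ e
      |Is|≡e = trans (sym (Pointwise-length ves)) (piecesOf-length es)
      1≤e : 1 ≤ e
      1≤e = ≤-trans (long-nonempty es q) (≤-reflexive (piecesOf-length es))
      |es|≤N : |es| ≤ N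
      |es|≤N = ≤-trans (m≤n+m |es| |P|) (≤-trans (≤-reflexive (sym (length-++ (verts P))))
                 (≤-trans (pieceFrom-length (ring P (piecesOf es)) cs) ≤N))
      cycle-steps : a ≤ e * (2 * Z)
      cycle-steps = begin
        a                        ≤⟨ ring-steps w l u p l≤u 1≤p wP v (long-nonempty es q) wes u₂ ves
                                      (≤-trans (≤-reflexive (sym (Pointwise-length ves))) (≤-trans (wf-length wes) |es|≤N)) ⟩
        length Is * (N * (2 * U)) ≡⟨ cong₂ _*_ |Is|≡e (solve 2 (λ n u → n :* (con 2 :* u) := con 2 :* (n :* u)) refl N U) ⟩
        e * (2 * Z)              ∎
    partitionEntries-steps [] _ _ _ _ = ≤-refl
    partitionEntries-steps (cVertex v ∷ es) long (_ ∷ u₁) 1≤N ≤N = begin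
      1 + (s + 0) + (2 + 2 * Z + length es * (2 + 2 * Z))
        ≡⟨ solve 3 (λ s z r → con 1 :+ (s :+ con 0) :+ (con 2 :+ con 2 :* z :+ r) := (con 3 :+ con 2 :* z) :+ (s :+ r)) refl s Z (length es * (2 + 2 * Z)) ⟩
      (3 + 2 * Z) + (s + length es * (2 + 2 * Z))
        ≤⟨ +-mono-≤ (+-monoˡ-≤ (2 * Z) (*-monoʳ-≤ 3 1≤Z)) (partitionEntries-steps es long u₁ 1≤N (≤-trans (n≤1+n _) ≤N)) ⟩
      (3 * Z + 2 * Z) + (1 + |es| * (5 * Z))
        ≡⟨ solve 2 (λ z r → (con 3 :* z :+ con 2 :* z) :+ (con 1 :+ r) := con 1 :+ (con 5 :* z :+ r)) refl Z (|es| * (5 * Z)) ⟩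
      1 + suc |es| * (5 * Z) ∎
      where
      open ≤-Reasoning
      open +-*-Solver
      s = steps (partitionEntries w es)
      |es| = length (concatMap verts (piecesOf es))
      1≤Z = ≤-trans (≤-trans (s≤s z≤n) 26≤U) (U≤Z 1≤N)
    partitionEntries-steps (hVertex t ∷ es) long u₁ 1≤N ≤N = begin
      1 + (s′ + (s + 0)) + (2 + 2 * Z + length es * (2 + 2 * Z))
        ≡⟨ solve 4 (λ s t z r → con 1 :+ (t :+ (s :+ con 0)) :+ (con 2 :+ con 2 :* z :+ r) := (t :+ (con 3 :+ con 2 :* z)) :+ (s :+ r)) refl s s′ Z (length es * (2 + 2 * Z)) ⟩
      (s′ + (3 + 2 * Z)) + (s + length es * (2 + 2 * Z))
        ≤⟨ +-mono-≤ (+-monoʳ-≤ s′ (+-monoˡ-≤ (2 * Z) 3≤Z))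
             (partitionEntries-steps es (Allₚ.++⁻ʳ (cycles t) long) u₃ 1≤N (≤-trans (m≤n+m |es| |t|) |t|+|es|≤N)) ⟩
      (s′ + 3 * Z) + (1 + |es| * (5 * Z))
        ≤⟨ +-monoˡ-≤ _ (partition-steps t (Allₚ.++⁻ˡ (cycles t) long) u₂ 1≤N (≤-trans (m≤m+n |t| |es|) |t|+|es|≤N)) ⟩
      |t| * (5 * Z) + (1 + |es| * (5 * Z))
        ≡⟨ solve 3 (λ t z r → t :* (con 5 :* z) :+ (con 1 :+ r :* (con 5 :* z)) := con 1 :+ (t :+ r) :* (con 5 :* z)) refl |t| Z |es| ⟩
      1 + (|t| + |es|) * (5 * Z)
        ≡⟨ cong (λ k → 1 + k * (5 * Z)) (length-++ (verts (pieceOf t))) ⟨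
      1 + length (verts (pieceOf t) ++ concatMap verts (piecesOf es)) * (5 * Z) ∎
      where
      open ≤-Reasoning
      open +-*-Solver
      s = steps (partitionEntries w es)
      s′ = steps (partition w t)
      |t| = length (verts (pieceOf t))
      |es| = length (concatMap verts (piecesOf es))
      u₂ = proj₁ (Unique-++⁻ (verts (pieceOf t)) u₁)
      u₃ = proj₁ (proj₂ (Unique-++⁻ (verts (pieceOf t)) u₁))
      3≤Z = ≤-trans (≤-trans (s≤s (s≤s (s≤s z≤n))) 26≤U) (U≤Z 1≤N)
      |t|+|es|≤N : |t| + |es| ≤ N
      |t|+|es|≤N = ≤-trans (≤-reflexive (sym (length-++ (verts (pieceOf t))))) ≤N

-- The graph of a tree representation

module _ {A : Set} where

  AllPairs-++⁻ : ∀ {R : A → A → Set} xs {ys} → AllPairs R (xs ++ ys) →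
                 AllPairs R xs × AllPairs R ys × (∀ {x y} → x ∈ xs → y ∈ ys → R x y)
  AllPairs-++⁻ []       rs = [] , rs , λ ()
  AllPairs-++⁻ (x ∷ xs) (r ∷ rs) with AllPairs-++⁻ xs rs
  ... | rsˡ , rsʳ , cross = Allₚ.++⁻ˡ xs r ∷ rsˡ , rsʳ , λ where
    (here refl) y∈ → All.lookup (Allₚ.++⁻ʳ xs r) y∈
    (there x∈)  y∈ → cross x∈ y∈

  cyclicPairs-cover : ∀ {v : A} C → v ∈ C → ∃[ y ] (v , y) ∈ cyclicPairs C
  cyclicPairs-cover {v} (x ∷ xs) v∈ = go x xs v∈
    where
    go : ∀ y ys → v ∈ y ∷ ys → ∃[ z ] (v , z) ∈ zip (y ∷ ys) (ys ∷ʳ x)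
    go y []        (here refl) = x , here refl
    go y (y′ ∷ ys) (here refl) = y′ , here refl
    go y (y′ ∷ ys) (there v∈)  with go y′ ys v∈
    ... | z , z∈ = z , there z∈

  lookup-injective : ∀ {xss : List (List A)} {v} → Unique (concat xss) →
                     ∀ i j → v ∈ lookup xss i → v ∈ lookup xss j → i ≡ j
  lookup-injective {xs ∷ xss} u fzero    fzero    p q = refl
  lookup-injective {xs ∷ xss} u fzero    (fsuc j) p q =
    ⊥-elim (proj₂ (proj₂ (Unique-++⁻ xs u)) p (∈-concat⁺′ q (∈-lookup {xs = xss} j)))
  lookup-injective {xs ∷ xss} u (fsuc i) fzero    p q =
    ⊥-elim (proj₂ (proj₂ (Unique-++⁻ xs u)) q (∈-concat⁺′ p (∈-lookup {xs = xss} i)))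
  lookup-injective {xs ∷ xss} u (fsuc i) (fsuc j) p q =
    cong fsuc (lookup-injective {xss} (proj₁ (proj₂ (Unique-++⁻ xs u))) i j p q)

  lookup-unique : ∀ {xss : List (List A)} → Unique (concat xss) → ∀ i → Unique (lookup xss i)
  lookup-unique {xs ∷ xss} u fzero    = proj₁ (Unique-++⁻ xs u)
  lookup-unique {xs ∷ xss} u (fsuc i) = lookup-unique {xss} (proj₁ (proj₂ (Unique-++⁻ xs u))) i

module _ {n : ℕ} where

  pieceOf-verts   : ∀ t → verts (pieceOf t) ↭ labels t ++ cLabels t
  pieceFrom-verts : ∀ P cs → verts (pieceFrom P cs) ↭ verts P ++ labelsChildren cs ++ cLabelsChildren cs
  piecesOf-verts  : ∀ (es : List (Entry n)) → concatMap verts (piecesOf es) ↭ labelsEntries es ++ cLabelsEntries es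
  pieceOf-verts (node v cs) = pieceFrom-verts (single v) cs
  pieceFrom-verts P [] = ↭-reflexive (sym (++-identityʳ (verts P)))
  pieceFrom-verts P (vertexNode t ∷ cs) = begin
    verts (pieceFrom (link P (pieceOf t)) cs)
      ↭⟨ pieceFrom-verts (link P (pieceOf t)) cs ⟩
    (verts P ++ verts (pieceOf t)) ++ (labelsChildren cs ++ cLabelsChildren cs)
      ≡⟨ ++-assoc (verts P) _ _ ⟩
    verts P ++ verts (pieceOf t) ++ (labelsChildren cs ++ cLabelsChildren cs)
      ↭⟨ ++⁺ˡ (verts P) (++⁺ʳ _ (pieceOf-verts t)) ⟩
    verts P ++ (labels t ++ cLabels t) ++ (labelsChildren cs ++ cLabelsChildren cs)
      ↭⟨ ++⁺ˡ (verts P) (++-interchange (labels t) (cLabels t) (labelsChildren cs) (cLabelsChildren cs)) ⟩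
    verts P ++ (labels t ++ labelsChildren cs) ++ (cLabels t ++ cLabelsChildren cs) ∎
    where open PermutationReasoning
  pieceFrom-verts P (cycleNode es ∷ cs) = begin
    verts (pieceFrom (ring P (piecesOf es)) cs)
      ↭⟨ pieceFrom-verts (ring P (piecesOf es)) cs ⟩
    (verts P ++ concatMap verts (piecesOf es)) ++ (labelsChildren cs ++ cLabelsChildren cs)
      ≡⟨ ++-assoc (verts P) _ _ ⟩
    verts P ++ concatMap verts (piecesOf es) ++ (labelsChildren cs ++ cLabelsChildren cs)
      ↭⟨ ++⁺ˡ (verts P) (++⁺ʳ _ (piecesOf-verts es)) ⟩
    verts P ++ (labelsEntries es ++ cLabelsEntries es) ++ (labelsChildren cs ++ cLabelsChildren cs)
      ↭⟨ ++⁺ˡ (verts P) (++-interchange (labelsEntries es) (cLabelsEntries es) (labelsChildren cs) (cLabelsChildren cs)) ⟩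
    verts P ++ (labelsEntries es ++ labelsChildren cs) ++ (cLabelsEntries es ++ cLabelsChildren cs) ∎
    where open PermutationReasoning
  piecesOf-verts []               = ↭-refl
  piecesOf-verts (cVertex v ∷ es) = ↭-trans (↭-prep v (piecesOf-verts es)) (↭-sym (shift v (labelsEntries es) (cLabelsEntries es)))
  piecesOf-verts (hVertex t ∷ es) = ↭-trans (++⁺ (pieceOf-verts t) (piecesOf-verts es))
    (++-interchange (labels t) (cLabels t) (labelsEntries es) (cLabelsEntries es))

  private
    cyclePairs : List (List (Fin n)) → List (Fin n × Fin n)
    cyclePairs = concatMap cyclicPairs

  pieceOf-arcs   : ∀ t → arcs (pieceOf t) ↭ edges t ++ concatMap cyclicPairs (cycles t)
  pieceFrom-arcs : ∀ P cs → arcs (pieceFrom P cs) ↭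
                   arcs P ++ edgesChildren (root P) cs ++ concatMap cyclicPairs (cyclesChildren (root P) cs)
  piecesOf-arcs  : ∀ (es : List (Entry n)) → concatMap arcs (piecesOf es) ↭
                   edgesEntries es ++ concatMap cyclicPairs (cyclesEntries es)
  pieceOf-arcs (node v cs) = pieceFrom-arcs (single v) cs
  pieceFrom-arcs P [] = ↭-reflexive (sym (++-identityʳ (arcs P)))
  pieceFrom-arcs P (vertexNode t ∷ cs) = begin
    arcs (pieceFrom (link P (pieceOf t)) cs)
      ↭⟨ pieceFrom-arcs (link P (pieceOf t)) cs ⟩
    (root P , root (pieceOf t)) ∷ (arcs P ++ arcs (pieceOf t)) ++ (E ++ K)
      ≡⟨ cong₂ _∷_ (cong (root P ,_) (pieceOf-root t)) (++-assoc (arcs P) _ _) ⟩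
    (root P , label t) ∷ arcs P ++ arcs (pieceOf t) ++ (E ++ K)
      ↭⟨ ↭-sym (shift (root P , label t) (arcs P) (arcs (pieceOf t) ++ (E ++ K))) ⟩
    arcs P ++ (root P , label t) ∷ arcs (pieceOf t) ++ (E ++ K)
      ↭⟨ ++⁺ˡ (arcs P) (↭-prep (root P , label t) (++⁺ʳ (E ++ K) (pieceOf-arcs t))) ⟩
    arcs P ++ (root P , label t) ∷ (edges t ++ cyclePairs (cycles t)) ++ (E ++ K)
      ↭⟨ ++⁺ˡ (arcs P) (↭-prep (root P , label t) (++-interchange (edges t) (cyclePairs (cycles t)) E K)) ⟩
    arcs P ++ (root P , label t) ∷ (edges t ++ E) ++ (cyclePairs (cycles t) ++ K)
      ≡⟨ cong (λ z → arcs P ++ (root P , label t) ∷ (edges t ++ E) ++ z) (concatMap-++ cyclicPairs (cycles t) (cyclesChildren (root P) cs)) ⟨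
    arcs P ++ edgesChildren (root P) (vertexNode t ∷ cs) ++ cyclePairs (cyclesChildren (root P) (vertexNode t ∷ cs)) ∎
    where
    open PermutationReasoning
    E = edgesChildren (root P) cs
    K = cyclePairs (cyclesChildren (root P) cs)
  pieceFrom-arcs P (cycleNode es ∷ cs) = begin
    arcs (pieceFrom (ring P (piecesOf es)) cs)
      ↭⟨ pieceFrom-arcs (ring P (piecesOf es)) cs ⟩
    (cyclicPairs (root P ∷ map root (piecesOf es)) ++ arcs P ++ concatMap arcs (piecesOf es)) ++ (E ++ K)
      ≡⟨ cong (λ z → (cyclicPairs (root P ∷ z) ++ arcs P ++ concatMap arcs (piecesOf es)) ++ (E ++ K)) (piecesOf-roots es) ⟩
    (c ++ arcs P ++ concatMap arcs (piecesOf es)) ++ (E ++ K)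
      ↭⟨ ++⁺ʳ (E ++ K) (shifts c (arcs P)) ⟩
    (arcs P ++ c ++ concatMap arcs (piecesOf es)) ++ (E ++ K)
      ≡⟨ trans (++-assoc (arcs P) _ _) (cong (arcs P ++_) (++-assoc c _ _)) ⟩
    arcs P ++ c ++ concatMap arcs (piecesOf es) ++ (E ++ K)
      ↭⟨ ++⁺ˡ (arcs P) (++⁺ˡ c (++⁺ʳ (E ++ K) (piecesOf-arcs es))) ⟩
    arcs P ++ c ++ (edgesEntries es ++ cyclePairs (cyclesEntries es)) ++ (E ++ K)
      ↭⟨ ++⁺ˡ (arcs P) (++⁺ˡ c (++-interchange (edgesEntries es) (cyclePairs (cyclesEntries es)) E K)) ⟩
    arcs P ++ c ++ (edgesEntries es ++ E) ++ (cyclePairs (cyclesEntries es) ++ K)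
      ↭⟨ ++⁺ˡ (arcs P) (shifts c (edgesEntries es ++ E)) ⟩
    arcs P ++ (edgesEntries es ++ E) ++ c ++ (cyclePairs (cyclesEntries es) ++ K)
      ≡⟨ cong (λ z → arcs P ++ (edgesEntries es ++ E) ++ c ++ z) (concatMap-++ cyclicPairs (cyclesEntries es) (cyclesChildren (root P) cs)) ⟨
    arcs P ++ edgesChildren (root P) (cycleNode es ∷ cs) ++ cyclePairs (cyclesChildren (root P) (cycleNode es ∷ cs)) ∎
    where
    open PermutationReasoning
    E = edgesChildren (root P) cs
    K = cyclePairs (cyclesChildren (root P) cs)
    c = cyclicPairs (root P ∷ map entryLabel es)
  piecesOf-arcs []               = ↭-refl
  piecesOf-arcs (cVertex v ∷ es) = piecesOf-arcs es
  piecesOf-arcs (hVertex t ∷ es) = begin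
    arcs (pieceOf t) ++ concatMap arcs (piecesOf es)
      ↭⟨ ++⁺ (pieceOf-arcs t) (piecesOf-arcs es) ⟩
    (edges t ++ cyclePairs (cycles t)) ++ (edgesEntries es ++ cyclePairs (cyclesEntries es))
      ↭⟨ ++-interchange (edges t) (cyclePairs (cycles t)) (edgesEntries es) (cyclePairs (cyclesEntries es)) ⟩
    (edges t ++ edgesEntries es) ++ (cyclePairs (cycles t) ++ cyclePairs (cyclesEntries es))
      ≡⟨ cong ((edges t ++ edgesEntries es) ++_) (concatMap-++ cyclicPairs (cycles t) (cyclesEntries es)) ⟨
    edgesEntries (hVertex t ∷ es) ++ cyclePairs (cyclesEntries (hVertex t ∷ es)) ∎
    where open PermutationReasoning

  -- `hinge` is the vertex at which the cycle node hangs, and `v` is another vertex of that cycle.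
  -- The first two fields locate a recorded C-vertex on a listed cycle; `hinge∈`, saying that the
  -- hinge has a node, serves to exclude the root from the recorded C-vertices.
  record CycleThrough (v : Fin n) (Cs : List (List (Fin n))) (Hs : List (Fin n)) : Set where
    constructor through
    field
      {hinge} : Fin n
      {rest}  : List (Fin n)
      cycle∈  : (hinge ∷ rest) ∈ Cs
      v∈rest  : v ∈ rest
      hinge∈  : hinge ∈ Hs

  CycleThrough-map : ∀ {v Cs Ds Hs Is} → (∀ {C} → C ∈ Cs → C ∈ Ds) → (∀ {h} → h ∈ Hs → h ∈ Is) →
                     CycleThrough v Cs Hs → CycleThrough v Ds Is
  CycleThrough-map f g (through a b c) = through (f a) b (g c)

  cLabels-through         : ∀ {v} t → v ∈ cLabels t → CycleThrough v (cycles t) (labels t)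
  cLabelsChildren-through : ∀ {v} h cs → v ∈ cLabelsChildren cs →
                            CycleThrough v (cyclesChildren h cs) (h ∷ labelsChildren cs)
  cLabelsEntries-through  : ∀ {v} es → v ∈ cLabelsEntries es →
                            v ∈ map entryLabel es ⊎ CycleThrough v (cyclesEntries es) (labelsEntries es)
  cLabels-through (node h cs) v∈ = cLabelsChildren-through h cs v∈
  cLabelsChildren-through h (vertexNode t ∷ cs) v∈ with ∈-++⁻ (cLabels t) v∈
  ... | inj₁ q = CycleThrough-map ∈-++⁺ˡ (there ∘ ∈-++⁺ˡ) (cLabels-through t q)
  ... | inj₂ q = CycleThrough-map (∈-++⁺ʳ (cycles t))
      (λ { (here e) → here e ; (there h∈) → there (∈-++⁺ʳ (labels t) h∈) }) (cLabelsChildren-through h cs q)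
  cLabelsChildren-through h (cycleNode es ∷ cs) v∈ with ∈-++⁻ (cLabelsEntries es) v∈
  ... | inj₂ q = CycleThrough-map (there ∘ ∈-++⁺ʳ (cyclesEntries es))
      (λ { (here e) → here e ; (there h∈) → there (∈-++⁺ʳ (labelsEntries es) h∈) }) (cLabelsChildren-through h cs q)
  ... | inj₁ q with cLabelsEntries-through es q
  ...   | inj₁ v∈es = through (here refl) v∈es (here refl)
  ...   | inj₂ c    = CycleThrough-map (there ∘ ∈-++⁺ˡ) (there ∘ ∈-++⁺ˡ) c
  cLabelsEntries-through (cVertex v ∷ es) (here refl) = inj₁ (here refl)
  cLabelsEntries-through (cVertex v ∷ es) (there v∈)  = Sum.map₁ there (cLabelsEntries-through es v∈)
  cLabelsEntries-through (hVertex t ∷ es) v∈ with ∈-++⁻ (cLabels t) v∈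
  ... | inj₁ q = inj₂ (CycleThrough-map ∈-++⁺ˡ ∈-++⁺ˡ (cLabels-through t q))
  ... | inj₂ q = Sum.map there (CycleThrough-map (∈-++⁺ʳ (cycles t)) (∈-++⁺ʳ (labels t))) (cLabelsEntries-through es q)

-- Each C-vertex is recorded only once

module _ {n : ℕ} (G : WeightedGraph n) where
  open WeightedGraph G

  SameCycle-sym : ∀ {C D : List (Fin n)} → SameCycle C D → SameCycle D C
  SameCycle-sym s x y = ⇔-sym (s x y)

  SameCycle-trans : ∀ {C D E : List (Fin n)} → SameCycle C D → SameCycle D E → SameCycle C E
  SameCycle-trans s t x y = t x y ⇔-∘ s x y

  same-cycle : ∀ {v C D} → CVertex G v → IsCycle G C → IsCycle G D → v ∈ C → v ∈ D → SameCycle C D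
  same-cycle {C = C} {D} (_ , E , _ , _ , only) c d v∈C v∈D = SameCycle-trans {C} {E} {D} (SameCycle-sym {E} {C} (only _ c v∈C)) (only _ d v∈D)

  Distinct : List (List (Fin n)) → Set
  Distinct = AllPairs (λ C D → ¬ SameCycle C D)

  private
    on-cycle : ∀ {v : Fin n} {Cs Hs} → CycleThrough v Cs Hs → ∃[ C ] C ∈ Cs × v ∈ C
    on-cycle (through a b _) = _ , a , there b

    clash : ∀ {v Cs Ds} → CVertex G v → All (IsCycle G) Cs → All (IsCycle G) Ds →
            (∀ {C D} → C ∈ Cs → D ∈ Ds → ¬ SameCycle C D) →
            ∃[ C ] C ∈ Cs × v ∈ C → ∃[ D ] D ∈ Ds × v ∈ D → ⊥
    clash cv cs ds distinct (C , C∈ , v∈C) (D , D∈ , v∈D) =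
      distinct C∈ D∈ (same-cycle cv (All.lookup cs C∈) (All.lookup ds D∈) v∈C v∈D)

  -- A C-vertex recorded twice would lie on two of the listed cycles or occur twice on one. The
  -- former is impossible because it is on one cycle only and the listed cycles differ, the latter
  -- because a cycle repeats no vertex.
  cLabels-unique         : ∀ t → All (CVertex G) (cLabels t) → All (IsCycle G) (cycles t) → Distinct (cycles t) →
                           Unique (cLabels t)
  cLabelsChildren-unique : ∀ h cs → All (CVertex G) (cLabelsChildren cs) → All (IsCycle G) (cyclesChildren h cs) →
                           Distinct (cyclesChildren h cs) → Unique (cLabelsChildren cs)
  cLabelsEntries-unique  : ∀ {C} es → IsCycle G C → (∀ {v} → v ∈ map entryLabel es → v ∈ C) → Unique (map entryLabel es) →
                           All (CVertex G) (cLabelsEntries es) → All (IsCycle G) (cyclesEntries es) →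
                           Distinct (C ∷ cyclesEntries es) → Unique (cLabelsEntries es)
  cLabels-unique (node h cs) = cLabelsChildren-unique h cs
  cLabelsChildren-unique h [] _ _ _ = []
  cLabelsChildren-unique h (vertexNode t ∷ cs) cv c distinct with AllPairs-++⁻ (cycles t) distinct
  ... | dˡ , dʳ , cross = Uniqueₚ.++⁺
    (cLabels-unique t (Allₚ.++⁻ˡ (cLabels t) cv) (Allₚ.++⁻ˡ (cycles t) c) dˡ)
    (cLabelsChildren-unique h cs (Allₚ.++⁻ʳ (cLabels t) cv) (Allₚ.++⁻ʳ (cycles t) c) dʳ)
    λ (p , q) → clash (All.lookup (Allₚ.++⁻ˡ (cLabels t) cv) p) (Allₚ.++⁻ˡ (cycles t) c) (Allₚ.++⁻ʳ (cycles t) c) cross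
                  (on-cycle (cLabels-through t p)) (on-cycle (cLabelsChildren-through h cs q))
  cLabelsChildren-unique h (cycleNode es ∷ cs) cv (c₀ ∷ c) distinct
    with AllPairs-++⁻ ((h ∷ map entryLabel es) ∷ cyclesEntries es) distinct | c₀
  ... | dˡ , dʳ , cross | _ , _ ∷ u₀ , _ = Uniqueₚ.++⁺
    (cLabelsEntries-unique es c₀ there u₀ (Allₚ.++⁻ˡ (cLabelsEntries es) cv) (Allₚ.++⁻ˡ (cyclesEntries es) c) dˡ)
    (cLabelsChildren-unique h cs (Allₚ.++⁻ʳ (cLabelsEntries es) cv) (Allₚ.++⁻ʳ (cyclesEntries es) c) dʳ)
    λ (p , q) → clash (All.lookup (Allₚ.++⁻ˡ (cLabelsEntries es) cv) p) (c₀ ∷ Allₚ.++⁻ˡ (cyclesEntries es) c) (Allₚ.++⁻ʳ (cyclesEntries es) c) cross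
                  (case cLabelsEntries-through es p of λ where
                    (inj₁ v∈) → _ , here refl , there v∈
                    (inj₂ r)  → case on-cycle r of λ (D , D∈ , v∈) → D , there D∈ , v∈)
                  (on-cycle (cLabelsChildren-through h cs q))
  cLabelsEntries-unique [] _ _ _ _ _ _ = []
  cLabelsEntries-unique (cVertex v ∷ es) c₀ ⊆C (v∉ ∷ u₀) (cv ∷ cvs) c (d ∷ ds) =
    Allₚ.¬Any⇒All¬ _ (λ v∈ → case cLabelsEntries-through es v∈ of λ where
      (inj₁ v∈es) → All.lookup v∉ v∈es refl
      (inj₂ r)    → clash cv (c₀ ∷ []) c (λ { (here refl) D∈ → All.lookup d D∈ }) (_ , here refl , ⊆C (here refl)) (on-cycle r))
    ∷ cLabelsEntries-unique es c₀ (⊆C ∘ there) u₀ cvs c (d ∷ ds)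
  cLabelsEntries-unique {C} (hVertex t ∷ es) c₀ ⊆C (_ ∷ u₀) cv c (d ∷ ds) with AllPairs-++⁻ (cycles t) ds
  ... | dˡ , dʳ , cross = Uniqueₚ.++⁺
    (cLabels-unique t (Allₚ.++⁻ˡ (cLabels t) cv) (Allₚ.++⁻ˡ (cycles t) c) dˡ)
    (cLabelsEntries-unique es c₀ (⊆C ∘ there) u₀ (Allₚ.++⁻ʳ (cLabels t) cv) (Allₚ.++⁻ʳ (cycles t) c) (Allₚ.++⁻ʳ (cycles t) d ∷ dʳ))
    λ (p , q) → let cvp = All.lookup (Allₚ.++⁻ˡ (cLabels t) cv) p in
      case cLabelsEntries-through es q of λ where
        (inj₁ v∈es) → clash cvp (c₀ ∷ []) (Allₚ.++⁻ˡ (cycles t) c) (λ { (here refl) D∈ → All.lookup (Allₚ.++⁻ˡ (cycles t) d) D∈ })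
                        (_ , here refl , ⊆C (there v∈es)) (on-cycle (cLabels-through t p))
        (inj₂ r)    → clash cvp (Allₚ.++⁻ˡ (cycles t) c) (Allₚ.++⁻ʳ (cycles t) c) cross
                        (on-cycle (cLabels-through t p)) (on-cycle r)

-- The piece of a tree representation is the whole graph

module _ {n : ℕ} {G : WeightedGraph n} {r : Fin n} {T : VertexNode n}
         (root-r : Root G r) (tr : IsTreeRepresentation G r T) where
  open WeightedGraph G
  open IsTreeRepresentation tr
  open DecMembership (_≟_ {n}) using (_∈?_)
  open DecMembership (Productₚ.≡-dec (_≟_ {n}) (_≟_ {n})) using () renaming (_∈?_ to _∈ₚ?_)

  private
    whole = pieceOf T

    -- Were `r` recorded as a C-vertex, it would not be a hinge, and so the graph would have no
    -- hinges. But the cycle on which `r` is recorded hangs at a different vertex with a node of its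
    -- own, and a vertex of a cycle that has a node and is not `r` is a hinge.
    root∉cLabels : ¬ r ∈ cLabels T
    root∉cLabels r∈ with cLabels-through T r∈
    ... | through {hinge} {rest} cycle∈ r∈rest hinge∈ with All.lookup cycles-cycles cycle∈
    ...   | c@(_ , hinge∉ ∷ _ , _) = All.lookup hinge∉ r∈rest (hinge≡r (Equivalence.to (labels-vertices hinge) hinge∈))
      where
      no-hinges : ∀ v → ¬ HVertex G v
      no-hinges = [ (λ (¬C , _) → contradiction (All.lookup cLabels-C r∈) ¬C) , id ]′ root-r
      hinge≡r : ¬ CVertex G hinge ⊎ hinge ≡ r → hinge ≡ r
      hinge≡r (inj₁ ¬C) = contradiction (¬C , λ ¬G → ¬G (_ , c , here refl)) (no-hinges hinge)
      hinge≡r (inj₂ e)  = e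

  pieceOf-unique : Unique (verts whole)
  pieceOf-unique = Unique-resp-↭ (↭-sym (pieceOf-verts T)) (Uniqueₚ.++⁺ labels-unique
    (cLabels-unique G T cLabels-C cycles-cycles cycles-distinct)
    λ {v} (p , q) → case Equivalence.to (labels-vertices v) p of λ where
      (inj₁ ¬C)   → ¬C (All.lookup cLabels-C q)
      (inj₂ refl) → root∉cLabels q)

  private
    cycle-arc : ∀ {C x y} → IsCycle G C → CycleEdge C x y → Adj (arcs whole) x y
    cycle-arc {C} {x} {y} c e with find (cycles-complete C c)
    ... | D , D∈ , same = Adj-mono
      (λ z∈ → ∈-resp-↭ (↭-sym (pieceOf-arcs T)) (∈-++⁺ʳ (edges T) (∈-concat⁺′ z∈ (∈-map⁺ cyclicPairs D∈))))
      (Equivalence.to (same x y) e)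

  -- Membership in the list is decidable, so `v` may be supposed missing. It is then no C-vertex,
  -- since an arc of its cycle would bring it in; hence it has a node and is not missing after all.
  pieceOf-covers : ∀ v → v ∈ verts whole
  pieceOf-covers v = decidable-stable (v ∈? verts whole) λ v∉ →
    v∉ (∈-resp-↭ (↭-sym (pieceOf-verts T)) (∈-++⁺ˡ (Equivalence.from (labels-vertices v) (inj₁
      λ (_ , C , c , v∈C , _) → case cyclicPairs-cover C v∈C of λ
        (_ , e) → v∉ (arcs∈ (pieceOf-wf T pieceOf-unique) (cycle-arc c (inj₁ e)))))))

  pieceOf-sound : ∀ {x y} → Adj (arcs whole) x y → x ~ y
  pieceOf-sound {x} {y} e with Adj-++⁻ (edges T) (Adj-mono (∈-resp-↭ (pieceOf-arcs T)) e)
  ... | inj₁ e′ = proj₁ (Equivalence.to (edges-acyclic x y) e′)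
  ... | inj₂ e′ = [ on-cycle , ~-sym ∘ on-cycle ]′ e′
    where
    on-cycle : ∀ {x y} → (x , y) ∈ concatMap cyclicPairs (cycles T) → x ~ y
    on-cycle p with ∈-concat⁻′ (map cyclicPairs (cycles T)) p
    ... | E , p∈E , E∈ with ∈-map⁻ cyclicPairs E∈
    ...   | C , C∈ , refl with All.lookup cycles-cycles C∈
    ...     | _ , _ , adjacent = All.lookup adjacent p∈E

  -- An edge missing from the arcs cannot be on a cycle, hence joins two nodes of the tree
  -- representation and is among the arcs after all.
  pieceOf-complete : ∀ {x y} → x ~ y → Adj (arcs whole) x y
  pieceOf-complete {x} {y} x~y =
    decidable-stable (((x , y) ∈ₚ? arcs whole) ⊎-dec ((y , x) ∈ₚ? arcs whole)) λ ¬e →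
      ¬e (Adj-mono (λ z∈ → ∈-resp-↭ (↭-sym (pieceOf-arcs T)) (∈-++⁺ˡ z∈))
        (Equivalence.from (edges-acyclic x y) (x~y , λ (_ , c , e) → ¬e (cycle-arc c e))))

  pieceOf-↭ : verts whole ↭ allFin n
  pieceOf-↭ = unique⇒↭ pieceOf-unique (Uniqueₚ.allFin⁺ n) (λ _ → ∈-allFin _) (λ _ → pieceOf-covers _)

  -- Partitions of the graph and partitions of its piece

  module _ (l u p : ℕ) where

    partition⇒achieves : Partition G l u p → ∃[ x ] Achieves weight l u whole x p × l ≤ x × x ≤ u
    -- The index of the cluster containing the root is taken out of `allFin p`, because `Part` lists
    -- that cluster apart from the others.
    partition⇒achieves π with ∈-∃++ (∈-allFin (Partition.cluster π (root whole)))
    ... | is , js , e = wt weight l u (D i₀)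
      , (D i₀ , map D (is ++ js) , record
          { covers   = ↭-trans (concat-↭ (map⁺ D order)) all-covered
          ; root∈R   = ∈-filter⁺ (λ v → cluster v ≟ i₀) (∈-allFin _) refl
          ; R-conn   = conn i₀
          ; clusters = Allₚ.map⁺ (All.tabulate λ {i} _ → record
              { connected = conn i ; inhabited = inhabited i ; lower = lower i ; upper = upper i }) }
        , refl
        , trans (cong suc (length-map D (is ++ js))) (trans (↭-length order) (length-tabulate {n = p} id)))
      , lower i₀ , upper i₀
      where
      open Partition π
      i₀ = cluster (root whole)
      D : Fin p → List (Fin n)
      D i = filter (λ v → cluster v ≟ i) (allFin n)
      order : i₀ ∷ is ++ js ↭ allFin p
      order = ↭-trans (↭-sym (shift i₀ is js)) (↭-reflexive (sym e))
      D⁻ : ∀ {v i} → v ∈ D i → cluster v ≡ i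
      D⁻ {i = i} v∈ = proj₂ (∈-filter⁻ (λ v → cluster v ≟ i) {xs = allFin n} v∈)
      D⁺ : ∀ {v i} → cluster v ≡ i → v ∈ D i
      D⁺ {i = i} = ∈-filter⁺ (λ v → cluster v ≟ i) (∈-allFin _)
      all-covered : concat (map D (allFin p)) ↭ verts whole
      all-covered = ↭-trans (unique⇒↭
        (Uniqueₚ.concat⁺ (Allₚ.map⁺ (All.tabulate λ {i} _ → Uniqueₚ.filter⁺ (λ v → cluster v ≟ i) (Uniqueₚ.allFin⁺ n)))
          (AllPairsₚ.map⁺ (AllPairs.map (λ i≢j {v} (p , q) → i≢j (trans (sym (D⁻ p)) (D⁻ q))) (Uniqueₚ.allFin⁺ p))))
        (Uniqueₚ.allFin⁺ n) (λ _ → ∈-allFin _)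
        (λ {v} _ → ∈-concat⁺′ (D⁺ {v} refl) (∈-map⁺ D (∈-allFin (cluster v))))) (↭-sym pieceOf-↭)
      conn : ∀ i → Conn (arcs whole) (D i)
      conn i x∈ y∈ = Star.map (λ (a , b , e) → D⁺ a , D⁺ b , pieceOf-complete e) (connected i (D⁻ x∈) (D⁻ y∈))
      inhabited : ∀ i → ∃[ v ] v ∈ D i
      inhabited i with nonempty i
      ... | v , e = v , D⁺ e

    -- The count in `Achieves` makes `p` equal to the length of `R ∷ Cs`, so positions in this list
    -- serve as cluster indices; as the vertices are distinct, each has only one position.
    achieves⇒partition : ∀ {x} → Achieves weight l u whole x p → l ≤ x → x ≤ u → Partition G l u p
    achieves⇒partition (R , Cs , π , refl , refl) l≤ ≤u = record
      { cluster   = cluster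
      ; nonempty  = λ i → case Cluster.inhabited (get i) of λ (v , v∈) → v , assigned i v∈
      ; connected = λ i {x} {y} p q → Star.map (λ (a , b , e) → assigned i a , assigned i b , pieceOf-sound e)
                      (Cluster.connected (get i) (subst (λ j → x ∈ lookup Ds j) p (member x)) (subst (λ j → y ∈ lookup Ds j) q (member y)))
      ; lower     = λ i → subst (l ≤_) (weight-eq i) (Cluster.lower (get i))
      ; upper     = λ i → subst (_≤ u) (weight-eq i) (Cluster.upper (get i)) }
      where
      Ds = R ∷ Cs
      located : ∀ v → Any (v ∈_) Ds
      located v = ∈-concat⁻ Ds (∈-resp-↭ (↭-sym (Part.covers π)) (pieceOf-covers v))
      cluster : Fin n → Fin (length Ds)
      cluster v = Any.index (located v)
      member : ∀ v → v ∈ lookup Ds (cluster v)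
      member v = Anyₚ.lookup-index (located v)
      uDs : Unique (concat Ds)
      uDs = Unique-resp-↭ (↭-sym (Part.covers π)) pieceOf-unique
      assigned : ∀ i {v} → v ∈ lookup Ds i → cluster v ≡ i
      assigned i {v} = lookup-injective {xss = Ds} uDs (cluster v) i (member v)
      Ds-clusters : All (Cluster weight l u (arcs whole)) Ds
      Ds-clusters = record { connected = Part.R-conn π ; inhabited = _ , Part.root∈R π ; lower = l≤ ; upper = ≤u } ∷ Part.clusters π
      get : ∀ i → Cluster weight l u (arcs whole) (lookup Ds i)
      get i = All.lookup Ds-clusters (∈-lookup i)
      weight-eq : ∀ i → wt weight l u (lookup Ds i) ≡ wt weight l u (filter (λ v → cluster v ≟ i) (allFin n))
      weight-eq i = wt-↭ weight l u (unique⇒↭ (lookup-unique {xss = Ds} uDs i) (Uniqueₚ.filter⁺ (λ v → cluster v ≟ i) (Uniqueₚ.allFin⁺ n))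
        (λ v∈ → ∈-filter⁺ (λ v → cluster v ≟ i) (∈-allFin _) (assigned i v∈))
        (λ {v} v∈ → subst (λ j → v ∈ lookup Ds j) (proj₂ (∈-filter⁻ (λ v → cluster v ≟ i) {xs = allFin n} v∈)) (member v)))

-- 520 is `5 * 26 * 4`: 5 from the charge `5 Z` per vertex, 26 from `unit`, and 4 from squaring
-- `maxLength ≤ 2 p²`. The surplus `3 Z` left at the root pays for the final scan.
run-steps : ∀ {n} {G : WeightedGraph n} {r T} → Root G r → IsTreeRepresentation G r T →
            ∀ l u p → l ≤ u → 1 ≤ p →
            steps (cactusPartitionPoly l u p (WeightedGraph.weight G) T) ≤ 520 * (p ^ 4 * n ^ 2)
run-steps {n} {G} {r} {T} root-r tr l u p l≤u 1≤p = begin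
  1 + (s + steps (accepts w I))    ≤⟨ s≤s (+-monoʳ-≤ s (≤-trans (accepts-steps l u p w I) (s≤s |I|≤B))) ⟩
  1 + (s + (1 + B))                ≡⟨ solve 2 (λ s b → con 1 :+ (s :+ (con 1 :+ b)) := s :+ (con 2 :+ b)) refl s B ⟩
  s + (2 + B)                      ≤⟨ +-monoʳ-≤ s 2+B≤3Z ⟩
  s + 3 * Z                        ≤⟨ partition-steps w l u p l≤u 1≤p n T long unique-T 1≤n (≤-reflexive |T|≡n) ⟩
  length (verts (pieceOf T)) * (5 * Z) ≡⟨ cong (_* (5 * Z)) |T|≡n ⟩
  n * (5 * (n * (26 * (B * B))))   ≤⟨ *-monoʳ-≤ n (*-monoʳ-≤ 5 (*-monoʳ-≤ n (*-monoʳ-≤ 26 (*-mono-≤ B≤2p² B≤2p²)))) ⟩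
  n * (5 * (n * (26 * ((2 * (p * p)) * (2 * (p * p))))))
    ≡⟨ solve 2 (λ n p → n :* (con 5 :* (n :* (con 26 :* ((con 2 :* (p :* p)) :* (con 2 :* (p :* p))))))
                     := con 520 :* (p :^ 4 :* n :^ 2)) refl n p ⟩
  520 * (p ^ 4 * n ^ 2)            ∎
  where
  open ≤-Reasoning
  open +-*-Solver
  open Algorithm l u p hiding (cactusPartitionPoly)
  w = WeightedGraph.weight G
  unique-T = pieceOf-unique root-r tr
  long : LongCycles (cycles T)
  long = All.map proj₁ (IsTreeRepresentation.cycles-cycles tr)
  I = value (partition w T)
  s = steps (partition w T)
  B = maxLength l u p
  Z = n * (26 * (B * B))
  |I|≤B : length I ≤ B
  |I|≤B = valid-length l u p l≤u (Achieves-measured w l u p (pieceOf T)) (partition-represents w l u p l≤u 1≤p T long unique-T)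
  |T|≡n : length (verts (pieceOf T)) ≡ n
  |T|≡n = trans (↭-length (pieceOf-↭ root-r tr)) (length-tabulate id)
  1≤n : 1 ≤ n
  1≤n = >-nonZero⁻¹ n {{nonZeroIndex r}}
  B≤2p² : B ≤ 2 * (p * p)
  B≤2p² = +-monoʳ-≤ (p * p) (≤-trans (m≤n*m p p {{>-nonZero 1≤p}}) (m≤m+n (p * p) 0))
  1≤B : 1 ≤ B
  1≤B = ≤-trans 1≤p (m≤n+m p (p * p))
  2+B≤3Z : 2 + B ≤ 3 * Z
  2+B≤3Z = begin
    2 + B                 ≤⟨ +-mono-≤ (*-monoʳ-≤ 2 (*-mono-≤ 1≤B 1≤B)) (m≤n*m B B {{>-nonZero 1≤B}}) ⟩
    2 * (B * B) + B * B   ≡⟨ solve 1 (λ b → con 2 :* (b :* b) :+ b :* b := con 3 :* (b :* b)) refl B ⟩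
    3 * (B * B)           ≤⟨ *-monoʳ-≤ 3 (m≤n*m (B * B) 26) ⟩
    3 * (26 * (B * B))    ≤⟨ *-monoʳ-≤ 3 (m≤n*m (26 * (B * B)) n {{>-nonZero 1≤n}}) ⟩
    3 * Z                 ∎

theorem2 : ∃[ K ] (∀ {n : ℕ} (G : WeightedGraph n) (r : Fin n) (T : VertexNode n) (p l u : ℕ) →
    Connected G → Cactus G → Root G r → IsTreeRepresentation G r T →
    1 ≤ p → l ≤ u → (∀ v → WeightedGraph.weight G v ≤ u) →
    let run = cactusPartitionPoly l u p (WeightedGraph.weight G) T in
    ((value run ≡ true) ⇔ Partition G l u p)
    × steps run ≤ K * (p ^ 4 * n ^ 2))
theorem2 = 520 , λ {n} G r T p l u _ _ root-r tr 1≤p l≤u _ →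
  let accepted = accepts⇔ l u p l≤u (WeightedGraph.weight G)
        (partition-represents (WeightedGraph.weight G) l u p l≤u 1≤p T
          (All.map proj₁ (IsTreeRepresentation.cycles-cycles tr)) (pieceOf-unique root-r tr))
  in mk⇔
    (λ yes → case Equivalence.to accepted yes of λ (_ , a , l≤x , x≤u) → achieves⇒partition root-r tr l u p a l≤x x≤u)
    (λ π → Equivalence.from accepted (partition⇒achieves root-r tr l u p π))
  , run-steps root-r tr l u p l≤u 1≤p
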